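{- There are positive constants $C_0,C_2,C_3$ such that the following holds. Let $m,n$ be integers satisfying $C_0\le n<m<2n$ and let $\delta=n/m$. Let $r>m$ be an integer with $r\ge\left(\frac{1}{1-\delta}\right)^{C_2}n$. Then $$\chi^n(m,r)\ \ge\ \frac{1}{C_3}\,n(\ln(n))^2\,\ln\!\left(\frac{1}{1-\delta}\right).$$
   Context: Interval notation denotes sets of integers. For a finite set $Y$ of integers ("keys"), a storage function for $Y$ is a strictly order preserving map $f:Y\to[1,m]$ ($x<y$ implies $f(x)<f(y)$); $[1,m]$ is the set of cells of an array of size $m$. The online labeling (array loading) game $G^n(m,r)$, for integers $n\le m<r$, is played by an adversary and a (deterministic) algorithm in $n$ steps. At step $t\in[1,n]$ the adversary selects a key $y^t\in\{1,\dots,r\}\setminus\{y^1,\dots,y^{t-1}\}$, and the algorithm, before seeing later keys, responds with a storage function $f^t$ for the set $Y^t=\{y^1,\dots,y^t\}$. A key $y\in Y^t$ is relocated at step $t$ if $y=y^t$ or $f^t(y)\ne f^{t-1}(y)$; $Rel^t$ is the set of keys relocated at step $t$. The total cost is $\chi^n=\sum_{t=1}^n|Rel^t|$. The algorithm wants to minimize and the adversary to maximize this cost. $\chi^n(m,r)$ denotes the smallest cost that can be achieved by the algorithm against the best adversary, i.e. the minimum over algorithms of the maximum over adversary key sequences of the total cost. -}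

module Defs where

module OnlineLabeling where

  open import Data.Fin as Fin using (Fin; zero; suc)
  import Data.Fin.Properties as Fin
  open import Data.Irrelevant using (Irrelevant; [_])
  open import Data.List as List using (List; []; _∷_; allFin; filter; length)
  open import Data.List.Extrema.Nat using (argmax; argmin; f[xs]≤f[argmax]; f[argmin]≤f[xs])
  open import Data.List.Membership.Propositional using (_∈_)
  import Data.List.Membership.Propositional.Properties as ∈
  import Data.List.Relation.Unary.All as LAll
  open import Data.List.Relation.Unary.Any using (here; there)
  open import Data.Nat as ℕ using (ℕ; zero; suc; _≤_; _<_; _∸_; z≤n; s≤s)
  import Data.Nat.Properties as ℕ
  open import Data.Product using (Σ; ∃; _×_; _,_; proj₁; proj₂)
  open import Data.Refinement using (Refinement; Refinement-syntax; value; _,_)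
  open import Data.Vec as Vec using (Vec; []; _∷_; lookup)
  open import Data.Vec.Relation.Unary.All as VAll using (All; []; _∷_)
  import Data.Vec.Properties as Vec
  import Data.Vec.Relation.Unary.AllPairs as AllPairs
  open import Data.Vec.Relation.Unary.AllPairs using ([]; _∷_)
  open import Data.Vec.Relation.Unary.Unique.Propositional using (Unique)
  open import Function using (_∘_)
  open import Relation.Binary.PropositionalEquality
    using (_≡_; _≢_; refl; sym; trans; cong; subst)
  open import Relation.Nullary using (Dec; yes; no; ¬_; contradiction)
  open import Relation.Nullary.Decidable using (¬?; recompute; _→-dec_)
  open import Relation.Unary using (Decidable)

  private variable
    n m r t k : ℕ
    A B : Set

  -- Keys 1, …, r and cells 1, …, m are represented by Fin r and Fin m. A sequence
  -- of keys is listed with the most recent key first.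
  KeySeq : ℕ → ℕ → Set
  KeySeq r t = [ ys ∈ Vec (Fin r) t ∣ Unique ys ]

  before : KeySeq r (suc t) → KeySeq r t
  before (_ ∷ ys , [ u ]) = ys , [ AllPairs.tail u ]

  OrderPreserving : Vec (Fin r) t → Vec (Fin m) t → Set
  OrderPreserving ys cs =
    ∀ i j → lookup ys i Fin.< lookup ys j → lookup cs i Fin.< lookup cs j

  -- The i-th entry is the cell in which the i-th entry of ys is stored; the keys
  -- being distinct, such a vector is the same thing as a map on the set of keys.
  Storage : (m : ℕ) → KeySeq r t → Set
  Storage {t = t} m ys = [ cs ∈ Vec (Fin m) t ∣ OrderPreserving (value ys) cs ]

  -- A deterministic algorithm answers the keys received so far. At t = 0 there is
  -- only the empty storage function.
  Algorithm : (n m r : ℕ) → Set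
  Algorithm n m r = ∀ t → .(t ≤ n) → (ys : KeySeq r t) → Storage m ys

  module _ {ys : KeySeq r (suc t)} (f : Storage m (before ys)) (f⁺ : Storage m ys) where

    -- Indexed by positions in ys: the new key sits at zero, and position suc i of
    -- ys is position i of before ys.
    data Relocated : Fin (suc t) → Set where
      new   : Relocated zero
      moved : ∀ {i} → lookup (value f⁺) (suc i) ≢ lookup (value f) i → Relocated (suc i)

    relocated? : Decidable Relocated
    relocated? zero    = yes new
    relocated? (suc i) with lookup (value f⁺) (suc i) Fin.≟ lookup (value f) i
    ... | yes p = no λ { (moved q) → q p }
    ... | no  q = yes (moved q)

    Rel : List (Fin (suc t))
    Rel = filter relocated? (allFin (suc t))

  cost : Algorithm n m r → .(t ≤ n) → KeySeq r t → ℕ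
  cost {t = zero}  _ _   _  = 0
  cost {t = suc t} A t≤n ys =
    cost A (ℕ.<⇒≤ t≤n) (before ys) ℕ.+
    length (Rel {ys = ys} (A t (ℕ.<⇒≤ t≤n) (before ys)) (A (suc t) t≤n ys))

  totalCost : Algorithm n m r → KeySeq r n → ℕ
  totalCost A = cost A ℕ.≤-refl

  record Maximum (f : A → ℕ) : Set where
    field
      arg   : A
      bound : ∀ x → f x ≤ f arg
    max : ℕ
    max = f arg

  record Minimum (f : A → ℕ) : Set where
    field
      arg   : A
      bound : ∀ x → f arg ≤ f x
    min : ℕ
    min = f arg

  open Maximum using (max)
  open Minimum using (min)

  module Finiteness where

    Finite : Set → Set
    Finite A = Σ (List A) λ xs → ∀ x → x ∈ xs

    maximum : Finite A → A → (f : A → ℕ) → Maximum f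
    maximum (xs , c) a f = record
      { arg   = argmax f a xs
      ; bound = λ x → LAll.lookup (f[xs]≤f[argmax] {f = f} a xs) (c x)
      }

    minimum : Finite A → A → (f : A → ℕ) → Minimum f
    minimum (xs , c) a f = record
      { arg   = argmin f a xs
      ; bound = λ x → LAll.lookup (f[argmin]≤f[xs] {f = f} a xs) (c x)
      }

    finite-Vec : ∀ k t → Finite (Vec (Fin k) t)
    finite-Vec k zero    = [] ∷ [] , λ { [] → here refl }
    finite-Vec k (suc t) = List.cartesianProductWith _∷_ (allFin k) (proj₁ rec) , λ
      { (x ∷ xs) → ∈.∈-cartesianProductWith⁺ _∷_ (∈.∈-allFin x) (proj₂ rec xs) }
      where rec = finite-Vec k t

    finite-refine : {P : A → Set} → Decidable P → Finite A → Finite [ x ∈ A ∣ P x ]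
    finite-refine {A} {P} P? (xs , c) = select xs , λ { (x , [ p ]) → select-∈ xs p (c x) }
      where
      select : List A → List [ x ∈ A ∣ P x ]
      select []       = []
      select (x ∷ xs) with P? x
      ... | yes p = (x , [ p ]) ∷ select xs
      ... | no  _ = select xs

      select-∈ : ∀ {x} xs .(p : P x) → x ∈ xs → (x , [ p ]) ∈ select xs
      select-∈ (y ∷ ys) p (here refl) with P? y
      ... | yes _ = here refl
      ... | no ¬p = contradiction (recompute (P? y) p) ¬p
      select-∈ (y ∷ ys) p (there x∈) with P? y
      ... | yes _ = there (select-∈ ys p x∈)
      ... | no  _ = select-∈ ys p x∈

    finite-KeySeq : ∀ r t → Finite (KeySeq r t)
    finite-KeySeq r t =
      finite-refine (AllPairs.allPairs? (λ x y → ¬? (x Fin.≟ y))) (finite-Vec r t)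

    finite-Storage : (ys : KeySeq r t) → Finite (Storage m ys)
    finite-Storage {t = t} {m = m} ys = finite-refine
      (λ cs → Fin.all? λ i → Fin.all? λ j →
        (lookup (value ys) i Fin.<? lookup (value ys) j) →-dec (lookup cs i Fin.<? lookup cs j))
      (finite-Vec m t)

    Fresh : KeySeq r t → Set
    Fresh {r = r} ys = [ y ∈ Fin r ∣ All (y ≢_) (value ys) ]

    extend : (ys : KeySeq r t) → Fresh ys → KeySeq r (suc t)
    extend (ys , [ u ]) (y , [ y∉ ]) = y ∷ ys , [ y∉ ∷ u ]

    fresh? : (ys : Vec (Fin r) t) → Decidable λ y → All (y ≢_) ys
    fresh? ys y = VAll.all? (λ x → ¬? (y Fin.≟ x)) ys

    finite-Fresh : (ys : KeySeq r t) → Finite (Fresh ys)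
    finite-Fresh ys = finite-refine (fresh? (value ys)) (List.allFin _ , ∈.∈-allFin)

    index-of : (ys : Vec (Fin r) t) (y : Fin r) → ¬ All (y ≢_) ys → ∃ λ i → lookup ys i ≡ y
    index-of []       y ¬f = contradiction [] ¬f
    index-of (x ∷ ys) y ¬f with y Fin.≟ x
    ... | yes y≡x = zero , sym y≡x
    ... | no  y≢x with index-of ys y (λ f → ¬f (y≢x ∷ f))
    ...   | i , eq = suc i , eq

    fresh : .(t < r) → (ys : KeySeq r t) → Fresh ys
    fresh {t} {r} t<r ys with Fin.any? (fresh? (value ys))
    ... | yes (y , p) = y , [ p ]
    ... | no  none    = contradiction (Fin.injective⇒≤ inj) (ℕ.<⇒≱ (recompute (t ℕ.<? r) t<r))
      where
      at : ∀ y → ∃ λ i → lookup (value ys) i ≡ y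
      at y = index-of (value ys) y (λ f → none (y , f))
      inj : ∀ {x y} → proj₁ (at x) ≡ proj₁ (at y) → x ≡ y
      inj {x} {y} eq =
        trans (sym (proj₂ (at x))) (trans (cong (lookup (value ys)) eq) (proj₂ (at y)))

    someKeySeq : ∀ t → .(t ≤ r) → KeySeq r t
    someKeySeq zero    _   = [] , [ [] ]
    someKeySeq (suc t) t<r = extend ys (fresh t<r ys)
      where ys = someKeySeq t (ℕ.<⇒≤ t<r)

    rank : Vec (Fin r) t → Fin r → ℕ
    rank []       x = 0
    rank (y ∷ ys) x with y Fin.<? x
    ... | yes _ = suc (rank ys x)
    ... | no  _ = rank ys x

    rank≤ : (ys : Vec (Fin r) t) (x : Fin r) → rank ys x ≤ t
    rank≤ []       x = z≤n
    rank≤ (y ∷ ys) x with y Fin.<? x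
    ... | yes _ = s≤s (rank≤ ys x)
    ... | no  _ = ℕ.m≤n⇒m≤1+n (rank≤ ys x)

    rank< : (ys : Vec (Fin r) t) (i : Fin t) → rank ys (lookup ys i) < t
    rank< (y ∷ ys) zero with y Fin.<? y
    ... | yes y<y = contradiction y<y (ℕ.<-irrefl refl)
    ... | no  _   = s≤s (rank≤ ys y)
    rank< (y ∷ ys) (suc i) with y Fin.<? lookup ys i
    ... | yes _ = s≤s (rank< ys i)
    ... | no  _ = ℕ.m<n⇒m<1+n (rank< ys i)

    rank-mono-≤ : (ys : Vec (Fin r) t) {x z : Fin r} → x Fin.< z → rank ys x ≤ rank ys z
    rank-mono-≤ []       x<z = z≤n
    rank-mono-≤ (y ∷ ys) {x} {z} x<z with y Fin.<? x | y Fin.<? z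
    ... | yes _   | yes _   = s≤s (rank-mono-≤ ys x<z)
    ... | yes y<x | no  y≮z = contradiction (ℕ.<-trans y<x x<z) y≮z
    ... | no  _   | yes _   = ℕ.m≤n⇒m≤1+n (rank-mono-≤ ys x<z)
    ... | no  _   | no  _   = rank-mono-≤ ys x<z

    rank-mono-< : (ys : Vec (Fin r) t) (i : Fin t) {z : Fin r} →
                  lookup ys i Fin.< z → rank ys (lookup ys i) < rank ys z
    rank-mono-< (y ∷ ys) zero {z} y<z with y Fin.<? y | y Fin.<? z
    ... | yes y<y | _       = contradiction y<y (ℕ.<-irrefl refl)
    ... | no  _   | yes _   = s≤s (rank-mono-≤ ys y<z)
    ... | no  _   | no  y≮z = contradiction y<z y≮z
    rank-mono-< (y ∷ ys) (suc i) {z} x<z with y Fin.<? lookup ys i | y Fin.<? z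
    ... | yes _   | yes _   = s≤s (rank-mono-< ys i x<z)
    ... | yes y<x | no  y≮z = contradiction (ℕ.<-trans y<x x<z) y≮z
    ... | no  _   | yes _   = ℕ.m<n⇒m<1+n (rank-mono-< ys i x<z)
    ... | no  _   | no  _   = rank-mono-< ys i x<z

    someStorage : .(t ≤ m) → (ys : KeySeq r t) → Storage m ys
    someStorage {t} {m} {r} t≤m ys = Vec.tabulate cell , [ mono ]
      where
      cell : Fin t → Fin m
      cell i = Fin.fromℕ< (ℕ.<-≤-trans (rank< (value ys) i) (recompute (t ℕ.≤? m) t≤m))
      mono : OrderPreserving (value ys) (Vec.tabulate cell)
      mono i j y<y
        rewrite Vec.lookup∘tabulate cell i
              | Vec.lookup∘tabulate cell j
              | Fin.toℕ-fromℕ< (ℕ.<-≤-trans (rank< (value ys) i) (recompute (t ℕ.≤? m) t≤m))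
              | Fin.toℕ-fromℕ< (ℕ.<-≤-trans (rank< (value ys) j) (recompute (t ℕ.≤? m) t≤m))
        = rank-mono-< (value ys) i y<y

  open Finiteness

  worstCase : .(n ≤ r) → (A : Algorithm n m r) → Maximum (totalCost A)
  worstCase {n} {r} n≤r A = maximum (finite-KeySeq r n) (someKeySeq n n≤r) (totalCost A)

  -- An optimal algorithm exists, by backward induction over the remaining steps.
  module Optimal {n m r : ℕ} .(n≤m : n ≤ m) .(m<r : m < r) where

    step : .(suc k ℕ.+ t ≡ n) → k ℕ.+ suc t ≡ n
    step {k} {t} eq = trans (ℕ.+-suc k t) (recompute (suc k ℕ.+ t ℕ.≟ n) eq)

    next≤n : .(suc k ℕ.+ t ≡ n) → suc t ≤ n
    next≤n {k} {t} eq = subst (suc t ≤_) (step {k} eq) (ℕ.m≤n+m (suc t) k)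

    optimum : ∀ k → .(k ℕ.+ t ≡ n) → (ys : KeySeq r t) → Storage m ys → ℕ

    reply : ∀ k → .(eq : suc k ℕ.+ t ≡ n) → (ys : KeySeq r t) (f : Storage m ys) (y : Fresh ys) →
            Minimum {A = Storage m (extend ys y)} λ f⁺ →
              length (Rel {ys = extend ys y} f f⁺) ℕ.+ optimum k (step {k} eq) (extend ys y) f⁺

    worst : ∀ k → .(eq : suc k ℕ.+ t ≡ n) → (ys : KeySeq r t) (f : Storage m ys) →
            Maximum λ y → min (reply k eq ys f y)

    optimum zero    _  ys f = 0
    optimum (suc k) eq ys f = max (worst k eq ys f)

    reply k eq ys f y = minimum
      (finite-Storage (extend ys y))
      (someStorage (ℕ.≤-trans (next≤n {k} eq) n≤m) (extend ys y)) _

    worst k eq ys f = maximum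
      (finite-Fresh ys)
      (fresh (ℕ.≤-<-trans (ℕ.<⇒≤ (next≤n {k} eq)) (ℕ.≤-<-trans n≤m m<r)) ys) _

    play : ∀ {t} k → .(k ℕ.+ t ≡ n) → (ys : KeySeq r t) → Storage m ys
    play {zero}  k eq ([] , _) = [] , [ (λ ()) ]
    play {suc t} k eq (y ∷ ys , [ u ]) =
      Minimum.arg (reply k eq′ ys′ (play {t} (suc k) eq′ ys′) (y , [ AllPairs.head u ]))
      where
      ys′ : KeySeq r t
      ys′ = ys , [ AllPairs.tail u ]
      eq′ : suc k ℕ.+ t ≡ n
      eq′ = trans (sym (ℕ.+-suc k t)) (recompute (k ℕ.+ suc t ℕ.≟ n) eq)

    best : Algorithm n m r
    best t t≤n ys = play (n ∸ t) (ℕ.m∸n+n≡m t≤n) ys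

    play-best : ∀ k → .(eq : k ℕ.+ t ≡ n) → .(t≤n : t ≤ n) → (ys : KeySeq r t) →
                best t t≤n ys ≡ play k eq ys
    play-best {t} k eq t≤n ys = go (n ∸ t) (ℕ.m∸n+n≡m t≤n) (ℕ.+-cancelʳ-≡ t (n ∸ t) k
      (trans (ℕ.m∸n+n≡m (recompute (t ℕ.≤? n) t≤n)) (sym (recompute (k ℕ.+ t ℕ.≟ n) eq))))
      where
      go : ∀ j → .(eq′ : j ℕ.+ t ≡ n) → j ≡ k → play j eq′ ys ≡ play k eq ys
      go j _ refl = refl

    value₀ : ℕ
    value₀ = optimum n (ℕ.+-identityʳ n) ([] , [ [] ]) ([] , [ (λ ()) ])

    upper : ∀ {t} k → .(eq : k ℕ.+ t ≡ n) → .(t≤n : t ≤ n) → (ys : KeySeq r t) →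
            cost best t≤n ys ℕ.+ optimum k eq ys (play k eq ys) ≤ value₀
    upper {zero} k eq t≤n ([] , _) = go k eq
      (trans (sym (ℕ.+-identityʳ k)) (recompute (k ℕ.+ 0 ℕ.≟ n) eq))
      where
      go : ∀ k → .(eq : k ℕ.+ 0 ≡ n) → k ≡ n → optimum k eq ([] , [ [] ]) ([] , [ (λ ()) ]) ≤ value₀
      go k _ refl = ℕ.≤-refl
    upper {suc t} k eq t≤n ys⁺@(y ∷ ys , [ u ]) = begin
      c ℕ.+ length (Rel {ys = ys⁺} (best t (ℕ.<⇒≤ t≤n) ys′) (best (suc t) t≤n ys⁺)) ℕ.+ o
        ≡⟨ cong (ℕ._+ o) (cong (c ℕ.+_)
             (trans (cong (λ f → length (Rel {ys = ys⁺} f (best (suc t) t≤n ys⁺))) (play-best (suc k) eq′ (ℕ.<⇒≤ t≤n) ys′))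
                    (cong (λ f → length (Rel {ys = ys⁺} (play (suc k) eq′ ys′) f)) (play-best k eq t≤n ys⁺)))) ⟩
      c ℕ.+ length (Rel {ys = ys⁺} (play (suc k) eq′ ys′) (play k eq ys⁺)) ℕ.+ o
        ≡⟨ ℕ.+-assoc c _ o ⟩
      c ℕ.+ min (reply k eq′ ys′ (play (suc k) eq′ ys′) y′)
        ≤⟨ ℕ.+-monoʳ-≤ c (Maximum.bound (worst k eq′ ys′ (play (suc k) eq′ ys′)) y′) ⟩
      c ℕ.+ optimum (suc k) eq′ ys′ (play (suc k) eq′ ys′)
        ≤⟨ upper (suc k) eq′ (ℕ.<⇒≤ t≤n) ys′ ⟩
      value₀ ∎
      where
      open ℕ.≤-Reasoning
      ys′ : KeySeq r t
      ys′ = before ys⁺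
      y′ : Fresh ys′
      y′ = y , [ AllPairs.head u ]
      eq′ : suc k ℕ.+ t ≡ n
      eq′ = trans (sym (ℕ.+-suc k t)) (recompute (k ℕ.+ suc t ℕ.≟ n) eq)
      c o : ℕ
      c = cost best (ℕ.<⇒≤ t≤n) ys′
      o = optimum k eq ys⁺ (play k eq ys⁺)

    lower : (A : Algorithm n m r) → ∀ {t} k → .(eq : k ℕ.+ t ≡ n) → .(t≤n : t ≤ n) → (ys : KeySeq r t) →
            ∃ λ zs → cost A t≤n ys ℕ.+ optimum k eq ys (A t t≤n ys) ≤ totalCost A zs
    lower A {t} zero eq t≤n ys with recompute (t ℕ.≟ n) eq
    ... | refl = ys , ℕ.≤-reflexive (ℕ.+-identityʳ _)
    lower A {t} (suc k) eq t≤n ys = proj₁ rec , (begin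
      c ℕ.+ min (reply k eq ys (A t t≤n ys) y)
        ≤⟨ ℕ.+-monoʳ-≤ c (Minimum.bound (reply k eq ys (A t t≤n ys) y) (A (suc t) t<n ys⁺)) ⟩
      c ℕ.+ (length (Rel {ys = ys⁺} (A t t≤n ys) (A (suc t) t<n ys⁺)) ℕ.+ optimum k (step {k} eq) ys⁺ (A (suc t) t<n ys⁺))
        ≡⟨ ℕ.+-assoc c _ _ ⟨
      cost A t<n ys⁺ ℕ.+ optimum k (step {k} eq) ys⁺ (A (suc t) t<n ys⁺)
        ≤⟨ proj₂ rec ⟩
      totalCost A (proj₁ rec) ∎)
      where
      open ℕ.≤-Reasoning
      t<n : suc t ≤ n
      t<n = next≤n {k} eq
      y : Fresh ys
      y = Maximum.arg (worst k eq ys (A t t≤n ys))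
      ys⁺ : KeySeq r (suc t)
      ys⁺ = extend ys y
      c : ℕ
      c = cost A t≤n ys
      rec = lower A k (step {k} eq) t<n ys⁺

  optimalAlgorithm : ∀ n m r → .(n≤m : n ≤ m) → .(m<r : m < r) →
    Minimum {A = Algorithm n m r} λ A → max (worstCase (ℕ.<⇒≤ (ℕ.≤-<-trans n≤m m<r)) A)
  optimalAlgorithm n m r n≤m m<r = record
    { arg   = best
    ; bound = λ A → ℕ.≤-trans (upper′ (Maximum.arg (worstCase n≤r best))) (lower′ A)
    }
    where
    open Optimal {n} {m} {r} n≤m m<r
    n≤r : n ≤ r
    n≤r = ℕ.<⇒≤ (ℕ.≤-<-trans (recompute (n ℕ.≤? m) n≤m) (recompute (m ℕ.<? r) m<r))
    upper′ : ∀ ys → totalCost best ys ≤ value₀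
    upper′ ys = ℕ.≤-trans (ℕ.≤-reflexive (sym (ℕ.+-identityʳ _))) (upper 0 refl ℕ.≤-refl ys)
    lower′ : ∀ A → value₀ ≤ max (worstCase n≤r A)
    lower′ A with A 0 z≤n ([] , [ [] ]) | lower A n (ℕ.+-identityʳ n) z≤n ([] , [ [] ])
    ... | [] , _ | zs , le = ℕ.≤-trans le (Maximum.bound (worstCase n≤r A) zs)

  -- min over algorithms A of max over sequences of n distinct keys of totalCost A.
  χ : ∀ n m r → .(n ≤ m) → .(m < r) → ℕ
  χ n m r n≤m m<r = min (optimalAlgorithm n m r n≤m m<r)

module Reals where

  open import Data.Integer as ℤ using (+_)
  import Data.Integer.Properties as ℤ
  open import Data.Nat as ℕ using (ℕ; zero; suc)
  import Data.Nat.Properties as ℕ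
  open import Data.Product using (∃; _×_; _,_; proj₁; proj₂)
  open import Data.Rational as ℚ using (ℚ; mkℚ; 0ℚ; 1ℚ; _+_; _*_; _-_; -_; _/_; 1/_; _≤_; _<_; ∣_∣; Positive; NonNegative; NonZero)
  import Data.Rational.Properties as ℚ
  open import Data.Rational.Solver using (module +-*-Solver)
  import Data.Rational.Unnormalised as ℚᵘ
  import Data.Rational.Unnormalised.Properties as ℚᵘ
  open import Data.Sum using (_⊎_; inj₁; inj₂)
  open import Relation.Binary.PropositionalEquality
    using (_≡_; refl; sym; trans; cong; cong₂; subst)

  open import Algebra.Definitions.RawSemiring ℚ.+-*-rawSemiring public using (_^_)

  toℚ : ℕ → ℚ
  toℚ n = + n / 1

  private

    open +-*-Solver

    flip-sub : ∀ p q → p - q ≡ - (q - p)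
    flip-sub = solve 2 (λ p q → p :- q := :- (q :- p)) refl

    sub-add : ∀ a b → b ≡ (b - a) + a
    sub-add = solve 2 (λ a b → b := (b :- a) :+ a) refl

    add-sub : ∀ s x → s + x - s ≡ x
    add-sub = solve 2 (λ s x → s :+ x :- s := x) refl

    product-diff : ∀ a b c d → a * b - c * d ≡ a * (b - d) + (a - c) * d
    product-diff = solve 4 (λ a b c d → a :* b :- c :* d := a :* (b :- d) :+ (a :- c) :* d) refl

    collect : ∀ B C e v → B * (e * v) + (e * v) * C ≡ e * ((B + C) * v)
    collect = solve 4 (λ B C e v → B :* (e :* v) :+ (e :* v) :* C := e :* ((B :+ C) :* v)) refl

    rotate : ∀ d e c → d * e * c ≡ e * (c * d)
    rotate = solve 3 (λ d e c → d :* e :* c := e :* (c :* d)) refl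

    cancel-mid : ∀ o w u → w * (o - u) + w * u ≡ w * o
    cancel-mid = solve 3 (λ o w u → w :* (o :- u) :+ w :* u := w :* o) refl

    factor : ∀ o s x w u c p → x ≡ c * p → s + o * x + w * (c * (u * p)) ≡ s + (o + w * u) * x
    factor o s _ w u c p refl =
      solve 6 (λ o s c p w u → s :+ o :* (c :* p) :+ w :* (c :* (u :* p)) := s :+ (o :+ w :* u) :* (c :* p)) refl o s c p w u

    neg-square : ∀ p → (- p) * (- p) ≡ p * p
    neg-square = solve 1 (λ p → (:- p) :* (:- p) := p :* p) refl

    square-diff : ∀ o x v → (x + o) * v * ((x + o) * v) - (x - o) * v * ((x - o) * v) ≡
                            (o * v + o * v) * (x * v + x * v)
    square-diff = solve 3 (λ o x v →
      (x :+ o) :* v :* ((x :+ o) :* v) :- (x :- o) :* v :* ((x :- o) :* v)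
        := (o :* v :+ o :* v) :* (x :* v :+ x :* v)) refl

  -- Cauchy sequences of rationals; distinct sequences may represent the same real.
  record ℝ : Set where
    field
      approx : ℕ → ℚ
      cauchy : ∀ ε → 0ℚ < ε → ∃ λ N → ∀ i j → N ℕ.≤ i → N ℕ.≤ j → ∣ approx i - approx j ∣ ≤ ε

  open ℝ public

  infix 4 _≤ℝ_ _≥ℝ_
  -- lim x ≤ lim y.
  _≤ℝ_ : ℝ → ℝ → Set
  x ≤ℝ y = ∀ ε → 0ℚ < ε → ∃ λ N → ∀ i → N ℕ.≤ i → approx x i ≤ approx y i + ε

  _≥ℝ_ : ℝ → ℝ → Set
  x ≥ℝ y = y ≤ℝ x

  fromℚ : ℚ → ℝ
  fromℚ q = record
    { approx = λ _ → q
    ; cauchy = λ ε ε>0 → 0 , λ _ _ _ _ →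
        ℚ.≤-trans (ℚ.≤-reflexive (cong ∣_∣ (ℚ.+-inverseʳ q))) (ℚ.<⇒≤ ε>0)
    }

  module Products where

    abs-swap : ∀ p q → ∣ p - q ∣ ≡ ∣ q - p ∣
    abs-swap p q = trans (cong ∣_∣ (flip-sub p q)) (ℚ.∣-p∣≡∣p∣ (q - p))

    0≤-diff : ∀ {p q} → p ≤ q → 0ℚ ≤ q - p
    0≤-diff {p} {q} p≤q = subst (_≤ q - p) (ℚ.+-inverseʳ p) (ℚ.+-monoˡ-≤ (- p) p≤q)

    0≤* : ∀ {p q} → 0ℚ ≤ p → 0ℚ ≤ q → 0ℚ ≤ p * q
    0≤* {p} {q} 0≤p 0≤q =
      ℚ.nonNegative⁻¹ (p * q) {{ℚ.nonNeg*nonNeg⇒nonNeg p {{ℚ.nonNegative 0≤p}} q {{ℚ.nonNegative 0≤q}}}}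

    *-mono : ∀ {p q r s} → 0ℚ ≤ q → 0ℚ ≤ r → p ≤ q → r ≤ s → p * r ≤ q * s
    *-mono {p} {q} {r} {s} 0≤q 0≤r p≤q r≤s = ℚ.≤-trans
      (ℚ.*-monoʳ-≤-nonNeg r {{ℚ.nonNegative 0≤r}} p≤q)
      (ℚ.*-monoˡ-≤-nonNeg q {{ℚ.nonNegative 0≤q}} r≤s)

    eventuallyBounded : (x : ℝ) → ∃ λ B → 0ℚ < B × ∃ λ N → ∀ i → N ℕ.≤ i → ∣ approx x i ∣ ≤ B
    eventuallyBounded x with cauchy x 1ℚ (ℚ.positive⁻¹ 1ℚ)
    ... | N , close = 1ℚ + ∣ a ∣
      , ℚ.<-≤-trans (ℚ.positive⁻¹ 1ℚ)
          (subst (_≤ 1ℚ + ∣ a ∣) (ℚ.+-identityʳ 1ℚ) (ℚ.+-monoʳ-≤ 1ℚ (ℚ.0≤∣p∣ a)))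
      , N , λ i N≤i → let b = approx x i in begin
          ∣ b ∣             ≡⟨ cong ∣_∣ (sub-add a b) ⟩
          ∣ (b - a) + a ∣   ≤⟨ ℚ.∣p+q∣≤∣p∣+∣q∣ (b - a) a ⟩
          ∣ b - a ∣ + ∣ a ∣ ≤⟨ ℚ.+-monoˡ-≤ ∣ a ∣ (close i N N≤i ℕ.≤-refl) ⟩
          1ℚ + ∣ a ∣        ∎
      where
      open ℚ.≤-Reasoning
      a : ℚ
      a = approx x N

    product-bound : ∀ a b c d B C e → 0ℚ ≤ B → 0ℚ ≤ e →
                    ∣ a ∣ ≤ B → ∣ d ∣ ≤ C → ∣ a - c ∣ ≤ e → ∣ b - d ∣ ≤ e →
                    ∣ a * b - c * d ∣ ≤ B * e + e * C
    product-bound a b c d B C e 0≤B 0≤e a≤B d≤C ac bd = begin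
      ∣ a * b - c * d ∣
        ≡⟨ cong ∣_∣ (product-diff a b c d) ⟩
      ∣ a * (b - d) + (a - c) * d ∣
        ≤⟨ ℚ.∣p+q∣≤∣p∣+∣q∣ (a * (b - d)) ((a - c) * d) ⟩
      ∣ a * (b - d) ∣ + ∣ (a - c) * d ∣
        ≡⟨ cong₂ _+_ (ℚ.∣p*q∣≡∣p∣*∣q∣ a (b - d)) (ℚ.∣p*q∣≡∣p∣*∣q∣ (a - c) d) ⟩
      ∣ a ∣ * ∣ b - d ∣ + ∣ a - c ∣ * ∣ d ∣
        ≤⟨ ℚ.+-mono-≤ {∣ a ∣ * ∣ b - d ∣} {B * e} {∣ a - c ∣ * ∣ d ∣} {e * C}
             (*-mono {∣ a ∣} {B} {∣ b - d ∣} {e} 0≤B (ℚ.0≤∣p∣ (b - d)) a≤B bd)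
             (*-mono {∣ a - c ∣} {e} {∣ d ∣} {C} 0≤e (ℚ.0≤∣p∣ d) ac d≤C) ⟩
      B * e + e * C ∎
      where open ℚ.≤-Reasoning

    split : ∀ B C → 0ℚ < B → 0ℚ < C → ∀ ε → 0ℚ < ε → ∃ λ e → 0ℚ < e × B * e + e * C ≤ ε
    split B C B>0 C>0 ε ε>0 = ε * v , ℚ.positive⁻¹ (ε * v) {{e>0}} , (begin
      B * (ε * v) + (ε * v) * C ≡⟨ collect B C ε v ⟩
      ε * (D * v)               ≡⟨ cong (ε *_) (ℚ.*-inverseʳ D) ⟩
      ε * 1ℚ                    ≡⟨ ℚ.*-identityʳ ε ⟩
      ε ∎)
      where
      open ℚ.≤-Reasoning
      D : ℚ
      D = B + C
      D>0 : Positive D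
      D>0 = ℚ.pos+pos⇒pos B {{ℚ.positive B>0}} C {{ℚ.positive C>0}}
      instance
        D≢0 : NonZero D
        D≢0 = ℚ.pos⇒nonZero D {{D>0}}
      v : ℚ
      v = 1/ D
      e>0 : Positive (ε * v)
      e>0 = ℚ.pos*pos⇒pos ε {{ℚ.positive ε>0}} v {{ℚ.1/pos⇒pos D {{D>0}}}}

    *-cauchy : ∀ x y ε → 0ℚ < ε → ∃ λ N → ∀ i j → N ℕ.≤ i → N ℕ.≤ j →
               ∣ approx x i * approx y i - approx x j * approx y j ∣ ≤ ε
    *-cauchy x y ε ε>0 = from (eventuallyBounded x) (eventuallyBounded y)
      where
      Goal : Set
      Goal = ∃ λ N → ∀ i j → N ℕ.≤ i → N ℕ.≤ j →
             ∣ approx x i * approx y i - approx x j * approx y j ∣ ≤ ε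
      Bounded Close : ℝ → ℚ → Set
      Bounded z B = ∃ λ N → ∀ i → N ℕ.≤ i → ∣ approx z i ∣ ≤ B
      Close z e = ∃ λ N → ∀ i j → N ℕ.≤ i → N ℕ.≤ j → ∣ approx z i - approx z j ∣ ≤ e
      finish : ∀ B C e → 0ℚ < B → 0ℚ < e → B * e + e * C ≤ ε →
               Bounded x B → Bounded y C → Close x e → Close y e → Goal
      finish B C e B>0 e>0 e≤ε (M , bx) (N , by) (P , cx) (Q , cy) =
        (M ℕ.⊔ N) ℕ.⊔ (P ℕ.⊔ Q) , λ i j K≤i K≤j →
        let M⊔N≤ : ∀ {o} → (M ℕ.⊔ N) ℕ.⊔ (P ℕ.⊔ Q) ℕ.≤ o → M ℕ.⊔ N ℕ.≤ o
            M⊔N≤ = ℕ.m⊔n≤o⇒m≤o (M ℕ.⊔ N) (P ℕ.⊔ Q)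
            P⊔Q≤ : ∀ {o} → (M ℕ.⊔ N) ℕ.⊔ (P ℕ.⊔ Q) ℕ.≤ o → P ℕ.⊔ Q ℕ.≤ o
            P⊔Q≤ = ℕ.m⊔n≤o⇒n≤o (M ℕ.⊔ N) (P ℕ.⊔ Q)
            a = approx x i
            b = approx y i
            c = approx x j
            d = approx y j
        in ℚ.≤-trans {∣ a * b - c * d ∣} {B * e + e * C} {ε}
          (product-bound a b c d B C e (ℚ.<⇒≤ B>0) (ℚ.<⇒≤ e>0)
            (bx i (ℕ.m⊔n≤o⇒m≤o M N (M⊔N≤ K≤i)))
            (by j (ℕ.m⊔n≤o⇒n≤o M N (M⊔N≤ K≤j)))
            (cx i j (ℕ.m⊔n≤o⇒m≤o P Q (P⊔Q≤ K≤i)) (ℕ.m⊔n≤o⇒m≤o P Q (P⊔Q≤ K≤j)))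
            (cy i j (ℕ.m⊔n≤o⇒n≤o P Q (P⊔Q≤ K≤i)) (ℕ.m⊔n≤o⇒n≤o P Q (P⊔Q≤ K≤j))))
          e≤ε
      from : (∃ λ B → 0ℚ < B × Bounded x B) → (∃ λ C → 0ℚ < C × Bounded y C) → Goal
      from (B , B>0 , bx) (C , C>0 , by) =
        let e , e>0 , e≤ε = split B C B>0 C>0 ε ε>0
        in finish B C e B>0 e>0 e≤ε bx by (cauchy x e e>0) (cauchy y e e>0)

  open Products

  infixl 7 _*ℝ_
  _*ℝ_ : ℝ → ℝ → ℝ
  x *ℝ y = record { approx = λ i → approx x i * approx y i ; cauchy = *-cauchy x y }

  -- Partial sums of Σₖ uᵏ/(2k+1), that is of artanh z / z for u = z².
  artanhSum : ℚ → ℕ → ℚ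
  artanhSum u zero    = 0ℚ
  artanhSum u (suc k) = artanhSum u k + + 1 / suc (2 ℕ.* k) * u ^ k

  module Series where

    coeff : ℕ → ℚ
    coeff k = + 1 / suc (2 ℕ.* k)

    toℚᵘ-/ : ∀ p d → ℚ.toℚᵘ (p / suc d) ℚᵘ.≃ ℚᵘ.mkℚᵘ p d
    toℚᵘ-/ p d = ℚ.toℚᵘ-fromℚᵘ (ℚᵘ.mkℚᵘ p d)

    /-≤ : ∀ p d q e → p ℤ.* + suc e ℤ.≤ q ℤ.* + suc d → p / suc d ≤ q / suc e
    /-≤ p d q e le = ℚ.toℚᵘ-cancel-≤
      (ℚᵘ.≤-respˡ-≃ (ℚᵘ.≃-sym (toℚᵘ-/ p d)) (ℚᵘ.≤-respʳ-≃ (ℚᵘ.≃-sym (toℚᵘ-/ q e)) (ℚᵘ.*≤* le)))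

    toℚ-mono : ∀ {a b} → a ℕ.≤ b → toℚ a ≤ toℚ b
    toℚ-mono {a} {b} a≤b = /-≤ (+ a) 0 (+ b) 0 (ℤ.*-monoʳ-≤-nonNeg (+ 1) (ℤ.+≤+ a≤b))

    archimedean : ∀ q → q ≤ toℚ ℤ.∣ ℚ.numerator q ∣
    archimedean q@(mkℚ p d _) = ℚ.toℚᵘ-cancel-≤ (ℚᵘ.≤-respʳ-≃ (ℚᵘ.≃-sym (toℚᵘ-/ (+ ℤ.∣ p ∣) 0)) (ℚᵘ.*≤* (lem p)))
      where
      lem : ∀ p → p ℤ.* + 1 ℤ.≤ + ℤ.∣ p ∣ ℤ.* + suc d
      lem (+ a)      = ℤ.*-monoˡ-≤-nonNeg (+ a) (ℤ.+≤+ (ℕ.s≤s ℕ.z≤n))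
      lem ℤ.-[1+ a ] = ℤ.-≤+

    coeff-inverse : ∀ k → coeff k * toℚ (suc (2 ℕ.* k)) ≡ 1ℚ
    coeff-inverse k = ℚ.toℚᵘ-injective (ℚᵘ.≃-trans
      (ℚ.toℚᵘ-homo-* (coeff k) (toℚ (suc (2 ℕ.* k))))
      (ℚᵘ.≃-trans
        (ℚᵘ.*-cong (toℚᵘ-/ (+ 1) (2 ℕ.* k)) (toℚᵘ-/ (+ suc (2 ℕ.* k)) 0))
        (ℚᵘ.*≡* (ℤ.*-assoc (+ 1) (+ suc (2 ℕ.* k)) (+ 1)))))

    coeff≥0 : ∀ k → 0ℚ ≤ coeff k
    coeff≥0 k = /-≤ (+ 0) 0 (+ 1) (2 ℕ.* k) (ℤ.+≤+ ℕ.z≤n)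

    coeff-anti : ∀ {i j} → i ℕ.≤ j → coeff j ≤ coeff i
    coeff-anti {i} {j} i≤j = /-≤ (+ 1) (2 ℕ.* j) (+ 1) (2 ℕ.* i)
      (ℤ.*-monoˡ-≤-nonNeg (+ 1) (ℤ.+≤+ (ℕ.s≤s (ℕ.*-monoʳ-≤ 2 i≤j))))

    coeff→0 : ∀ B ε → 0ℚ < ε → ∃ λ N → B * coeff N ≤ ε
    coeff→0 B ε ε>0 = N , (begin
      B * c                ≡⟨ cong (_* c) (sym (ℚ.*-identityʳ B)) ⟩
      B * 1ℚ * c           ≡⟨ cong (λ o → B * o * c) (sym (ℚ.*-inverseˡ ε)) ⟩
      B * (1/ ε * ε) * c   ≡⟨ cong (_* c) (sym (ℚ.*-assoc B (1/ ε) ε)) ⟩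
      B * 1/ ε * ε * c     ≤⟨ ℚ.*-monoʳ-≤-nonNeg c {{ℚ.nonNegative (coeff≥0 N)}}
                                (ℚ.*-monoʳ-≤-nonNeg ε {{ℚ.nonNegative (ℚ.<⇒≤ ε>0)}}
                                  (ℚ.≤-trans (archimedean (B * 1/ ε))
                                    (toℚ-mono (ℕ.≤-trans (ℕ.m≤n*m N 2) (ℕ.n≤1+n _))))) ⟩
      d * ε * c            ≡⟨ rotate d ε c ⟩
      ε * (c * d)          ≡⟨ cong (ε *_) (coeff-inverse N) ⟩
      ε * 1ℚ               ≡⟨ ℚ.*-identityʳ ε ⟩
      ε ∎)
      where
      open ℚ.≤-Reasoning
      instance
        ε≢0 : NonZero ε
        ε≢0 = ℚ.pos⇒nonZero ε {{ℚ.positive ε>0}}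
      N : ℕ
      N = ℤ.∣ ℚ.numerator (B * 1/ ε) ∣
      c d : ℚ
      c = coeff N
      d = toℚ (suc (2 ℕ.* N))

    module Tail (u : ℚ) (u≥0 : 0ℚ ≤ u) (1-u>0 : 0ℚ < 1ℚ - u) where
      open ℚ.≤-Reasoning

      instance
        1-u⁺ : Positive (1ℚ - u)
        1-u⁺ = ℚ.positive 1-u>0
        1-u≢0 : NonZero (1ℚ - u)
        1-u≢0 = ℚ.pos⇒nonZero (1ℚ - u)

      w : ℚ
      w = 1/ (1ℚ - u)

      w≥0 : 0ℚ ≤ w
      w≥0 = ℚ.<⇒≤ (ℚ.positive⁻¹ w {{ℚ.1/pos⇒pos (1ℚ - u)}})

      1+wu≡w : 1ℚ + w * u ≡ w
      1+wu≡w = begin-equality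
        1ℚ + w * u               ≡⟨ cong (_+ w * u) (sym (ℚ.*-inverseˡ (1ℚ - u))) ⟩
        w * (1ℚ - u) + w * u     ≡⟨ cancel-mid 1ℚ w u ⟩
        w * 1ℚ                   ≡⟨ ℚ.*-identityʳ w ⟩
        w ∎

      u≤1 : u ≤ 1ℚ
      u≤1 = begin
        u               ≡⟨ ℚ.+-identityˡ u ⟨
        0ℚ + u          ≤⟨ ℚ.+-monoˡ-≤ u (ℚ.<⇒≤ 1-u>0) ⟩
        1ℚ - u + u      ≡⟨ sym (sub-add u 1ℚ) ⟩
        1ℚ ∎

      pow≥0 : ∀ k → 0ℚ ≤ u ^ k
      pow≥0 zero    = ℚ.<⇒≤ (ℚ.positive⁻¹ 1ℚ)
      pow≥0 (suc k) = 0≤* u≥0 (pow≥0 k)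

      pow≤1 : ∀ k → u ^ k ≤ 1ℚ
      pow≤1 zero    = ℚ.≤-refl
      pow≤1 (suc k) = *-mono (ℚ.<⇒≤ (ℚ.positive⁻¹ 1ℚ)) (pow≥0 k) u≤1 (pow≤1 k)

      S V : ℕ → ℚ
      S = artanhSum u
      V k = S k + w * (coeff k * u ^ k)

      S-step : ∀ k → S k ≤ S (suc k)
      S-step k = subst (_≤ S (suc k)) (ℚ.+-identityʳ (S k)) (ℚ.+-monoʳ-≤ (S k) (0≤* (coeff≥0 k) (pow≥0 k)))

      V-step : ∀ k → V (suc k) ≤ V k
      V-step k = begin
        s + c * p + w * (coeff (suc k) * (u * p))
          ≤⟨ ℚ.+-monoʳ-≤ (s + c * p) (ℚ.*-monoˡ-≤-nonNeg w {{ℚ.nonNegative w≥0}}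
               (ℚ.*-monoʳ-≤-nonNeg (u * p) {{ℚ.nonNegative (pow≥0 (suc k))}} (coeff-anti (ℕ.n≤1+n k)))) ⟩
        s + c * p + w * (c * (u * p))
          ≡⟨ cong (λ x → s + x + w * (c * (u * p))) (sym (ℚ.*-identityˡ (c * p))) ⟩
        s + 1ℚ * (c * p) + w * (c * (u * p))
          ≡⟨ factor 1ℚ s (c * p) w u c p refl ⟩
        s + (1ℚ + w * u) * (c * p)
          ≡⟨ cong (λ x → s + x * (c * p)) 1+wu≡w ⟩
        s + w * (c * p) ∎
        where
        s c p : ℚ
        s = S k
        c = coeff k
        p = u ^ k

      S-mono : ∀ i j → i ℕ.≤′ j → S i ≤ S j
      S-mono i .i      ℕ.≤′-refl       = ℚ.≤-refl {S i}
      S-mono i (suc j) (ℕ.≤′-step i≤j) = ℚ.≤-trans {S i} {S j} {S (suc j)} (S-mono i j i≤j) (S-step j)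

      V-anti : ∀ i j → i ℕ.≤′ j → V j ≤ V i
      V-anti i .i      ℕ.≤′-refl       = ℚ.≤-refl {V i}
      V-anti i (suc j) (ℕ.≤′-step i≤j) = ℚ.≤-trans {V (suc j)} {V j} {V i} (V-step j) (V-anti i j i≤j)

      tail : ∀ {i j} → i ℕ.≤ j → ∣ S i - S j ∣ ≤ w * coeff i
      tail {i} {j} i≤j = begin
        ∣ S i - S j ∣   ≡⟨ abs-swap (S i) (S j) ⟩
        ∣ S j - S i ∣   ≡⟨ ℚ.0≤p⇒∣p∣≡p (0≤-diff (S-mono i j (ℕ.≤⇒≤′ i≤j))) ⟩
        S j - S i       ≡⟨ cong (_- S i) (sym (ℚ.+-identityʳ (S j))) ⟩
        S j + 0ℚ - S i  ≤⟨ ℚ.+-monoˡ-≤ (- S i) (ℚ.+-monoʳ-≤ (S j) (0≤* w≥0 (0≤* (coeff≥0 j) (pow≥0 j)))) ⟩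
        V j - S i       ≤⟨ ℚ.+-monoˡ-≤ (- S i) (V-anti i j (ℕ.≤⇒≤′ i≤j)) ⟩
        V i - S i       ≡⟨ add-sub (S i) (w * (coeff i * u ^ i)) ⟩
        w * (coeff i * u ^ i)
          ≤⟨ ℚ.*-monoˡ-≤-nonNeg w {{ℚ.nonNegative w≥0}} (ℚ.*-monoˡ-≤-nonNeg (coeff i) {{ℚ.nonNegative (coeff≥0 i)}} (pow≤1 i)) ⟩
        w * (coeff i * 1ℚ)
          ≡⟨ cong (w *_) (ℚ.*-identityʳ (coeff i)) ⟩
        w * coeff i ∎

      S-cauchy : ∀ ε → 0ℚ < ε → ∃ λ N → ∀ i j → N ℕ.≤ i → N ℕ.≤ j → ∣ S i - S j ∣ ≤ ε
      S-cauchy ε ε>0 = proj₁ small , λ i j N≤i N≤j → close i j N≤i N≤j (ℕ.≤-total i j)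
        where
        small : ∃ λ N → w * coeff N ≤ ε
        small = coeff→0 w ε ε>0
        N : ℕ
        N = proj₁ small
        close′ : ∀ i j → N ℕ.≤ i → i ℕ.≤ j → ∣ S i - S j ∣ ≤ ε
        close′ i j N≤i i≤j = begin
          ∣ S i - S j ∣ ≤⟨ tail i≤j ⟩
          w * coeff i   ≤⟨ ℚ.*-monoˡ-≤-nonNeg w {{ℚ.nonNegative w≥0}} (coeff-anti N≤i) ⟩
          w * coeff N   ≤⟨ proj₂ small ⟩
          ε ∎
        close : ∀ i j → N ℕ.≤ i → N ℕ.≤ j → i ℕ.≤ j ⊎ j ℕ.≤ i → ∣ S i - S j ∣ ≤ ε
        close i j N≤i N≤j (inj₁ i≤j) = close′ i j N≤i i≤j
        close i j N≤i N≤j (inj₂ j≤i) = subst (_≤ ε) (abs-swap (S j) (S i)) (close′ j i N≤j j≤i)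

    square≥0 : ∀ p → 0ℚ ≤ p * p
    square≥0 p with ℚ.≤-total 0ℚ p
    ... | inj₁ 0≤p = 0≤* 0≤p 0≤p
    ... | inj₂ p≤0 = subst (0ℚ ≤_) (neg-square p) (0≤* 0≤-p 0≤-p)
      where
      0≤-p : 0ℚ ≤ - p
      0≤-p = ℚ.neg-antimono-≤ p≤0

    x+1≢0 : ∀ x → .{{Positive x}} → NonZero (x + 1ℚ)
    x+1≢0 x = ℚ.pos⇒nonZero (x + 1ℚ) {{ℚ.pos+pos⇒pos x 1ℚ}}

  open Series

  -- (x - 1)/(x + 1)
  cayley : ∀ x → .{{Positive x}} → ℚ
  cayley x = ((x - 1ℚ) ℚ.÷ (x + 1ℚ)) {{x+1≢0 x}}

  module Convergence where

    1-cayley²>0 : ∀ x → .{{_ : Positive x}} → 0ℚ < 1ℚ - cayley x * cayley x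
    1-cayley²>0 x = subst (0ℚ <_) (sym eq) (ℚ.positive⁻¹ _ {{pos}})
      where
      open ℚ.≤-Reasoning
      instance
        x+1⁺ : Positive (x + 1ℚ)
        x+1⁺ = ℚ.pos+pos⇒pos x 1ℚ
        nz : NonZero (x + 1ℚ)
        nz = x+1≢0 x
      v : ℚ
      v = 1/ (x + 1ℚ)
      instance
        v⁺ : Positive v
        v⁺ = ℚ.1/pos⇒pos (x + 1ℚ)
      pos : Positive ((v + v) * (x * v + x * v))
      pos = ℚ.pos*pos⇒pos (v + v) {{ℚ.pos+pos⇒pos v v}} (x * v + x * v)
              {{ℚ.pos+pos⇒pos (x * v) {{xv}} (x * v) {{xv}}}}
        where xv = ℚ.pos*pos⇒pos x v
      inv : (x + 1ℚ) * v ≡ 1ℚ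
      inv = ℚ.*-inverseʳ (x + 1ℚ)
      z : ℚ
      z = (x - 1ℚ) * v
      eq : 1ℚ - cayley x * cayley x ≡ (v + v) * (x * v + x * v)
      eq = begin-equality
        1ℚ - z * z
          ≡⟨ cong (_- z * z) (sym (trans (cong₂ _*_ inv inv) (ℚ.*-identityˡ 1ℚ))) ⟩
        (x + 1ℚ) * v * ((x + 1ℚ) * v) - z * z
          ≡⟨ square-diff 1ℚ x v ⟩
        (1ℚ * v + 1ℚ * v) * (x * v + x * v)
          ≡⟨ cong (λ y → (y + y) * (x * v + x * v)) (ℚ.*-identityˡ v) ⟩
        (v + v) * (x * v + x * v) ∎

  open Convergence

  -- ln x = 2 artanh z = 2z (1 + z²/3 + z⁴/5 + …), where z = cayley x.
  ln : ∀ x → .{{Positive x}} → ℝ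
  ln x = fromℚ (cayley x + cayley x) *ℝ record
    { approx = artanhSum (cayley x * cayley x)
    ; cauchy = Tail.S-cauchy _ (square≥0 (cayley x)) (1-cayley²>0 x)
    }

  1-δ⁺ : ∀ {n m} → .{{_ : ℕ.NonZero m}} → n ℕ.< m → Positive (1ℚ - + n / m)
  1-δ⁺ {n} {suc m} n<m = ℚ.positive (subst (_< 1ℚ - δ) (ℚ.+-inverseʳ δ) (ℚ.+-monoˡ-< (- δ) δ<1))
    where
    δ : ℚ
    δ = + n / suc m
    δ<1 : δ < 1ℚ
    δ<1 = ℚ.toℚᵘ-cancel-< (ℚᵘ.<-respˡ-≃ (ℚᵘ.≃-sym (toℚᵘ-/ (+ n) m))
      (ℚᵘ.*<* (subst (ℤ._< + 1 ℤ.* + suc m) (sym (ℤ.*-identityʳ (+ n)))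
        (subst (+ n ℤ.<_) (sym (ℤ.*-identityˡ (+ suc m))) (ℤ.+<+ n<m)))))

  toℚ⁺ : ∀ n → .{{_ : ℕ.NonZero n}} → Positive (toℚ n)
  toℚ⁺ n = ℚ.normalize-pos n 1

open OnlineLabeling public using (χ)
open Reals public

-- The adversary first inserts G + 1 heavy keys, evenly spaced; they cut the array into G groups. The remaining,
-- light keys go into the groups, and only relocations of heavy keys are counted. The weight of a group is twice
-- its number of empty cells plus a penalty that grows as its unused keys run out, so that a light group always
-- has room and every insertion lowers the weight of its surroundings by at least 1, unless heavy keys move.
--
-- Suppose that the array has about H empty cells, and measure density in quanta, 1/R of the overall density. The
-- adversary keeps a chain of nested windows, each inside the middle part of the previous one, and inserts into
-- the innermost. A window dies when all keys of the left, or of the right, of the two zones around its middle have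
-- moved since its birth: this costs the algorithm a constant fraction of the window. Until then the part between
-- two unmoved zone keys gains no cells and absorbs all insertions. If an end piece of an interval is lighter than
-- the interval by a quantum, the adversary moves on to that piece. Otherwise passing from a window to its middle
-- raises the density by at most 8 quanta, or even lowers it by one if the window is old, that is, if it has
-- absorbed a few quanta of insertions. Densities are nonnegative, so a chain of 10 R levels contains R young windows. A window is young
-- for a number of steps proportional to H / (R G) times its length, and lengths decrease geometrically along the
-- chain, so R young windows at every step force on the order of R² G relocations while H drops by a quarter.
-- There are on the order of ln (1 / (1 - δ)) such phases, and R can be of order ln n.
module Submission where

-- Prefix sums and lists of the keys in a zone

module Strategy where

  open import Data.List using (List; []; _∷_; length; filter; map)
  open import Data.List.Membership.Propositional using (_∈_)
  open import Data.List.Membership.Propositional.Properties using (∈-filter⁻)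
  open import Data.List.Relation.Unary.All as All using (All; []; _∷_)
  open import Data.List.Relation.Unary.AllPairs using (AllPairs; []; _∷_)
  import Data.List.Relation.Unary.AllPairs.Properties as AllPairs
  open import Data.List.Relation.Unary.Any using (here; there)
  open import Data.Nat
  open import Data.Nat.DivMod using (m≡m%n+[m/n]*n; m%n<n; /-monoˡ-≤; m*n/n≡m; m/n*n≤m)
  open import Data.Nat.ListAction using (sum)
  open import Data.Nat.Properties
  open import Data.Nat.Tactic.RingSolver using (solve-∀)
  open import Data.Product using (Σ; ∃; _×_; _,_; proj₁; proj₂)
  open import Data.Sum using (_⊎_; inj₁; inj₂)
  open import Relation.Binary.PropositionalEquality
  open import Relation.Nullary using (Dec; yes; no; contradiction)

  -- Adds up inequalities without subtraction: `L ≤ U` is the sum of the inequalities in play, and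
  -- `S` collects the terms that occur on both of its sides and cancel.
  ≤-by : ∀ {A B L U} S → L ≤ U → A + S ≡ L → U ≡ B + S → A ≤ B
  ≤-by S L≤U p q = +-cancelʳ-≤ S _ _ (≤-trans (≤-reflexive p) (≤-trans L≤U (≤-reflexive q)))

  Σ< : (ℕ → ℕ) → ℕ → ℕ
  Σ< f zero    = 0
  Σ< f (suc n) = Σ< f n + f n

  Σ<-mono : ∀ f {m n} → m ≤ n → Σ< f m ≤ Σ< f n
  Σ<-mono f {m} m≤n = go (≤⇒≤′ m≤n)
    where
    go : ∀ {n} → m ≤′ n → Σ< f m ≤ Σ< f n
    go ≤′-refl     = ≤-refl
    go (≤′-step p) = ≤-trans (go p) (m≤m+n _ _)

  module _ (ρ : ℕ → ℕ) where

    kept : List ℕ → List ℕ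
    kept = filter (λ x → ρ x ≟ 0)

    gone : List ℕ → ℕ
    gone xs = sum (map ρ xs)

    length≤gone+kept : ∀ xs → length xs ≤ gone xs + length (kept xs)
    length≤gone+kept []       = z≤n
    length≤gone+kept (x ∷ xs) with ρ x
    ... | zero  = ≤-trans (s≤s (length≤gone+kept xs)) (≤-reflexive (sym (+-suc (gone xs) _)))
    ... | suc k = s≤s (≤-trans (length≤gone+kept xs) (+-monoˡ-≤ (length (kept xs)) (m≤n+m (gone xs) k)))

    -- A strictly monotone list visits each index at most once, so its total of `ρ` is part of the
    -- sum over the indices from `lo` up to, but excluding, `hi`.
    gone-descending : ∀ {lo hi} xs → AllPairs _>_ xs → All (lo ≤_) xs → All (_< hi) xs → lo ≤ hi →
                      gone xs + Σ< ρ lo ≤ Σ< ρ hi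
    gone-descending []       _           _            _            lo≤hi = Σ<-mono ρ lo≤hi
    gone-descending {lo} {hi} (x ∷ xs) (x> ∷ sorted) (lo≤x ∷ lo≤) (x<hi ∷ _) _ = begin
      ρ x + gone xs + Σ< ρ lo    ≡⟨ +-assoc (ρ x) (gone xs) _ ⟩
      ρ x + (gone xs + Σ< ρ lo)  ≤⟨ +-monoʳ-≤ (ρ x) (gone-descending xs sorted lo≤ x> lo≤x) ⟩
      ρ x + Σ< ρ x               ≡⟨ +-comm (ρ x) _ ⟩
      Σ< ρ (suc x)               ≤⟨ Σ<-mono ρ x<hi ⟩
      Σ< ρ hi                    ∎
      where open ≤-Reasoning

    gone-ascending : ∀ {lo hi} xs → AllPairs _<_ xs → All (lo ≤_) xs → All (_< hi) xs → lo ≤ hi →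
                     gone xs + Σ< ρ lo ≤ Σ< ρ hi
    gone-ascending []       _           _            _            lo≤hi = Σ<-mono ρ lo≤hi
    gone-ascending {lo} {hi} (x ∷ xs) (x< ∷ sorted) (lo≤x ∷ _) (x<hi ∷ <hi) _ = begin
      ρ x + gone xs + Σ< ρ lo  ≤⟨ +-monoʳ-≤ (ρ x + gone xs) (Σ<-mono ρ lo≤x) ⟩
      ρ x + gone xs + Σ< ρ x   ≡⟨ rearrange (ρ x) (gone xs) (Σ< ρ x) ⟩
      gone xs + Σ< ρ (suc x)   ≤⟨ gone-ascending xs sorted x< <hi x<hi ⟩
      Σ< ρ hi                  ∎
      where
      open ≤-Reasoning
      rearrange : ∀ a b c → a + b + c ≡ b + (c + a)
      rearrange = solve-∀

  descending : ℕ → ℕ → List ℕ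
  descending lo zero    = lo ∷ []
  descending lo (suc n) = lo + suc n ∷ descending lo n

  descending-bounds : ∀ lo n {x} → x ∈ descending lo n → lo ≤ x × x ≤ lo + n
  descending-bounds lo zero    (here refl) = ≤-refl , m≤m+n lo 0
  descending-bounds lo (suc n) (here refl) = m≤m+n lo (suc n) , ≤-refl
  descending-bounds lo (suc n) (there x∈)  =
    let lo≤x , x≤ = descending-bounds lo n x∈ in lo≤x , ≤-trans x≤ (+-monoʳ-≤ lo (n≤1+n n))

  descending-sorted : ∀ lo n → AllPairs _>_ (descending lo n)
  descending-sorted lo zero    = [] ∷ []
  descending-sorted lo (suc n) =
    All.tabulate (λ x∈ → ≤-trans (s≤s (proj₂ (descending-bounds lo n x∈))) (≤-reflexive (sym (+-suc lo n))))
    ∷ descending-sorted lo n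

  length-descending : ∀ lo n → length (descending lo n) ≡ suc n
  length-descending lo zero    = refl
  length-descending lo (suc n) = cong suc (length-descending lo n)

  ascending : ℕ → ℕ → List ℕ
  ascending lo zero    = lo ∷ []
  ascending lo (suc n) = lo ∷ ascending (suc lo) n

  ascending-bounds : ∀ lo n {x} → x ∈ ascending lo n → lo ≤ x × x ≤ lo + n
  ascending-bounds lo zero    (here refl) = ≤-refl , m≤m+n lo 0
  ascending-bounds lo (suc n) (here refl) = ≤-refl , m≤m+n lo (suc n)
  ascending-bounds lo (suc n) (there x∈)  =
    let lo<x , x≤ = ascending-bounds (suc lo) n x∈ in <⇒≤ lo<x , ≤-trans x≤ (≤-reflexive (sym (+-suc lo n)))

  ascending-sorted : ∀ lo n → AllPairs _<_ (ascending lo n)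
  ascending-sorted lo zero    = [] ∷ []
  ascending-sorted lo (suc n) =
    All.tabulate (λ x∈ → proj₁ (ascending-bounds (suc lo) n x∈)) ∷ ascending-sorted (suc lo) n

  length-ascending : ∀ lo n → length (ascending lo n) ≡ suc n
  length-ascending lo zero    = refl
  length-ascending lo (suc n) = cong suc (length-ascending (suc lo) n)

  search : ∀ (f g : ℕ → ℕ) lo n →
           (∃ λ x → lo ≤ x × x ≤ lo + n × f x < g x) ⊎ (∀ x → lo ≤ x → x ≤ lo + n → g x ≤ f x)
  search f g lo n with anyUpTo? (λ i → f (lo + i) <? g (lo + i)) (suc n)
  ... | yes (i , s≤s i≤n , f<g) = inj₁ (lo + i , m≤m+n lo i , +-monoʳ-≤ lo i≤n , f<g)
  ... | no  none                = inj₂ λ x lo≤x x≤ →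
    ≮⇒≥ λ f<g → none (x ∸ lo , s≤s (m≤n+o⇒m∸n≤o x lo x≤)
                     , subst (λ x → f x < g x) (sym (m+[n∸m]≡n lo≤x)) f<g)

  -- Chains of nested windows

  module Chains (R N Q s₀ : ℕ) (N≤s₀Q : N ≤ s₀ * Q) (15≤s₀ : 15 ≤ s₀) (Q>0 : 0 < Q) where

    -- P stands for the prefix sums of the weights: [a , b] has density at most X Q / N, that is X quanta.
    Light : (ℕ → ℕ) → ℕ → ℕ → ℕ → Set
    Light P X a b = N * P b + X * Q * a ≤ N * P a + X * Q * b

    -- The window [a , a + k]. UL and UR list the keys of its zones that have not moved since its birth, the one closest
    -- to the middle first; mL and mR count the relocations in the zones. The age is the number of insertions since
    -- its birth. The window was created with density at most X quanta; below it d levels are left, and starting from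
    -- it y young windows are still needed, which the budget guarantees because each young one raises the density
    -- by at most 8 quanta and every other level lowers it by one.
    record Node (P : ℕ → ℕ) (y : ℕ) : Set where
      field
        a z e d X age mL mR : ℕ
        UL UR : List ℕ
        e≤z    : e ≤ z
        big    : s₀ * 16 ^ d ≤ z
        budget : X + 9 * y ≤ suc d
        cap    : X + 8 * y ≤ 9 * R
        UL-sorted : AllPairs _>_ UL
        UR-sorted : AllPairs _<_ UR
        UL-range : ∀ {x} → x ∈ UL → a + 6 * z ≤ x × x ≤ a + 6 * z + z
        UR-range : ∀ {x} → x ∈ UR → a + 9 * z ≤ x × x ≤ a + 9 * z + z
        UL-count : z ≤ mL + length UL
        UR-count : z ≤ mR + length UR
        light : ∀ {l r} → l ∈ UL → r ∈ UR →
                N * (P r + age) + (X + 8) * Q * l ≤ N * P l + (X + 8) * Q * r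
      k b : ℕ
      k = 16 * z + e
      b = a + k

    open Node

    -- A young window counts towards the required number, so the chain below it needs one fewer; an
    -- old window does not count. The threshold comes from the fact that zone keys of opposite sides
    -- are at most `k / 3` apart: at age `3 * Q * k / N` the part between two unmoved ones has lost
    -- 9 quanta.
    data Status {P : ℕ → ℕ} : ∀ {y} → Node P y → ℕ → Set where
      young : ∀ {y} {T : Node P (suc y)} → N * age T < 3 * Q * k T → Status T y
      old   : ∀ {y} {T : Node P y} → 3 * Q * k T ≤ N * age T → Status T y

    -- The child interval from `lo` to `hi` lies between all unmoved keys of the two zones. Hence
    -- every insertion into the child falls between each such pair.
    record Fit {P y} (T : Node P y) (A B lo hi : ℕ) : Set where
      field
        A≤a : A ≤ a T
        b≤B : b T ≤ B
        lo≥ : a T + 6 * z T ≤ lo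
        hi≤ : hi ≤ a T + 9 * z T + z T
        UL≤ : ∀ {x} → x ∈ UL T → x ≤ lo
        UR≥ : ∀ {x} → x ∈ UR T → hi ≤ x

    open Fit

    -- The index `y` is the number of young windows. A chain ends in a group of at most `9 * R`
    -- quanta, the level to which `cap` limits densities.
    data Chain (P : ℕ → ℕ) : ℕ → ℕ → ℕ → Set where
      done : ∀ {A B} g → A ≤ g → g < B → N * P (suc g) ≤ N * P g + 9 * R * Q → Chain P 0 A B
      node : ∀ {y y′ A B lo hi} (T : Node P y) → Status T y′ → Fit T A B lo hi →
             Chain P y′ lo hi → Chain P y A B

    -- N times the number of steps for which the window has been counted as young. The debt of an old window also
    -- includes that of its descendants, which were abandoned unpaid when it became old.
    own : ∀ {P y y′} {T : Node P y} → Status T y′ → ℕ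
    own {T = T} (young _) = N * age T
    own {T = T} (old _)   = 6 * Q * k T

    debt : ∀ {P y A B} → Chain P y A B → ℕ
    debt (done _ _ _ _)   = 0
    debt (node T s _ c)   = own s + debt c

    -- Relocations already made in the zones of living windows. They are saved up to settle the debt
    -- of a window when it dies.
    credit : ∀ {P y A B} → Chain P y A B → ℕ
    credit (done _ _ _ _) = 0
    credit (node T _ _ c) = mL T + mR T + credit c

    target : ∀ {P y A B} → Chain P y A B → ℕ
    target (done g _ _ _) = g
    target (node _ _ _ c) = target c

    charged : ∀ {P y A B} → (ℕ → ℕ) → Chain P y A B → ℕ
    charged ρ (done _ _ _ _) = 0
    charged ρ (node T _ _ c) = gone ρ (UL T) + gone ρ (UR T) + charged ρ c

    10z≤ : ∀ {P y} (T : Node P y) → a T + 9 * z T + z T ≤ b T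
    10z≤ T = begin
      a T + 9 * z T + z T                ≤⟨ m≤m+n _ (6 * z T + e T) ⟩
      a T + 9 * z T + z T + (6 * z T + e T)  ≡⟨ eq (a T) (z T) (e T) ⟩
      b T ∎
      where
      open ≤-Reasoning
      eq : ∀ a z e → a + 9 * z + z + (6 * z + e) ≡ a + (16 * z + e)
      eq = solve-∀

    hi≤B : ∀ {P y A B lo hi} {T : Node P y} → Fit T A B lo hi → hi ≤ B
    hi≤B {T = T} f = ≤-trans (hi≤ f) (≤-trans (10z≤ T) (b≤B f))

    nonempty : ∀ {P y A B} → Chain P y A B → A < B
    nonempty (done g A≤g g<B _) = ≤-<-trans A≤g g<B
    nonempty (node T _ f c) =
      ≤-<-trans (≤-trans (A≤a f) (≤-trans (m≤m+n _ _) (lo≥ f))) (<-≤-trans (nonempty c) (hi≤B f))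

    target-≥ : ∀ {P y A B} (c : Chain P y A B) → A ≤ target c
    target-≥ (done g A≤g _ _) = A≤g
    target-≥ (node T _ f c) = ≤-trans (A≤a f) (≤-trans (m≤m+n _ _) (≤-trans (lo≥ f) (target-≥ c)))

    target-< : ∀ {P y A B} (c : Chain P y A B) → target c < B
    target-< (done g _ g<B _) = g<B
    target-< (node T _ f c) = <-≤-trans (target-< c) (hi≤B f)

    target-light : ∀ {P y A B} (c : Chain P y A B) → N * P (suc (target c)) ≤ N * P (target c) + 9 * R * Q
    target-light (done _ _ _ h) = h
    target-light (node _ _ _ c) = target-light c

    s₀≤z : ∀ {P y} (T : Node P y) → s₀ ≤ z T
    s₀≤z T = ≤-trans (m≤m*n s₀ (16 ^ d T) {{m^n≢0 16 (d T)}}) (big T)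

    z>0 : ∀ {P y} (T : Node P y) → 0 < z T
    z>0 T = ≤-trans (s≤s z≤n) (≤-trans 15≤s₀ (s₀≤z T))

    -- One insertion adds `N` to the debt of a young window. Windows are long enough for this to be
    -- at most a constant share of what their length can carry.
    N≤Qk : ∀ {P y} (T : Node P y) → N ≤ Q * k T
    N≤Qk T = begin
      N              ≤⟨ N≤s₀Q ⟩
      s₀ * Q         ≤⟨ *-monoˡ-≤ Q (s₀≤z T) ⟩
      z T * Q        ≡⟨ *-comm (z T) Q ⟩
      Q * z T        ≤⟨ *-monoʳ-≤ Q (≤-trans (m≤n*m (z T) 16) (m≤m+n (16 * z T) (e T))) ⟩
      Q * k T        ∎
      where open ≤-Reasoning

    weaken : ∀ {P y A B A′ B′} → A′ ≤ A → B ≤ B′ → Chain P y A B → Chain P y A′ B′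
    weaken A′≤A B≤B′ (done g A≤g g<B h) = done g (≤-trans A′≤A A≤g) (<-≤-trans g<B B≤B′) h
    weaken A′≤A B≤B′ (node T s f c) = node T s (record
      { A≤a = ≤-trans A′≤A (A≤a f) ; b≤B = ≤-trans (b≤B f) B≤B′
      ; lo≥ = lo≥ f ; hi≤ = hi≤ f ; UL≤ = UL≤ f ; UR≥ = UR≥ f }) c

    record Fresh {P y A B} (c : Chain P y A B) : Set where
      constructor fresh
      field
        no-debt   : debt c ≡ 0
        no-credit : credit c ≡ 0

    weaken-fresh : ∀ {P y A B A′ B′} (p : A′ ≤ A) (q : B ≤ B′) (c : Chain P y A B) →
                   Fresh c → Fresh (weaken p q c)
    weaken-fresh p q (done _ _ _ _) f = fresh refl refl
    weaken-fresh p q (node _ _ _ _) (fresh d c) = fresh d c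

    -- Averaging: if the first group exceeds the density of the interval, the rest of the interval
    -- is still light without it.
    lightest : ∀ P X a n → Light P X a (a + suc n) →
               ∃ λ g → a ≤ g × g < a + suc n × N * P (suc g) ≤ N * P g + X * Q
    lightest P X a zero h = a , ≤-refl , m<m+n a (s≤s z≤n) ,
      ≤-by (X * Q * a) (subst (λ x → Light P X a x) (+-comm a 1) h) refl (eq (N * P a) (X * Q) a)
      where
      eq : ∀ p x a → p + x * suc a ≡ p + x + x * a
      eq = solve-∀
    lightest P X a (suc n) h with N * P (suc a) ≤? N * P a + X * Q
    ... | yes p = a , ≤-refl , m<m+n a (s≤s z≤n) , p
    ... | no ¬p =
      let g , a<g , g< , hg = lightest P X (suc a) n
            (≤-by (N * P a) (+-mono-≤ (subst (Light P X a) (+-suc a (suc n)) h) (<⇒≤ (≰⇒> ¬p)))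
              (eq₁ (N * P (suc a + suc n)) (X * Q) a (N * P a)) (eq₂ (N * P a) (X * Q) (suc a + suc n) (N * P (suc a))))
      in g , <⇒≤ a<g , ≤-trans g< (≤-reflexive (sym (+-suc a (suc n)))) , hg
      where
      eq₁ : ∀ p x a q → p + x * suc a + q ≡ p + x * a + (q + x)
      eq₁ = solve-∀
      eq₂ : ∀ p x b q → p + x * b + q ≡ q + x * b + p
      eq₂ = solve-∀

    -- If the end pieces [a , l] and [r , b] have at least X - 1 quanta, the middle makes up for their deficit of one
    -- quantum per group, spread over at least a ninth of [a , b].
    middle-light : ∀ P X a l r b → Light P X a b →
      X * Q * l + N * P a + Q * a ≤ N * P l + Q * l + X * Q * a →
      X * Q * b + N * P r + Q * r ≤ N * P b + Q * b + X * Q * r →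
      9 * l + b ≤ 9 * r + a →
      N * P r + (X + 8) * Q * l ≤ N * P l + (X + 8) * Q * r
    middle-light P X a l r b h hˡ hʳ h⁹ =
      ≤-by (N * P b + N * P a + X * Q * a + X * Q * b + Q * (l + b + r + a))
        (+-mono-≤ (+-mono-≤ (+-mono-≤ h hˡ) hʳ) (*-monoʳ-≤ Q h⁹))
        (eq₁ (N * P r) X Q l a b r (N * P b) (N * P a))
        (eq₂ (N * P l) X Q l a b r (N * P b) (N * P a))
      where
      eq₁ : ∀ pr X Q l a b r pb pa →
            pr + (X + 8) * Q * l + (pb + pa + X * Q * a + X * Q * b + Q * (l + b + r + a)) ≡
            pb + X * Q * a + (X * Q * l + pa + Q * a) + (X * Q * b + pr + Q * r) + Q * (9 * l + b)
      eq₁ = solve-∀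
      eq₂ : ∀ pl X Q l a b r pb pa →
            pa + X * Q * b + (pl + Q * l + X * Q * a) + (pb + Q * b + X * Q * r) + Q * (9 * r + a) ≡
            pl + (X + 8) * Q * r + (pb + pa + X * Q * a + X * Q * b + Q * (l + b + r + a))
      eq₂ = solve-∀

    -- Weights are nonnegative, so a deficit of a quantum is impossible at `X = 0`. The lemma serves
    -- the right end piece too, with `r` and `b` for `a` and `l`.
    light-piece : ∀ P X a l → a ≤ l → P a ≤ P l → N * P l + Q * l + X * Q * a < X * Q * l + N * P a + Q * a →
                  ∃ λ X₁ → X ≡ suc X₁ × Light P X₁ a l
    light-piece P zero    a l a≤l Pa≤Pl h = contradiction
      (≤-trans (+-mono-≤ (*-monoʳ-≤ N Pa≤Pl) (*-monoʳ-≤ Q a≤l)) (m≤m+n _ 0)) (<⇒≱ h)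
    light-piece P (suc X) a l _   _     h = X , refl ,
      ≤-by (Q * l + Q * a) (<⇒≤ h) (eq (N * P l) X Q a l) (eq′ (N * P a) X Q a l)
      where
      eq : ∀ p X Q a l → p + X * Q * a + (Q * l + Q * a) ≡ p + Q * l + (Q + X * Q) * a
      eq = solve-∀
      eq′ : ∀ p X Q a l → (Q + X * Q) * l + p + Q * a ≡ p + X * Q * l + (Q * l + Q * a)
      eq′ = solve-∀

    -- The zones are `2 * z` apart and the window is at most `17 * z` long, which is within the
    -- factor 9 that `middle-light` needs.
    zones-apart : ∀ a z e l r → e ≤ z → l ≤ a + 6 * z + z → a + 9 * z ≤ r → 9 * l + (a + (16 * z + e)) ≤ 9 * r + a
    zones-apart a z e l r e≤z l≤ ≤r = begin
      9 * l + (a + (16 * z + e))             ≤⟨ +-mono-≤ (*-monoʳ-≤ 9 l≤) (+-monoʳ-≤ a (+-monoʳ-≤ (16 * z) e≤z)) ⟩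
      9 * (a + 6 * z + z) + (a + (16 * z + z)) ≤⟨ m≤m+n _ z ⟩
      9 * (a + 6 * z + z) + (a + (16 * z + z)) + z ≡⟨ eq a z ⟩
      9 * (a + 9 * z) + a                    ≤⟨ +-monoˡ-≤ a (*-monoʳ-≤ 9 ≤r) ⟩
      9 * r + a                              ∎
      where
      open ≤-Reasoning
      eq : ∀ a z → 9 * (a + 6 * z + z) + (a + (16 * z + z)) + z ≡ 9 * (a + 9 * z) + a
      eq = solve-∀

    Monotone : (ℕ → ℕ) → Set
    Monotone P = ∀ {i j} → i ≤ j → P i ≤ P j

    -- A young window is budgeted 9 levels: its own, and one for shedding each of the 8 quanta that
    -- it may add.
    spend-young : ∀ X y d → X + 9 * suc y ≤ suc d → X + 8 + 9 * y ≤ d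
    spend-young X y d h = s≤s⁻¹ (≤-trans (≤-reflexive (eq X y)) h)
      where
      eq : ∀ X y → suc (X + 8 + 9 * y) ≡ X + 9 * suc y
      eq = solve-∀

    cap-young : ∀ X y → X + 8 * suc y ≤ 9 * R → X + 8 + 8 * y ≤ 9 * R
    cap-young X y h = ≤-trans (≤-reflexive (eq X y)) h
      where
      eq : ∀ X y → X + 8 + 8 * y ≡ X + 8 * suc y
      eq = solve-∀

    -- Construction of a chain in a light interval

    module Build (P : ℕ → ℕ) (mono : Monotone P) where

      -- One level of the construction. Either an end piece is light, and moving to it lowers `X` by
      -- one; or neither is, and the interval becomes a window whose child lies between the zones,
      -- with `X + 8` quanta and one young window fewer to find.
      module Split (d X y a z e b : ℕ) (b≡ : b ≡ a + (16 * z + e)) (e≤z : e ≤ z) (big : s₀ * 16 ^ d ≤ z)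
        (h : Light P X a b) (budget : X + 9 * suc y ≤ suc d) (cap : X + 8 * suc y ≤ 9 * R)
        (rec : ∀ X y a b → Light P X a b → a + s₀ * 16 ^ d ≤ b → X + 9 * y ≤ d → X + 8 * y ≤ 9 * R →
               Σ (Chain P y a b) Fresh) where

        l≤b : ∀ {l} → l ≤ a + 6 * z + z → l ≤ b
        l≤b l≤ = ≤-trans l≤ (≤-trans (m≤m+n _ (9 * z + e)) (≤-reflexive (trans (eq a z e) (sym b≡))))
          where
          eq : ∀ a z e → a + 6 * z + z + (9 * z + e) ≡ a + (16 * z + e)
          eq = solve-∀

        r+z≤b : ∀ {r} → r ≤ a + 9 * z + z → r + z ≤ b
        r+z≤b r≤ = ≤-trans (+-monoˡ-≤ z r≤)
          (≤-trans (m≤m+n _ (5 * z + e)) (≤-reflexive (trans (eq a z e) (sym b≡))))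
          where
          eq : ∀ a z e → a + 9 * z + z + z + (5 * z + e) ≡ a + (16 * z + e)
          eq = solve-∀

        shrink : ∀ {A B X₁} → a ≤ A → B ≤ b → A + s₀ * 16 ^ d ≤ B → X ≡ suc X₁ → Light P X₁ A B →
                 Σ (Chain P (suc y) a b) Fresh
        shrink {A} {B} {X₁} a≤A B≤b size X≡ h₁ =
          let c , f = rec X₁ (suc y) A B h₁ size
                (s≤s⁻¹ (subst (λ X → X + 9 * suc y ≤ suc d) X≡ budget))
                (<⇒≤ (subst (λ X → X + 8 * suc y ≤ 9 * R) X≡ cap))
          in weaken a≤A B≤b c , weaken-fresh a≤A B≤b c f

        fˡ gˡ fʳ gʳ : ℕ → ℕ
        fˡ l = N * P l + Q * l + X * Q * a
        gˡ l = X * Q * l + N * P a + Q * a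
        fʳ r = N * P b + Q * b + X * Q * r
        gʳ r = X * Q * b + N * P r + Q * r

        module Cut (noˡ : ∀ l → a + 6 * z ≤ l → l ≤ a + 6 * z + z → gˡ l ≤ fˡ l)
                   (noʳ : ∀ r → a + 9 * z ≤ r → r ≤ a + 9 * z + z → gʳ r ≤ fʳ r) where

          light₀ : ∀ {l r} → a + 6 * z ≤ l → l ≤ a + 6 * z + z → a + 9 * z ≤ r → r ≤ a + 9 * z + z →
                   N * P r + (X + 8) * Q * l ≤ N * P l + (X + 8) * Q * r
          light₀ {l} {r} ≤l l≤ ≤r r≤ = middle-light P X a l r b h (noˡ l ≤l l≤) (noʳ r ≤r r≤)
            (subst (λ b → 9 * l + b ≤ 9 * r + a) (sym b≡) (zones-apart a z e l r e≤z l≤ ≤r))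

          T : Node P (suc y)
          T = record
            { a = a ; z = z ; e = e ; d = d ; X = X ; age = 0 ; mL = 0 ; mR = 0
            ; UL = descending (a + 6 * z) z ; UR = ascending (a + 9 * z) z
            ; e≤z = e≤z ; big = big ; budget = budget ; cap = cap
            ; UL-sorted = descending-sorted _ z ; UR-sorted = ascending-sorted _ z
            ; UL-range = descending-bounds _ z ; UR-range = ascending-bounds _ z
            ; UL-count = ≤-trans (n≤1+n z) (≤-reflexive (sym (length-descending _ z)))
            ; UR-count = ≤-trans (n≤1+n z) (≤-reflexive (sym (length-ascending _ z)))
            ; light = λ {l} {r} l∈ r∈ →
                let ≤l , l≤ = descending-bounds _ z l∈
                    ≤r , r≤ = ascending-bounds _ z r∈
                in subst (λ p → N * p + (X + 8) * Q * l ≤ N * P l + (X + 8) * Q * r) (sym (+-identityʳ (P r)))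
                     (light₀ ≤l l≤ ≤r r≤)
            }

          7z≤9z : a + 6 * z + z + z ≤ a + 9 * z
          7z≤9z = ≤-trans (m≤m+n _ z) (≤-reflexive (eq a z))
            where
            eq : ∀ a z → a + 6 * z + z + z + z ≡ a + 9 * z
            eq = solve-∀

          child : Σ (Chain P y (a + 6 * z + z) (a + 9 * z)) Fresh
          child = rec (X + 8) y (a + 6 * z + z) (a + 9 * z)
            (light₀ (m≤m+n _ z) ≤-refl ≤-refl (m≤m+n _ z))
            (≤-trans (+-monoʳ-≤ _ big) 7z≤9z) (spend-young X y d budget) (cap-young X y cap)

          fit : Fit T a b (a + 6 * z + z) (a + 9 * z)
          fit = record
            { A≤a = ≤-refl ; b≤B = ≤-reflexive (sym b≡) ; lo≥ = m≤m+n _ z ; hi≤ = m≤m+n _ z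
            ; UL≤ = λ x∈ → proj₂ (descending-bounds _ z x∈)
            ; UR≥ = λ x∈ → proj₁ (ascending-bounds _ z x∈) }

          N0< : N * 0 < 3 * Q * k T
          N0< = ≤-trans (≤-reflexive (cong suc (*-zeroʳ N)))
            (*-mono-≤ (*-mono-≤ (s≤s (z≤n {2})) Q>0) (≤-trans (z>0 T) (≤-trans (m≤n*m z 16) (m≤m+n _ e))))

          result : Σ (Chain P (suc y) a b) Fresh
          result = node T (young N0<) fit (proj₁ child) ,
            fresh (cong₂ _+_ (*-zeroʳ N) (Fresh.no-debt (proj₂ child))) (Fresh.no-credit (proj₂ child))

        result : Σ (Chain P (suc y) a b) Fresh
        result = caseˡ (search fˡ gˡ (a + 6 * z) z)
          where
          caseʳ : (∀ l → a + 6 * z ≤ l → l ≤ a + 6 * z + z → gˡ l ≤ fˡ l) →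
                  (∃ λ r → a + 9 * z ≤ r × r ≤ a + 9 * z + z × fʳ r < gʳ r) ⊎
                  (∀ r → a + 9 * z ≤ r → r ≤ a + 9 * z + z → gʳ r ≤ fʳ r) → Σ (Chain P (suc y) a b) Fresh
          caseʳ noˡ (inj₁ (r , ≤r , r≤ , h′)) =
            let r≤b = ≤-trans (m≤m+n r z) (r+z≤b r≤)
                X₁ , X≡ , h₁ = light-piece P X r b r≤b (mono r≤b) h′
            in shrink (≤-trans (m≤m+n a _) ≤r) ≤-refl (≤-trans (+-monoʳ-≤ r big) (r+z≤b r≤)) X≡ h₁
          caseʳ noˡ (inj₂ noʳ) = Cut.result noˡ noʳ
          caseˡ : (∃ λ l → a + 6 * z ≤ l × l ≤ a + 6 * z + z × fˡ l < gˡ l) ⊎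
                  (∀ l → a + 6 * z ≤ l → l ≤ a + 6 * z + z → gˡ l ≤ fˡ l) → Σ (Chain P (suc y) a b) Fresh
          caseˡ (inj₁ (l , ≤l , l≤ , h′)) =
            let a≤l = ≤-trans (m≤m+n a _) ≤l
                X₁ , X≡ , h₁ = light-piece P X a l a≤l (mono a≤l) h′
            in shrink ≤-refl (l≤b l≤) (≤-trans (+-monoʳ-≤ a (≤-trans big (m≤n*m z 6))) ≤l) X≡ h₁
          caseˡ (inj₂ noˡ) = caseʳ noˡ (search fʳ gʳ (a + 9 * z) z)

      -- Each level lowers `X + 9 * y` by exactly one, in both cases of `Split`, so `d` cannot reach
      -- 0 before `y` does.
      build : ∀ d X y a b → Light P X a b → a + s₀ * 16 ^ d ≤ b → X + 9 * y ≤ d → X + 8 * y ≤ 9 * R →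
              Σ (Chain P y a b) Fresh
      build d X zero a b h size _ cap =
        let n , eq = m≤n⇒∃[o]m+o≡n (≤-trans (+-monoʳ-≤ a s₀16>0) size)
            g , a≤g , g< , hg = lightest P X a n (subst (Light P X a) (trans (sym eq) (trans (cong (_+ n) (+-comm a 1)) (sym (+-suc a n)))) h)
        in done g a≤g (subst (g <_) (trans (+-suc a n) (trans (cong (_+ n) (+-comm 1 a)) eq)) g<)
             (≤-trans hg (+-monoʳ-≤ (N * P g) (*-monoˡ-≤ Q (≤-trans (m≤m+n X 0) cap))))
         , fresh refl refl
        where
        s₀16>0 : 1 ≤ s₀ * 16 ^ d
        s₀16>0 = *-mono-≤ (≤-trans (s≤s z≤n) 15≤s₀) (m^n>0 16 d)
      build zero    X (suc y) a b h size budget cap = contradiction (≤-trans (m≤n+m _ X) budget) λ ()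
      build (suc d) X (suc y) a b h size budget cap =
        -- The remainder modulo 16 is at most 15, and `15 ≤ s₀ ≤ z′` makes it small enough for a
        -- window.
        Split.result d X y a z′ e′ b b≡ (≤-trans e≤15 (≤-trans 15≤s₀ s₀≤z′)) 16^d≤z h budget cap (build d)
        where
        k′ z′ e′ : ℕ
        k′ = b ∸ a
        z′ = k′ / 16
        e′ = k′ % 16
        e≤15 : e′ ≤ 15
        e≤15 = s≤s⁻¹ (m%n<n k′ 16)
        16^d≤z : s₀ * 16 ^ d ≤ z′
        16^d≤z = begin
          s₀ * 16 ^ d              ≡⟨ m*n/n≡m (s₀ * 16 ^ d) 16 ⟨
          s₀ * 16 ^ d * 16 / 16    ≡⟨ cong (_/ 16) (trans (*-assoc s₀ _ 16) (cong (s₀ *_) (*-comm (16 ^ d) 16))) ⟩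
          s₀ * 16 ^ suc d / 16     ≤⟨ /-monoˡ-≤ 16 (m+n≤o⇒m≤o∸n (s₀ * 16 ^ suc d) (≤-trans (≤-reflexive (+-comm (s₀ * 16 ^ suc d) a)) size)) ⟩
          z′                       ∎
          where open ≤-Reasoning
        s₀≤z′ : s₀ ≤ z′
        s₀≤z′ = ≤-trans (m≤m*n s₀ (16 ^ d) {{m^n≢0 16 d}}) 16^d≤z
        b≡ : b ≡ a + (16 * z′ + e′)
        b≡ = trans (sym (m+[n∸m]≡n (≤-trans (m≤m+n a _) size)))
               (cong (a +_) (trans (m≡m%n+[m/n]*n k′ 16) (trans (+-comm e′ (z′ * 16)) (cong (_+ e′) (*-comm z′ 16)))))

  -- An insertion into group g, with ρ indicating the heavy keys that the algorithm relocates in response.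
  Drop : ℕ → (P P′ ρ : ℕ → ℕ) → ℕ → Set
  Drop G P P′ ρ g = ∀ l r → l ≤ g → g < r → r ≤ G → ρ l ≡ 0 → ρ r ≡ 0 → P′ r + P l + 1 ≤ P r + P′ l

  -- Amortized accounting for one insertion

  module Steps (R N Q s₀ : ℕ) (N≤s₀Q : N ≤ s₀ * Q) (15≤s₀ : 15 ≤ s₀) (Q>0 : 0 < Q) where

    open Chains R N Q s₀ N≤s₀Q 15≤s₀ Q>0
    open Node
    open Fit

    -- The debt of a chain is linear in its length. A child occupies at most a quarter of its
    -- parent, so it owes at most `2 * Q * k`, and `8 = 6 + 8 / 4` closes the induction.
    bound : ∀ {P y A B} (c : Chain P y A B) → N * y + debt c + 8 * Q * A ≤ 8 * Q * B
    inner : ∀ {P y y′ A B lo hi} (T : Node P y) → Fit T A B lo hi → (c : Chain P y′ lo hi) →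
            N * y′ + debt c ≤ Q * (2 * k T)
    -- The 6 is 1 for the coming step, 3 for the age limit and 2 for the child. It is also the flat
    -- debt of an old window, which can therefore take over everything owed so far.
    young-bound : ∀ {P y A B lo hi} (T : Node P (suc y)) → N * age T ≤ 3 * Q * k T → Fit T A B lo hi →
                  (c : Chain P y lo hi) → N * suc y + (N * age T + debt c) ≤ 6 * Q * k T
    node-bound : ∀ {P y y′ A B lo hi} (T : Node P y) (s : Status T y′) → Fit T A B lo hi →
                 (c : Chain P y′ lo hi) → N * y + (own s + debt c) ≤ 8 * Q * k T

    inner {y′ = y′} {lo = lo} {hi} T f c = begin
      N * y′ + debt c
        ≤⟨ ≤-by (8 * Q * (a T + 6 * z T))
             (≤-trans (+-monoʳ-≤ (N * y′ + debt c) (*-monoʳ-≤ (8 * Q) (lo≥ f)))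
               (≤-trans (bound c) (*-monoʳ-≤ (8 * Q) (hi≤ f))))
             refl (eq Q (a T) (z T)) ⟩
      Q * (32 * z T)
        ≤⟨ *-monoʳ-≤ Q (≤-trans (m≤m+n _ (2 * e T)) (≤-reflexive (eq′ (z T) (e T)))) ⟩
      Q * (2 * k T) ∎
      where
      open ≤-Reasoning
      eq : ∀ Q a z → 8 * Q * (a + 9 * z + z) ≡ Q * (32 * z) + 8 * Q * (a + 6 * z)
      eq = solve-∀
      eq′ : ∀ z e → 32 * z + 2 * e ≡ 2 * (16 * z + e)
      eq′ = solve-∀

    young-bound {y = y} T age≤ f c =
      ≤-trans (≤-reflexive (eq N y (N * age T) (debt c)))
        (≤-trans (+-mono-≤ (+-mono-≤ (N≤Qk T) age≤) (inner T f c)) (≤-reflexive (eq′ Q (k T))))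
      where
      eq : ∀ N y n d → N * suc y + (n + d) ≡ N + n + (N * y + d)
      eq = solve-∀
      eq′ : ∀ Q k → Q * k + 3 * Q * k + Q * (2 * k) ≡ 6 * Q * k
      eq′ = solve-∀

    node-bound T (young age<) f c =
      ≤-trans (young-bound T (<⇒≤ age<) f c) (*-monoˡ-≤ (k T) (*-monoˡ-≤ Q (m≤m+n 6 2)))
    node-bound {y = y} T (old _) f c =
      ≤-trans (≤-reflexive (eq (N * y) (6 * Q * k T) (debt c)))
        (≤-trans (+-monoʳ-≤ (6 * Q * k T) (inner T f c)) (≤-reflexive (eq′ Q (k T))))
      where
      eq : ∀ n o d → n + (o + d) ≡ o + (n + d)
      eq = solve-∀
      eq′ : ∀ Q k → 6 * Q * k + Q * (2 * k) ≡ 8 * Q * k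
      eq′ = solve-∀

    bound {A = A} (done g A≤g g<B _) = ≤-trans
      (≤-reflexive (cong (_+ 8 * Q * A) (trans (+-identityʳ (N * 0)) (*-zeroʳ N))))
      (*-monoʳ-≤ (8 * Q) (<⇒≤ (≤-<-trans A≤g g<B)))
    bound {A = A} {B} (node T s f c) = begin
      _ ≤⟨ +-mono-≤ (node-bound T s f c) (*-monoʳ-≤ (8 * Q) (A≤a f)) ⟩
      8 * Q * k T + 8 * Q * a T  ≡⟨ +-comm (8 * Q * k T) _ ⟩
      8 * Q * a T + 8 * Q * k T  ≡⟨ *-distribˡ-+ (8 * Q) (a T) (k T) ⟨
      8 * Q * b T                ≤⟨ *-monoʳ-≤ (8 * Q) (b≤B f) ⟩
      8 * Q * B ∎
      where open ≤-Reasoning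

    -- Unmoved zone keys are at most `lo` or at least `hi`, and the child charges only keys strictly
    -- between `lo` and `hi`. Thus no relocated key is charged twice.
    charged-total : ∀ {P y A B} ρ (c : Chain P y A B) → charged ρ c + Σ< ρ (suc A) ≤ Σ< ρ B
    charged-total ρ (done _ A≤g g<B _) = Σ<-mono ρ (≤-<-trans A≤g g<B)
    charged-total {A = A} {B} ρ (node {lo = lo} {hi} T s f c) =
      ≤-by (S (a T + 6 * z T) + S (suc lo) + S hi + S (suc (a T + 9 * z T + z T)))
        (+-mono-≤ (+-mono-≤ (+-mono-≤ left (charged-total ρ c)) right) (+-mono-≤ (Σ<-mono ρ A<) (Σ<-mono ρ <B)))
        (eq (gone ρ (UL T)) (gone ρ (UR T)) (charged ρ c) (S (suc A)) (S (a T + 6 * z T)) (S (suc lo)) (S hi) (S (suc (a T + 9 * z T + z T))))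
        (eq′ (S (suc lo)) (S hi) (S (suc (a T + 9 * z T + z T))) (S (a T + 6 * z T)) (S B))
      where
      S = Σ< ρ
      left : gone ρ (UL T) + S (a T + 6 * z T) ≤ S (suc lo)
      left = gone-descending ρ (UL T) (UL-sorted T) (All.tabulate λ x∈ → proj₁ (UL-range T x∈))
               (All.tabulate λ x∈ → s≤s (UL≤ f x∈)) (m≤n⇒m≤1+n (lo≥ f))
      right : gone ρ (UR T) + S hi ≤ S (suc (a T + 9 * z T + z T))
      right = gone-ascending ρ (UR T) (UR-sorted T) (All.tabulate (UR≥ f))
                (All.tabulate λ x∈ → s≤s (proj₂ (UR-range T x∈))) (m≤n⇒m≤1+n (hi≤ f))
      A< : suc A ≤ a T + 6 * z T
      A< = ≤-trans (s≤s (A≤a f)) (≤-trans (≤-reflexive (+-comm 1 (a T)))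
             (+-monoʳ-≤ (a T) (≤-trans (z>0 T) (m≤n*m (z T) 6))))
      <B : suc (a T + 9 * z T + z T) ≤ B
      <B = ≤-trans (≤-trans (≤-reflexive (+-comm 1 _)) (≤-trans (+-monoʳ-≤ (a T + 9 * z T + z T) (z>0 T))
             (≤-trans (m≤m+n _ (5 * z T + e T)) (≤-reflexive (eq₀ (a T) (z T) (e T)))))) (b≤B f)
        where
        eq₀ : ∀ a z e → a + 9 * z + z + z + (5 * z + e) ≡ a + (16 * z + e)
        eq₀ = solve-∀
      eq : ∀ gl gr ch sA s1 s2 s3 s4 →
           gl + gr + ch + sA + (s1 + s2 + s3 + s4) ≡ gl + s1 + (ch + s2) + (gr + s3) + (sA + s4)
      eq = solve-∀
      eq′ : ∀ s2 s3 s4 s1 sB → s2 + s3 + s4 + (s1 + sB) ≡ sB + (s1 + s2 + s3 + s4)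
      eq′ = solve-∀

    -- The price of one relocation. A window and its descendants owe at most `8 * Q * k`, and
    -- `k ≤ 17 * z`, so `z` relocations settle everything.
    E : ℕ
    E = 8 * Q * 17

    -- The potential is debt minus `E` times credit, and each insertion has to bring in `N` for each
    -- of the `y` young windows. A dead chain is paid in full, this insertion included, so it can be
    -- discarded and replaced by a fresh one.
    data Outcome {P y A B} (P′ ρ : ℕ → ℕ) (c : Chain P y A B) : Set where
      alive : (c′ : Chain P′ y A B) →
              N * y + debt c + E * credit c′ ≤ E * (charged ρ c + credit c) + debt c′ → Outcome P′ ρ c
      dead  : N * y + debt c ≤ E * (charged ρ c + credit c) → Outcome P′ ρ c

    fresh-outcome : ∀ {P P′ y A B A′ B′} ρ (c : Chain P y A B) (c′ : Chain P′ y A′ B′) → Fresh c′ →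
      N * y + debt c ≤ E * (charged ρ c + credit c) →
      N * y + debt c + E * credit c′ ≤ E * (charged ρ c + credit c) + debt c′
    fresh-outcome ρ c c′ (fresh d≡ cr≡) h rewrite d≡ | cr≡ =
      +-mono-≤ h (≤-reflexive (*-zeroʳ E))

    module Advance {P P′ ρ : ℕ → ℕ} {G g : ℕ} (mono′ : Monotone P′) (drop : Drop G P P′ ρ g) where

      advance : ∀ {y A B lo hi} (T : Node P y) → Fit T A B lo hi → lo ≤ g → g < hi → B ≤ G → Node P′ y
      advance T f lo≤g g<hi B≤G = record
        { a = a T ; z = z T ; e = e T ; d = d T ; X = X T ; age = suc (age T)
        ; mL = mL T + gone ρ (UL T) ; mR = mR T + gone ρ (UR T)
        ; UL = kept ρ (UL T) ; UR = kept ρ (UR T)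
        ; e≤z = e≤z T ; big = big T ; budget = budget T ; cap = cap T
        ; UL-sorted = AllPairs.filter⁺ (λ x → ρ x ≟ 0) (UL-sorted T)
        ; UR-sorted = AllPairs.filter⁺ (λ x → ρ x ≟ 0) (UR-sorted T)
        ; UL-range = λ x∈ → UL-range T (proj₁ (∈-filter⁻ (λ x → ρ x ≟ 0) x∈))
        ; UR-range = λ x∈ → UR-range T (proj₁ (∈-filter⁻ (λ x → ρ x ≟ 0) x∈))
        ; UL-count = count (mL T) (UL T) (UL-count T)
        ; UR-count = count (mR T) (UR T) (UR-count T)
        ; light = light′
        }
        where
        count : ∀ m xs → z T ≤ m + length xs → z T ≤ m + gone ρ xs + length (kept ρ xs)
        count m xs h = ≤-trans h (≤-trans (+-monoʳ-≤ m (length≤gone+kept ρ xs)) (≤-reflexive (sym (+-assoc m _ _))))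
        -- Both keys stayed in place, so `drop` lowers the weight between them by at least 1, which
        -- makes up for the age growing by 1.
        light′ : ∀ {l r} → l ∈ kept ρ (UL T) → r ∈ kept ρ (UR T) →
                 N * (P′ r + suc (age T)) + (X T + 8) * Q * l ≤ N * P′ l + (X T + 8) * Q * r
        light′ {l} {r} l∈ r∈ =
          let l∈U , ρl = ∈-filter⁻ (λ x → ρ x ≟ 0) l∈
              r∈U , ρr = ∈-filter⁻ (λ x → ρ x ≟ 0) r∈
              r≤G = ≤-trans (proj₂ (UR-range T r∈U)) (≤-trans (10z≤ T) (≤-trans (b≤B f) B≤G))
          in ≤-by (N * P l + N * P r)
               (+-mono-≤ (light T l∈U r∈U)
                 (*-monoʳ-≤ N (drop l r (≤-trans (UL≤ f l∈U) lo≤g) (<-≤-trans g<hi (UR≥ f r∈U)) r≤G ρl ρr)))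
               (eq N (P r) (P l) (P′ r) (age T) ((X T + 8) * Q * l))
               (eq′ N (P r) (P l) (P′ l) ((X T + 8) * Q * r))
          where
          eq : ∀ N pr pl pr′ age x → N * (pr′ + suc age) + x + (N * pl + N * pr) ≡ N * (pr + age) + x + N * (pr′ + pl + 1)
          eq = solve-∀
          eq′ : ∀ N pr pl pl′ x → N * pl + x + N * (pr + pl′) ≡ N * pl′ + x + (N * pl + N * pr)
          eq′ = solve-∀

    module Rebuild {P : ℕ → ℕ} (mono : Monotone P) {y : ℕ} (T : Node P y) {l r : ℕ} (l∈ : l ∈ UL T) (r∈ : r ∈ UR T) where

      open Build P mono

      apart : l + z T ≤ r
      apart = ≤-trans (+-monoˡ-≤ (z T) (proj₂ (UL-range T l∈)))
        (≤-trans (≤-trans (m≤m+n _ (z T)) (≤-reflexive (eq (a T) (z T)))) (proj₁ (UR-range T r∈)))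
        where
        eq : ∀ a z → a + 6 * z + z + z + z ≡ a + 9 * z
        eq = solve-∀

      rebuild : ∀ X₁ y₁ → Light P X₁ l r → X₁ + 9 * y₁ ≤ d T → X₁ + 8 * y₁ ≤ 9 * R → Σ (Chain P y₁ l r) Fresh
      rebuild X₁ y₁ h = build (d T) X₁ y₁ l r h (≤-trans (+-monoʳ-≤ l (big T)) apart)

      light-young : Light P (X T + 8) l r
      light-young = ≤-trans (+-monoˡ-≤ _ (*-monoʳ-≤ N (m≤m+n (P r) (age T)))) (light T l∈ r∈)

      -- Over a length of at most `k / 3` the age is worth 9 quanta: the 8 allowed at birth and one
      -- more. At `X = 0` the weight between `l` and `r` would be negative.
      light-old : 3 * Q * k T ≤ N * age T → ∃ λ X₁ → X T ≡ suc X₁ × Light P X₁ l r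
      light-old h = go (X T) (light T l∈ r∈)
        where
        9r≤ : 9 * r ≤ 3 * k T + 9 * l
        9r≤ = begin
          9 * r                              ≤⟨ *-monoʳ-≤ 9 (proj₂ (UR-range T r∈)) ⟩
          9 * (a T + 9 * z T + z T)          ≤⟨ m≤m+n _ (12 * z T + 3 * e T) ⟩
          9 * (a T + 9 * z T + z T) + (12 * z T + 3 * e T) ≡⟨ eq (a T) (z T) (e T) ⟩
          3 * k T + 9 * (a T + 6 * z T)      ≤⟨ +-monoʳ-≤ (3 * k T) (*-monoʳ-≤ 9 (proj₁ (UL-range T l∈))) ⟩
          3 * k T + 9 * l                    ∎
          where
          open ≤-Reasoning
          eq : ∀ a z e → 9 * (a + 9 * z + z) + (12 * z + 3 * e) ≡ 3 * (16 * z + e) + 9 * (a + 6 * z)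
          eq = solve-∀
        aged : ∀ x → N * (P r + age T) + x * Q * l ≤ N * P l + x * Q * r →
               N * P r + 9 * Q * r + x * Q * l ≤ N * P l + 9 * Q * l + x * Q * r
        aged x h′ = ≤-by (3 * Q * k T + N * age T)
          (+-mono-≤ (+-mono-≤ h′ h) (*-monoʳ-≤ Q 9r≤))
          (eq N (P r) (age T) (x * Q * l) (k T) Q r) (eq′ (N * P l) (x * Q * r) (N * age T) Q l (k T))
          where
          eq : ∀ N p age x k Q r → N * p + 9 * Q * r + x + (3 * Q * k + N * age) ≡ N * (p + age) + x + 3 * Q * k + Q * (9 * r)
          eq = solve-∀
          eq′ : ∀ p x n Q l k → p + x + n + Q * (3 * k + 9 * l) ≡ p + 9 * Q * l + x + (3 * Q * k + n)
          eq′ = solve-∀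
        go : ∀ x → N * (P r + age T) + (x + 8) * Q * l ≤ N * P l + (x + 8) * Q * r → ∃ λ X₁ → x ≡ suc X₁ × Light P X₁ l r
        go zero h′ = contradiction
          (≤-by (8 * Q * r + 8 * Q * l) (aged 8 h′) (eq (N * P r) Q r l) (eq′ (N * P l) Q r l))
          (<⇒≱ (+-mono-≤-< (*-monoʳ-≤ N (mono l≤r)) (*-monoʳ-< Q {{>-nonZero Q>0}} l<r)))
          where
          l<r : l < r
          l<r = ≤-trans (≤-trans (≤-reflexive (+-comm 1 l)) (+-monoʳ-≤ l (z>0 T))) apart
          l≤r : l ≤ r
          l≤r = <⇒≤ l<r
          eq : ∀ p Q r l → p + Q * r + (8 * Q * r + 8 * Q * l) ≡ p + 9 * Q * r + 8 * Q * l
          eq = solve-∀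
          eq′ : ∀ p Q r l → p + 9 * Q * l + 8 * Q * r ≡ p + Q * l + (8 * Q * r + 8 * Q * l)
          eq′ = solve-∀
        go (suc x) h′ = x , refl ,
          ≤-by (9 * Q * r + 9 * Q * l) (aged (suc x + 8) h′) (eq (N * P r) x Q r l) (eq′ (N * P l) x Q r l)
          where
          eq : ∀ p x Q r l → p + x * Q * l + (9 * Q * r + 9 * Q * l) ≡ p + 9 * Q * r + (suc x + 8) * Q * l
          eq = solve-∀
          eq′ : ∀ p x Q r l → p + 9 * Q * l + (suc x + 8) * Q * r ≡ p + x * Q * r + (9 * Q * r + 9 * Q * l)
          eq′ = solve-∀

    -- Since z ≥ k / 17, the relocations in an exhausted zone pay for the debts of the window and of its descendants.
    exhausted : ∀ {P P′ y y′ A B lo hi} ρ (T : Node P y) (s : Status T y′) (f : Fit T A B lo hi) (c : Chain P y′ lo hi) →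
                z T ≤ gone ρ (UL T) + gone ρ (UR T) + (mL T + mR T) → Outcome P′ ρ (node T s f c)
    exhausted ρ T s f c h = dead (begin
      _ ≤⟨ node-bound T s f c ⟩
      8 * Q * k T
        ≤⟨ *-monoʳ-≤ (8 * Q) (≤-trans (+-monoʳ-≤ (16 * z T) (e≤z T)) (≤-reflexive (eq (z T)))) ⟩
      8 * Q * (17 * z T)
        ≡⟨ *-assoc (8 * Q) 17 (z T) ⟨
      E * z T
        ≤⟨ *-monoʳ-≤ E (≤-trans h (≤-trans (m≤m+n _ (charged ρ c + credit c))
             (≤-reflexive (eq′ (gone ρ (UL T) + gone ρ (UR T)) (mL T + mR T) (charged ρ c) (credit c))))) ⟩
      _ ∎)
      where
      open ≤-Reasoning
      eq : ∀ z → 16 * z + z ≡ 17 * z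
      eq = solve-∀
      eq′ : ∀ g m ch cr → g + m + (ch + cr) ≡ g + ch + (m + cr)
      eq′ = solve-∀

    module Step {P P′ ρ : ℕ → ℕ} {G g : ℕ} (mono′ : Monotone P′) (drop : Drop G P P′ ρ g) where

      open Advance {P} {P′} {ρ} {G} {g} mono′ drop

      module AtNode {y A B lo hi} (T : Node P y) (f : Fit T A B lo hi)
        (lo≤g : lo ≤ g) (g<hi : g < hi) (B≤G : B ≤ G) where

        T′ : Node P′ y
        T′ = advance T f lo≤g g<hi B≤G

        same : Fit T′ A B lo hi
        same = record
          { A≤a = A≤a f ; b≤B = b≤B f ; lo≥ = lo≥ f ; hi≤ = hi≤ f
          ; UL≤ = λ x∈ → UL≤ f (proj₁ (∈-filter⁻ (λ x → ρ x ≟ 0) x∈))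
          ; UR≥ = λ x∈ → UR≥ f (proj₁ (∈-filter⁻ (λ x → ρ x ≟ 0) x∈)) }

        module Alive {l ls r rs} (L≡ : UL T′ ≡ l ∷ ls) (R≡ : UR T′ ≡ r ∷ rs) where

          l∈ : l ∈ UL T′
          l∈ = subst (l ∈_) (sym L≡) (here refl)

          r∈ : r ∈ UR T′
          r∈ = subst (r ∈_) (sym R≡) (here refl)

          open Rebuild mono′ T′ l∈ r∈ public

          refit : Fit T′ A B l r
          refit = record
            { A≤a = A≤a f ; b≤B = b≤B f ; lo≥ = proj₁ (UL-range T′ l∈) ; hi≤ = proj₂ (UR-range T′ r∈)
            ; UL≤ = λ x∈ → topmost (subst (AllPairs _>_) L≡ (UL-sorted T′)) (subst (_ ∈_) L≡ x∈)
            ; UR≥ = λ x∈ → bottommost (subst (AllPairs _<_) R≡ (UR-sorted T′)) (subst (_ ∈_) R≡ x∈) }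
            where
            topmost : ∀ {x} → AllPairs _>_ (l ∷ ls) → x ∈ l ∷ ls → x ≤ l
            topmost _        (here refl) = ≤-refl
            topmost (l> ∷ _) (there x∈)  = <⇒≤ (All.lookup l> x∈)
            bottommost : ∀ {x} → AllPairs _<_ (r ∷ rs) → x ∈ r ∷ rs → r ≤ x
            bottommost _        (here refl) = ≤-refl
            bottommost (r< ∷ _) (there x∈)  = <⇒≤ (All.lookup r< x∈)

      -- The child accounts for `N * y`; the remaining `N` is the growth of the window's own debt
      -- with its age.
      settle-young : ∀ {y A B lo hi lo′ hi′} (T : Node P (suc y)) (age< : N * age T < 3 * Q * k T)
        (f : Fit T A B lo hi) (c : Chain P y lo hi) (T′ : Node P′ (suc y)) (s′ : Status T′ y) (f′ : Fit T′ A B lo′ hi′)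
        (c′ : Chain P′ y lo′ hi′) → own s′ ≡ N * suc (age T) →
        mL T′ ≡ mL T + gone ρ (UL T) → mR T′ ≡ mR T + gone ρ (UR T) →
        N * y + debt c + E * credit c′ ≤ E * (charged ρ c + credit c) + debt c′ →
        Outcome P′ ρ (node T (young age<) f c)
      settle-young {y} T age< f c T′ s′ f′ c′ own≡ mL≡ mR≡ h = alive (node T′ s′ f′ c′)
        (≤-trans (≤-reflexive (trans (cong (λ m → N * suc y + (N * age T + debt c) + E * (m + credit c′)) (cong₂ _+_ mL≡ mR≡))
            (eq N y (age T) (debt c) E (mL T) (gone ρ (UL T)) (mR T) (gone ρ (UR T)) (credit c′))))
          (≤-trans (+-monoˡ-≤ _ h)
            (≤-reflexive (trans (eq′ N (age T) (debt c′) E (mL T) (gone ρ (UL T)) (mR T) (gone ρ (UR T)) (credit c) (charged ρ c))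
              (cong (λ o → E * (gone ρ (UL T) + gone ρ (UR T) + charged ρ c + (mL T + mR T + credit c)) + (o + debt c′)) (sym own≡))))))
        where
        eq : ∀ N y age d E mL gL mR gR cr′ →
             N * suc y + (N * age + d) + E * (mL + gL + (mR + gR) + cr′) ≡
             N * y + d + E * cr′ + (N * suc age + E * (mL + gL + (mR + gR)))
        eq = solve-∀
        eq′ : ∀ N age d′ E mL gL mR gR cr ch →
              E * (ch + cr) + d′ + (N * suc age + E * (mL + gL + (mR + gR))) ≡
              E * (gL + gR + ch + (mL + mR + cr)) + (N * suc age + d′)
        eq′ = solve-∀

      settle-old : ∀ {y A B lo hi lo′ hi′} (T : Node P y) (aged : 3 * Q * k T ≤ N * age T)
        (f : Fit T A B lo hi) (c : Chain P y lo hi) (T′ : Node P′ y) (aged′ : 3 * Q * k T′ ≤ N * age T′) (f′ : Fit T′ A B lo′ hi′)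
        (c′ : Chain P′ y lo′ hi′) → k T′ ≡ k T →
        mL T′ ≡ mL T + gone ρ (UL T) → mR T′ ≡ mR T + gone ρ (UR T) →
        N * y + debt c + E * credit c′ ≤ E * (charged ρ c + credit c) + debt c′ →
        Outcome P′ ρ (node T (old aged) f c)
      settle-old {y} T aged f c T′ aged′ f′ c′ k≡ mL≡ mR≡ h = alive (node T′ (old aged′) f′ c′)
        (≤-trans (≤-reflexive (trans (cong (λ m → N * y + (6 * Q * k T + debt c) + E * (m + credit c′)) (cong₂ _+_ mL≡ mR≡))
            (eq (N * y) (6 * Q * k T) (debt c) E (mL T) (gone ρ (UL T)) (mR T) (gone ρ (UR T)) (credit c′))))
          (≤-trans (+-monoˡ-≤ _ h)
            (≤-reflexive (trans (eq′ (6 * Q * k T) (debt c′) E (mL T) (gone ρ (UL T)) (mR T) (gone ρ (UR T)) (credit c) (charged ρ c))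
              (cong (λ o → E * (gone ρ (UL T) + gone ρ (UR T) + charged ρ c + (mL T + mR T + credit c)) + (6 * Q * o + debt c′)) (sym k≡))))))
        where
        eq : ∀ ny o d E mL gL mR gR cr′ →
             ny + (o + d) + E * (mL + gL + (mR + gR) + cr′) ≡ ny + d + E * cr′ + (o + E * (mL + gL + (mR + gR)))
        eq = solve-∀
        eq′ : ∀ o d′ E mL gL mR gR cr ch →
              E * (ch + cr) + d′ + (o + E * (mL + gL + (mR + gR))) ≡ E * (gL + gR + ch + (mL + mR + cr)) + (o + d′)
        eq′ = solve-∀

      -- The window turns old and its descendants are abandoned. By `young-bound` the flat debt
      -- covers theirs, the age and this insertion; the new child has to supply one more young
      -- window in its stead.
      settle-aged : ∀ {y A B lo hi lo′ hi′} (T : Node P (suc y)) (age< : N * age T < 3 * Q * k T)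
        (f : Fit T A B lo hi) (c : Chain P y lo hi) (T′ : Node P′ (suc y)) (aged′ : 3 * Q * k T′ ≤ N * age T′) (f′ : Fit T′ A B lo′ hi′)
        (c′ : Chain P′ (suc y) lo′ hi′) → k T′ ≡ k T →
        mL T′ ≡ mL T + gone ρ (UL T) → mR T′ ≡ mR T + gone ρ (UR T) → Fresh c′ →
        Outcome P′ ρ (node T (young age<) f c)
      settle-aged {y} T age< f c T′ aged′ f′ c′ k≡ mL≡ mR≡ (fresh d≡ cr≡) = alive (node T′ (old aged′) f′ c′) (begin
        N * suc y + (N * age T + debt c) + E * (mL T′ + mR T′ + credit c′)
          ≤⟨ +-mono-≤ (young-bound T (<⇒≤ age<) f c) (*-monoʳ-≤ E moves) ⟩
        6 * Q * k T + E * (gone ρ (UL T) + gone ρ (UR T) + charged ρ c + (mL T + mR T + credit c))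
          ≡⟨ +-comm (6 * Q * k T) _ ⟩
        E * (gone ρ (UL T) + gone ρ (UR T) + charged ρ c + (mL T + mR T + credit c)) + 6 * Q * k T
          ≡⟨ cong (E * (gone ρ (UL T) + gone ρ (UR T) + charged ρ c + (mL T + mR T + credit c)) +_)
               (trans (cong (6 * Q *_) (sym k≡)) (trans (sym (+-identityʳ _)) (cong (6 * Q * k T′ +_) (sym d≡)))) ⟩
        _ ∎)
        where
        open ≤-Reasoning
        eq : ∀ mL gL mR gR ch cr → mL + gL + (mR + gR) + 0 + (ch + cr) ≡ gL + gR + ch + (mL + mR + cr)
        eq = solve-∀
        moves : mL T′ + mR T′ + credit c′ ≤ gone ρ (UL T) + gone ρ (UR T) + charged ρ c + (mL T + mR T + credit c)
        moves = ≤-trans (≤-reflexive (cong₂ _+_ (cong₂ _+_ mL≡ mR≡) cr≡))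
          (≤-trans (m≤m+n _ (charged ρ c + credit c))
            (≤-reflexive (eq (mL T) (gone ρ (UL T)) (mR T) (gone ρ (UR T)) (charged ρ c) (credit c))))

      respond : ∀ {y y′ A B lo hi} (T : Node P y) (s : Status T y′) (f : Fit T A B lo hi) (c : Chain P y′ lo hi)
        (lo≤g : lo ≤ g) (g<hi : g < hi) (B≤G : B ≤ G) → Outcome P′ ρ c → ∀ us vs →
        UL (AtNode.T′ T f lo≤g g<hi B≤G) ≡ us → UR (AtNode.T′ T f lo≤g g<hi B≤G) ≡ vs →
        Outcome P′ ρ (node T s f c)
      respond T s f c lo≤g g<hi B≤G rec [] _ L≡ _ = exhausted ρ T s f c (begin
        z T                                                  ≤⟨ UL-count T′ ⟩
        mL T + gone ρ (UL T) + length (UL T′)                ≡⟨ cong (λ us → mL T + gone ρ (UL T) + length us) L≡ ⟩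
        mL T + gone ρ (UL T) + 0                             ≤⟨ m≤m+n _ (gone ρ (UR T) + mR T) ⟩
        mL T + gone ρ (UL T) + 0 + (gone ρ (UR T) + mR T)    ≡⟨ eq (mL T) (gone ρ (UL T)) (gone ρ (UR T)) (mR T) ⟩
        gone ρ (UL T) + gone ρ (UR T) + (mL T + mR T)        ∎)
        where
        open ≤-Reasoning
        open AtNode T f lo≤g g<hi B≤G using (T′)
        eq : ∀ ml gl gr mr → ml + gl + 0 + (gr + mr) ≡ gl + gr + (ml + mr)
        eq = solve-∀
      respond T s f c lo≤g g<hi B≤G rec (_ ∷ _) [] _ R≡ = exhausted ρ T s f c (begin
        z T                                                  ≤⟨ UR-count T′ ⟩
        mR T + gone ρ (UR T) + length (UR T′)                ≡⟨ cong (λ us → mR T + gone ρ (UR T) + length us) R≡ ⟩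
        mR T + gone ρ (UR T) + 0                             ≤⟨ m≤m+n _ (gone ρ (UL T) + mL T) ⟩
        mR T + gone ρ (UR T) + 0 + (gone ρ (UL T) + mL T)    ≡⟨ eq (mL T) (gone ρ (UL T)) (gone ρ (UR T)) (mR T) ⟩
        gone ρ (UL T) + gone ρ (UR T) + (mL T + mR T)        ∎)
        where
        open ≤-Reasoning
        open AtNode T f lo≤g g<hi B≤G using (T′)
        eq : ∀ ml gl gr mr → mr + gr + 0 + (gl + ml) ≡ gl + gr + (ml + mr)
        eq = solve-∀
      respond {y′ = y} T (young age<) f c lo≤g g<hi B≤G rec (_ ∷ _) (_ ∷ _) L≡ R≡ =
        go rec (N * suc (age T) <? 3 * Q * k T)
        where
        open AtNode T f lo≤g g<hi B≤G
        open Alive L≡ R≡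
        go : Outcome P′ ρ c → Dec (N * suc (age T) < 3 * Q * k T) → Outcome P′ ρ (node T (young age<) f c)
        go (alive c′ h) (yes age<′) = settle-young T age< f c T′ (young age<′) same c′ refl refl refl h
        go (dead h)     (yes age<′) =
          let c′ , fr = rebuild (X T + 8) y light-young (spend-young (X T) y (d T) (budget T)) (cap-young (X T) y (cap T))
          in settle-young T age< f c T′ (young age<′) refit c′ refl refl refl (fresh-outcome ρ c c′ fr h)
        -- At the age limit the child is replaced even if it is alive, since the part between `l`
        -- and `r` is now a quantum lighter than the window was at birth.
        go _            (no age≮)   =
          let aged = ≮⇒≥ age≮
              X₁ , X≡ , h₁ = light-old aged
              c′ , fr = rebuild X₁ (suc y) h₁ (s≤s⁻¹ (subst (λ X → X + 9 * suc y ≤ suc (d T)) X≡ (budget T)))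
                          (<⇒≤ (subst (λ X → X + 8 * suc y ≤ 9 * R) X≡ (cap T)))
          in settle-aged T age< f c T′ aged refit c′ refl refl refl fr
      respond {y′ = y} T (old aged) f c lo≤g g<hi B≤G rec (_ ∷ _) (_ ∷ _) L≡ R≡ = go rec
        where
        open AtNode T f lo≤g g<hi B≤G
        open Alive L≡ R≡
        aged′ : 3 * Q * k T ≤ N * suc (age T)
        aged′ = ≤-trans aged (*-monoʳ-≤ N (n≤1+n (age T)))
        go : Outcome P′ ρ c → Outcome P′ ρ (node T (old aged) f c)
        go (alive c′ h) = settle-old T aged f c T′ aged′ same c′ refl refl refl h
        go (dead h)     =
          let X₁ , X≡ , h₁ = light-old aged′
              c′ , fr = rebuild X₁ y h₁ (s≤s⁻¹ (subst (λ X → X + 9 * y ≤ suc (d T)) X≡ (budget T)))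
                          (<⇒≤ (subst (λ X → X + 8 * y ≤ 9 * R) X≡ (cap T)))
          in settle-old T aged f c T′ aged′ refit c′ refl refl refl (fresh-outcome ρ c c′ fr h)

      step : ∀ {y A B} (c : Chain P y A B) → g ≡ target c → B ≤ G → Outcome P′ ρ c
      -- Nothing is owed at the end of a chain, so it is declared dead after every insertion and the
      -- innermost window chooses anew.
      step (done _ _ _ _) _ _ = dead (≤-trans (≤-reflexive (trans (+-identityʳ (N * 0)) (*-zeroʳ N))) z≤n)
      step (node {lo = lo} {hi} T s f c) g≡ B≤G =
        respond T s f c (subst (lo ≤_) (sym g≡) (target-≥ c)) (subst (_< hi) (sym g≡) (target-< c)) B≤G
          (step c g≡ (≤-trans (hi≤B f) B≤G)) _ _ refl refl

  -- The abstract game and a single phase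

  record Game : Set₁ where
    field
      n G q  : ℕ
      State  : ℕ → Set
      weight : ∀ {t} → State t → ℕ → ℕ
      paid   : ∀ {t} → State t → ℕ
      insert : ∀ {t} → t < n → (s : State t) → ∀ g → g < G → weight s g < q →
               ∃ λ (s′ : State (suc t)) → ∃ λ ρ →
                 paid s + Σ< ρ G ≤ paid s′ × Drop G (Σ< (weight s)) (Σ< (weight s′)) ρ g

    total : ∀ {t} → State t → ℕ → ℕ
    total s = Σ< (weight s)

  module _ (Γ : Game) where

    open Game Γ

    module Phase (R Q s₀ : ℕ) (R>0 : 0 < R) (Q>0 : 0 < Q) (15≤s₀ : 15 ≤ s₀)
      (RG≤s₀Q : R * G ≤ s₀ * Q) (size : s₀ * 16 ^ (10 * R) ≤ G) (9Q<qG : 9 * Q < q * G) where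

      N : ℕ
      N = R * G

      open Chains R N Q s₀ RG≤s₀Q 15≤s₀ Q>0
      open Steps R N Q s₀ RG≤s₀Q 15≤s₀ Q>0

      mono : ∀ {t} (s : State t) → Monotone (total s)
      mono s = Σ<-mono (weight s)

      root : ∀ {t} (s : State t) → total s G ≤ Q → Σ (Chain (total s) R 0 G) Fresh
      root s P≤Q = Build.build (total s) (mono s) (10 * R) R R 0 G light₀ size
        (≤-reflexive (eq R)) (≤-reflexive refl)
        where
        eq : ∀ R → R + 9 * R ≡ 10 * R
        eq = solve-∀
        light₀ : Light (total s) R 0 G
        light₀ = begin
          N * total s G + R * Q * 0   ≡⟨ trans (cong (N * total s G +_) (*-zeroʳ (R * Q))) (+-identityʳ _) ⟩
          N * total s G               ≤⟨ *-monoʳ-≤ N P≤Q ⟩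
          N * Q                       ≡⟨ eq′ R G Q ⟩
          N * 0 + R * Q * G           ∎
          where
          open ≤-Reasoning
          eq′ : ∀ R G Q → R * G * Q ≡ R * G * 0 + R * Q * G
          eq′ = solve-∀

      -- With `N = R * G` a quantum is `Q / (R * G)`, so `9 * R` quanta are 9 times the average
      -- `Q / G`.
      target-weight : ∀ {t} (s : State t) (c : Chain (total s) R 0 G) → weight s (target c) < q
      target-weight s c = *-cancelʳ-< G (weight s (target c)) q (≤-<-trans w≤ 9Q<qG)
        where
        w : ℕ
        w = weight s (target c)
        instance
          R≢0 : NonZero R
          R≢0 = >-nonZero R>0
        eq : ∀ R G w p → R * (w * G) + R * G * p ≡ R * G * (p + w)
        eq = solve-∀
        eq′ : ∀ R Q p → p + 9 * R * Q ≡ R * (9 * Q) + p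
        eq′ = solve-∀
        w≤ : w * G ≤ 9 * Q
        w≤ = *-cancelˡ-≤ R (≤-by (N * total s (target c)) (target-light c)
          (eq R G w (total s (target c))) (eq′ R Q (N * total s (target c))))

      -- When the outermost window dies all debts have been settled, so starting over with a fresh
      -- chain loses nothing.
      one : ∀ {t} → t < n → (s : State t) (c : Chain (total s) R 0 G) →
            (∀ {t′} (s′ : State t′) → t ≤ t′ → total s′ G ≤ Q) →
            ∃ λ (s′ : State (suc t)) → ∃ λ (c′ : Chain (total s′) R 0 G) →
              N * R + debt c + E * credit c′ + E * paid s ≤ E * paid s′ + (E * credit c + debt c′)
      one {t} t<n s c bounded =
        let s′ , ρ , paid≤ , drop = insert t<n s (target c) (target-< c) (target-weight s c)
            c′ , h = settle s′ ρ (Step.step (mono s′) drop c refl ≤-refl)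
            charged≤ = ≤-trans (m≤m+n (charged ρ c) (Σ< ρ 1)) (charged-total ρ c)
        in s′ , c′ , ≤-by (E * charged ρ c + E * Σ< ρ G)
             (+-mono-≤ (+-mono-≤ h (*-monoʳ-≤ E charged≤)) (*-monoʳ-≤ E paid≤))
             (eq (N * R + debt c + E * credit c′) E (paid s) (charged ρ c) (Σ< ρ G))
             (eq′ E (paid s′) (charged ρ c) (credit c) (debt c′) (Σ< ρ G))
        where
        settle : (s′ : State (suc t)) (ρ : ℕ → ℕ) → Outcome (total s′) ρ c →
                 ∃ λ (c′ : Chain (total s′) R 0 G) → N * R + debt c + E * credit c′ ≤ E * (charged ρ c + credit c) + debt c′
        settle s′ ρ (alive c′ h) = c′ , h
        settle s′ ρ (dead h) =
          let c′ , f = root s′ (bounded s′ (n≤1+n t)) in c′ , fresh-outcome ρ c c′ f h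
        eq : ∀ x E p ch S → x + E * p + (E * ch + E * S) ≡ x + E * ch + E * (p + S)
        eq = solve-∀
        eq′ : ∀ E p′ ch cr d S → E * (ch + cr) + d + E * S + E * p′ ≡ E * p′ + (E * cr + d) + (E * ch + E * S)
        eq′ = solve-∀

      run : ∀ ω {t} → ω + t ≤ n → (s : State t) (c : Chain (total s) R 0 G) →
            (∀ {t′} (s′ : State t′) → t ≤ t′ → total s′ G ≤ Q) →
            ∃ λ (s′ : State (ω + t)) → ∃ λ (c′ : Chain (total s′) R 0 G) →
              ω * (N * R) + debt c + E * credit c′ + E * paid s ≤ E * paid s′ + (E * credit c + debt c′)
      run zero    _   s c _ = s , c , ≤-reflexive (eq (debt c) E (credit c) (paid s))
        where
        eq : ∀ d E cr p → d + E * cr + E * p ≡ E * p + (E * cr + d)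
        eq = solve-∀
      run (suc ω) {t} ≤n s c bounded =
        let s₁ , c₁ , h₁ = run ω (<⇒≤ ≤n) s c bounded
            s₂ , c₂ , h₂ = one ≤n s₁ c₁ (λ s′ le → bounded s′ (≤-trans (m≤n+m t ω) le))
        in s₂ , c₂ , ≤-by (E * credit c₁ + debt c₁ + E * paid s₁) (+-mono-≤ h₁ h₂)
             (eq (N * R) (ω * (N * R)) (debt c) (E * credit c₂) (E * paid s) (E * credit c₁) (debt c₁) (E * paid s₁))
             (eq′ (E * paid s₁) (E * credit c) (debt c₁) (E * paid s₂) (E * credit c₁) (debt c₂))
        where
        eq : ∀ x y d k2 p k1 d1 p1 → x + y + d + k2 + p + (k1 + d1 + p1) ≡ y + d + k1 + p + (x + d1 + k2 + p1)
        eq = solve-∀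
        eq′ : ∀ p1 k d1 p2 k1 d2 → p1 + (k + d1) + (p2 + (k1 + d2)) ≡ p2 + (k + d2) + (k1 + d1 + p1)
        eq′ = solve-∀

      -- Each insertion brings in `N * R`. At the end some debt may still be unpaid, but by `bound`
      -- no more than `8 * Q * G`.
      phase : ∀ ω {t} → ω + t ≤ n → (s : State t) → (∀ {t′} (s′ : State t′) → t ≤ t′ → total s′ G ≤ Q) →
              ∃ λ (s′ : State (ω + t)) → ω * (N * R) + E * paid s ≤ E * paid s′ + 8 * Q * G
      phase ω ≤n s bounded =
        let c₀ , fresh d≡ cr≡ = root s (bounded s ≤-refl)
            s₁ , c₁ , h = run ω ≤n s c₀ bounded
        in s₁ , (begin
          ω * (N * R) + E * paid s
            ≤⟨ +-monoˡ-≤ (E * paid s) (≤-trans (m≤m+n _ (debt c₀)) (m≤m+n _ (E * credit c₁))) ⟩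
          ω * (N * R) + debt c₀ + E * credit c₁ + E * paid s
            ≤⟨ h ⟩
          E * paid s₁ + (E * credit c₀ + debt c₁)
            ≡⟨ cong (λ x → E * paid s₁ + (x + debt c₁)) (trans (cong (E *_) cr≡) (*-zeroʳ E)) ⟩
          E * paid s₁ + debt c₁
            ≤⟨ +-monoʳ-≤ (E * paid s₁) (debt≤ c₁) ⟩
          E * paid s₁ + 8 * Q * G ∎)
        where
        open ≤-Reasoning
        debt≤ : ∀ {t} {s : State t} (c : Chain (total s) R 0 G) → debt c ≤ 8 * Q * G
        debt≤ c = ≤-trans (m≤n+m (debt c) (N * R)) (≤-trans (m≤m+n _ (8 * Q * 0)) (bound c))

  -- Iteration of the phases

  below-average : ∀ (w : ℕ → ℕ) q x → Σ< w x < q * x → ∃ λ g → g < x × w g < q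
  below-average w q zero    h = contradiction (≤-trans h (≤-reflexive (*-zeroʳ q))) λ ()
  below-average w q (suc x) h with w x <? q
  ... | yes w<q = x , ≤-refl , w<q
  ... | no  w≮q =
    let g , g<x , wg<q = below-average w q x (+-cancelʳ-< (w x) (Σ< w x) (q * x)
          (<-≤-trans h (≤-trans (≤-reflexive (trans (*-suc q x) (+-comm q (q * x)))) (+-monoʳ-≤ (q * x) (≮⇒≥ w≮q)))))
    in g , m≤n⇒m≤1+n g<x , wg<q

  quarter : ∀ H → H / 4 + H / 4 ≤ H
  quarter H = ≤-trans (≤-trans (m≤m+n (H / 4 + H / 4) (2 * (H / 4))) (≤-reflexive (eq (H / 4)))) (m/n*n≤m H 4)
    where
    eq : ∀ a → a + a + 2 * a ≡ a * 4
    eq = solve-∀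

  H≤8quarter : ∀ H → 4 ≤ H → H ≤ 8 * (H / 4)
  H≤8quarter H 4≤H = begin
    H                        ≡⟨ m≡m%n+[m/n]*n H 4 ⟩
    H % 4 + H / 4 * 4        ≤⟨ +-monoˡ-≤ (H / 4 * 4) (≤-trans (<⇒≤ (m%n<n H 4)) (*-monoˡ-≤ 4 (/-monoˡ-≤ 4 4≤H))) ⟩
    H / 4 * 4 + H / 4 * 4    ≡⟨ eq (H / 4) ⟩
    8 * (H / 4)              ∎
    where
    open ≤-Reasoning
    eq : ∀ a → a * 4 + a * 4 ≡ 8 * a
    eq = solve-∀

  abstract
    κ : ℕ
    κ = 16 * (8 * 3 * 17)

    κ≡ : κ ≡ 16 * (8 * 3 * 17)
    κ≡ = refl

  -- For `Q = 3 * H` the price `E` is `c * H` with `c = 8 * 3 * 17`, so `H` cancels. A phase has at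
  -- least `H / 8` steps, and after doubling, one of the two copies of `R * R * G` absorbs the
  -- unpaid debt. The factors 8 and 2 give the 16 in `κ`.
  phase-gain : ∀ c G H R ω p p′ → 0 < H → H ≤ 8 * ω → 384 * G ≤ R * R * G →
    ω * (R * G * R) + c * H * p ≤ c * H * p′ + 24 * H * G → R * R * G + 16 * c * p ≤ 16 * c * p′
  phase-gain c G H R ω p p′ H>0 H≤ R≥20 h = ≤-by (R * R * G + 384 * G)
    (+-mono-≤ (*-monoʳ-≤ 2 cancelled) R≥20)
    (eq₁ (R * R * G) c p (384 * G)) (eq₂ c p′ G (R * R * G))
    where
    cancelled : R * R * G + 8 * c * p ≤ 8 * c * p′ + 192 * G
    cancelled = *-cancelˡ-≤ H {{>-nonZero H>0}} (begin
      H * (R * R * G + 8 * c * p)                ≡⟨ eq₃ H R G c p ⟩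
      H * (R * G * R) + 8 * (c * H * p)          ≤⟨ +-monoˡ-≤ _ (*-monoˡ-≤ (R * G * R) H≤) ⟩
      8 * ω * (R * G * R) + 8 * (c * H * p)      ≡⟨ eq₄ ω (R * G * R) (c * H * p) ⟩
      8 * (ω * (R * G * R) + c * H * p)          ≤⟨ *-monoʳ-≤ 8 h ⟩
      8 * (c * H * p′ + 24 * H * G)              ≡⟨ eq₅ c H p′ G ⟩
      H * (8 * c * p′ + 192 * G)                 ∎)
      where
      open ≤-Reasoning
      eq₃ : ∀ H R G c p → H * (R * R * G + 8 * c * p) ≡ H * (R * G * R) + 8 * (c * H * p)
      eq₃ = solve-∀
      eq₄ : ∀ ω x y → 8 * ω * x + 8 * y ≡ 8 * (ω * x + y)
      eq₄ = solve-∀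
      eq₅ : ∀ c H p G → 8 * (c * H * p + 24 * H * G) ≡ H * (8 * c * p + 192 * G)
      eq₅ = solve-∀
    eq₁ : ∀ x c p y → x + 16 * c * p + (x + y) ≡ 2 * (x + 8 * c * p) + y
    eq₁ = solve-∀
    eq₂ : ∀ c p G x → 2 * (8 * c * p + 192 * G) + x ≡ 16 * c * p + (x + 384 * G)
    eq₂ = solve-∀

  module _ (Γ : Game) where

    open Game Γ

    module Loop (m D L R s₀ e : ℕ)
      (m≡ : m ≡ D + n) (D≤e : D ≤ e) (e≤m : e ≤ m) (4≤e : 4 ≤ e) (qn≤Le : q * n ≤ L * e)
      (R>0 : 0 < R) (384≤R² : 384 ≤ R * R) (15≤s₀ : 15 ≤ s₀) (RG≤ : R * G ≤ s₀ * (3 * e)) (size : s₀ * 16 ^ (10 * R) ≤ G)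
      (27m<qG : 27 * m < q * G)
      (bounded : ∀ H {t} (s : State t) → m ≤ H + t → q * n ≤ L * H → total s G ≤ 3 * H) where

      -- A phase of `H / 4` insertions starting with `H` empty cells. By `4 * e ≤ 3 * H` it leaves
      -- at least `e ≥ D` cells empty, so the number of keys stays within `n`.
      advance : ∀ H {t} (s : State t) → m ≡ H + t → 4 * e ≤ 3 * H →
                ∃ λ (s′ : State (H / 4 + t)) → H / 4 + t ≤ n × R * R * G + κ * paid s ≤ κ * paid s′
      advance H {t} s m≡H+t 4e≤3H =
        let s′ , h = phase (H / 4) ω+t≤n s (λ s′ t≤t′ → bounded H s′ (≤-trans (≤-reflexive m≡H+t) (+-monoʳ-≤ H t≤t′)) qn≤LH)
        in s′ , ω+t≤n , subst (λ κ → R * R * G + κ * paid s ≤ κ * paid s′) (sym κ≡) (phase-gain (8 * 3 * 17) G H R (H / 4) (paid s) (paid s′) H>0 (H≤8quarter H (≤-trans 4≤e e≤H))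
             (*-monoˡ-≤ G 384≤R²)
             (subst₂ _≤_ (cong (λ x → H / 4 * (R * G * R) + x * paid s) (eq H)) (cong₂ (λ x y → x * paid s′ + y * G) (eq H) (eq′ H)) h))
        where
        H′ : ℕ
        H′ = H ∸ H / 4
        H≡ : H / 4 + H′ ≡ H
        H≡ = m+[n∸m]≡n (≤-trans (m≤m+n (H / 4) (H / 4)) (quarter H))
        e≤H′ : e ≤ H′
        e≤H′ = *-cancelˡ-≤ 4 (≤-by (H / 4 * 4) (+-mono-≤ 4e≤3H (m/n*n≤m H 4)) refl (trans (eq₄ H) (trans (cong (4 *_) (sym H≡)) (eq₅ (H / 4) H′))))
          where
          eq₄ : ∀ H → 3 * H + H ≡ 4 * H
          eq₄ = solve-∀
          eq₅ : ∀ a H → 4 * (a + H) ≡ 4 * H + a * 4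
          eq₅ = solve-∀
        e≤H : e ≤ H
        e≤H = ≤-trans e≤H′ (m∸n≤m H (H / 4))
        H>0 : 0 < H
        H>0 = ≤-trans (≤-trans (s≤s z≤n) 4≤e) e≤H
        qn≤LH : q * n ≤ L * H
        qn≤LH = ≤-trans qn≤Le (*-monoʳ-≤ L e≤H)
        ω+t≤n : H / 4 + t ≤ n
        ω+t≤n = ≤-by H′ (+-monoʳ-≤ n (≤-trans D≤e e≤H′)) (trans (eq₆ (H / 4) t H′) (trans (cong (_+ t) H≡)
          (trans (sym m≡H+t) (trans m≡ (+-comm D n))))) refl
          where
          eq₆ : ∀ a t h → a + t + h ≡ a + h + t
          eq₆ = solve-∀
        H≤m : H ≤ m
        H≤m = ≤-trans (m≤m+n H t) (≤-reflexive (sym m≡H+t))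
        eq : ∀ H → 8 * (3 * H) * 17 ≡ 8 * 3 * 17 * H
        eq = solve-∀
        eq′ : ∀ H → 8 * (3 * H) ≡ 24 * H
        eq′ = solve-∀
        9Q<qG : 9 * (3 * H) < q * G
        9Q<qG = ≤-<-trans (≤-trans (≤-reflexive (eq₇ H)) (*-monoʳ-≤ 27 H≤m)) 27m<qG
          where
          eq₇ : ∀ H → 9 * (3 * H) ≡ 27 * H
          eq₇ = solve-∀
        open Phase Γ R (3 * H) s₀ R>0 (≤-trans H>0 (m≤n*m H 3)) 15≤s₀
          (≤-trans RG≤ (*-monoʳ-≤ s₀ (*-monoʳ-≤ 3 e≤H))) size 9Q<qG using (phase)

      -- Any group of at most average weight has room, so the game can be completed, and the amount
      -- paid never decreases.
      finish : ∀ k {t} → k + t ≡ n → (s : State t) → ∃ λ (s′ : State n) → paid s ≤ paid s′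
      finish zero    refl s = s , ≤-refl
      finish (suc k) {t} eq s =
        let g , g<G , light = below-average (weight s) q G (≤-<-trans (≤-trans
                (bounded m s (m≤m+n m t) (≤-trans qn≤Le (*-monoʳ-≤ L e≤m))) (*-monoˡ-≤ m (m≤m+n 3 24))) 27m<qG)
            s₁ , ρ , paid≤ , _ = insert (subst (t <_) eq (s≤s (m≤n+m t k))) s g g<G light
            s₂ , paid≤′ = finish k (trans (+-suc k t) eq) s₁
        in s₂ , ≤-trans (≤-trans (m≤m+n _ _) paid≤) paid≤′

      -- A phase uses up a quarter of `H`, so certainly no more than half, and one factor 2 per
      -- phase suffices.
      loop : ∀ J H {t} (s : State t) → m ≡ H + t → 4 * (2 ^ J * e) ≤ 3 * H →
             ∃ λ (s′ : State n) → suc J * (R * R * G) + κ * paid s ≤ κ * paid s′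
      loop zero H {t} s m≡H+t h =
        let s₁ , t₁≤n , h₁ = advance H s m≡H+t (subst (λ x → 4 * x ≤ 3 * H) (*-identityˡ e) h)
            s₂ , h₂ = finish (n ∸ (H / 4 + t)) (m∸n+n≡m t₁≤n) s₁
        in s₂ , ≤-trans (≤-reflexive (cong (_+ κ * paid s) (*-identityˡ (R * R * G)))) (≤-trans h₁ (*-monoʳ-≤ κ h₂))
      loop (suc J) H {t} s m≡H+t h =
        let s₁ , _ , h₁ = advance H s m≡H+t (≤-trans (*-monoʳ-≤ 4 (m≤n*m e (2 ^ suc J) {{m^n≢0 2 (suc J)}})) h)
            s₂ , h₂ = loop J (H ∸ H / 4) s₁ (trans m≡H+t (trans (cong (_+ t) (sym (m∸n+n≡m quarter≤))) (+-assoc (H ∸ H / 4) (H / 4) t))) half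
        in s₂ , (begin
          R * R * G + suc J * (R * R * G) + κ * paid s        ≡⟨ eq (R * R * G) (suc J * (R * R * G)) (κ * paid s) ⟩
          suc J * (R * R * G) + (R * R * G + κ * paid s)      ≤⟨ +-monoʳ-≤ (suc J * (R * R * G)) h₁ ⟩
          suc J * (R * R * G) + κ * paid s₁                   ≤⟨ h₂ ⟩
          κ * paid s₂                                         ∎)
        where
        open ≤-Reasoning
        quarter≤ : H / 4 ≤ H
        quarter≤ = ≤-trans (m≤m+n (H / 4) (H / 4)) (quarter H)
        eq : ∀ a b c → a + b + c ≡ b + (a + c)
        eq = solve-∀
        H≤2H′ : H ≤ 2 * (H ∸ H / 4)
        H≤2H′ = ≤-trans (≤-reflexive (sym (m∸n+n≡m quarter≤)))
          (+-monoʳ-≤ (H ∸ H / 4) (≤-trans (m+n≤o⇒m≤o∸n (H / 4) (quarter H)) (≤-reflexive (sym (+-identityʳ _)))))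
        half : 4 * (2 ^ J * e) ≤ 3 * (H ∸ H / 4)
        half = *-cancelˡ-≤ 2 (begin
          2 * (4 * (2 ^ J * e))     ≡⟨ eq₁ (2 ^ J) e ⟩
          4 * (2 * 2 ^ J * e)       ≤⟨ h ⟩
          3 * H                     ≤⟨ *-monoʳ-≤ 3 H≤2H′ ⟩
          3 * (2 * (H ∸ H / 4))     ≡⟨ eq₂ (H ∸ H / 4) ⟩
          2 * (3 * (H ∸ H / 4))     ∎)
          where
          eq₁ : ∀ a e → 2 * (4 * (a * e)) ≡ 4 * (2 * a * e)
          eq₁ = solve-∀
          eq₂ : ∀ h → 3 * (2 * h) ≡ 2 * (3 * h)
          eq₂ = solve-∀

-- Choice of the parameters

module Constants where

  open Strategy using (≤-by)
  open import Data.Nat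
  open import Data.Nat.DivMod using (m≡m%n+[m/n]*n; m%n<n; /-monoˡ-≤; m/n*n≤m; m*n/n≡m)
  open import Data.Nat.Properties
  open import Data.Nat.Tactic.RingSolver using (solve-∀)
  open import Data.Product using (∃; _×_; _,_; proj₁; proj₂)
  open import Data.Sum using ([_,_]′)
  open import Relation.Binary.PropositionalEquality hiding (J)
  open import Relation.Nullary using (yes; no; contradiction)

  n<b^n : ∀ b n → 2 ≤ b → n < b ^ n
  n<b^n b zero    2≤b = ≤-refl
  n<b^n b (suc n) 2≤b = begin
    suc (suc n)        ≤⟨ s≤s (m≤n+m (suc n) n) ⟩
    suc n + suc n      ≡⟨ cong (suc n +_) (+-identityʳ (suc n)) ⟨
    2 * suc n          ≤⟨ *-mono-≤ 2≤b (n<b^n b n 2≤b) ⟩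
    b * b ^ n          ∎
    where open ≤-Reasoning

  bracket : ∀ b a n → 2 ≤ b → 0 < a → a ≤ n → ∃ λ k → b ^ k * a ≤ n × n < b ^ suc k * a
  bracket b a n 2≤b a>0 a≤n = go n (<-≤-trans (n<b^n b n 2≤b) (m≤m*n (b ^ n) a {{>-nonZero a>0}}))
    where
    go : ∀ f → n < b ^ f * a → ∃ λ k → b ^ k * a ≤ n × n < b ^ suc k * a
    go zero    n<a = contradiction a≤n (<⇒≱ (subst (n <_) (*-identityˡ a) n<a))
    go (suc f) n<  with n <? b ^ f * a
    ... | yes n<′ = go f n<′
    ... | no  n≮  = f , ≮⇒≥ n≮ , n<

  ^-cancel-< : ∀ {i j} → 2 ^ i < 2 ^ j → i < j
  ^-cancel-< {i} {j} h with i <? j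
  ... | yes i<j = i<j
  ... | no  i≮j = contradiction (^-monoʳ-≤ 2 (≮⇒≥ i≮j)) (<⇒≱ h)

  abstract
    -- `R` becomes a hundredth of the binary logarithm of `n`, rounded down. Then `10 * R` levels
    -- shrink an interval by `2 ^ (40 * R)`, well below `B = 2 ^ (50 * R)`, which is at most the
    -- square root of `n`.
    base : ℕ
    base = 2 ^ 100

    base≡ : base ≡ 2 ^ 100
    base≡ = refl

  2≤base : 2 ≤ base
  2≤base = subst (2 ≤_) (sym base≡) (^-monoʳ-≤ 2 {1} {100} (s≤s z≤n))

  base^ : ∀ k → base ^ k ≡ 2 ^ (100 * k)
  base^ k = trans (cong (_^ k) base≡) (^-*-assoc 2 100 k)

  module Parameters (n D : ℕ) (n≥ : base ^ 20 ≤ n) (D>0 : 0 < D) (D<n : D < n) where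

    instance
      base≢0 : NonZero base
      base≢0 = >-nonZero (<⇒≤ 2≤base)

    n>0 : 0 < n
    n>0 = ≤-trans (m^n>0 base 20) n≥

    scale : ∃ λ R → base ^ R * 1 ≤ n × n < base ^ suc R * 1
    scale = bracket base 1 n 2≤base (s≤s z≤n) n>0

    R : ℕ
    R = proj₁ scale

    2^≤n : 2 ^ (100 * R) ≤ n
    2^≤n = subst (_≤ n) (trans (*-identityʳ _) (base^ R)) (proj₁ (proj₂ scale))

    n≤2^ : n ≤ 2 ^ (100 * suc R)
    n≤2^ = subst (n ≤_) (trans (*-identityʳ _) (base^ (suc R))) (<⇒≤ (proj₂ (proj₂ scale)))

    20≤R : 20 ≤ R
    20≤R = ≮⇒≥ λ R<20 → <⇒≱ (proj₂ (proj₂ scale))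
      (≤-trans (≤-reflexive (*-identityʳ _)) (≤-trans (^-monoʳ-≤ base R<20) n≥))

    R>0 : 0 < R
    R>0 = ≤-trans (s≤s z≤n) 20≤R

    384≤R² : 384 ≤ R * R
    384≤R² = ≤-trans (≤ᵇ⇒≤ 384 400 _) (*-mono-≤ 20≤R 20≤R)

    powers : ∀ c k → c ≤ k * R → k ≤ 100 → 2 ^ c ≤ n
    powers c k c≤ k≤ = ≤-trans (^-monoʳ-≤ 2 (≤-trans c≤ (*-monoˡ-≤ R k≤))) 2^≤n

    16≤n : 16 ≤ n
    16≤n = powers 4 4 (≤-trans (≤-reflexive (sym (*-identityʳ 4))) (*-monoʳ-≤ 4 R>0)) (m≤m+n 4 96)

    G : ℕ
    G = n / 4

    4G≤n : G * 4 ≤ n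
    4G≤n = m/n*n≤m n 4

    4≤G : 4 ≤ G
    4≤G = /-monoˡ-≤ 4 16≤n

    n≤5G : n ≤ 5 * G
    n≤5G = begin
      n                  ≡⟨ m≡m%n+[m/n]*n n 4 ⟩
      n % 4 + G * 4      ≤⟨ +-monoˡ-≤ (G * 4) (≤-trans (<⇒≤ (m%n<n n 4)) 4≤G) ⟩
      G + G * 4          ≡⟨ eq G ⟩
      5 * G              ∎
      where
      open ≤-Reasoning
      eq : ∀ G → G + G * 4 ≡ 5 * G
      eq = solve-∀

    2sucG≤n : 2 * suc G ≤ n
    2sucG≤n = ≤-trans (≤-trans (≤-trans (≤-reflexive (*-suc 2 G)) (+-monoˡ-≤ (2 * G) (≤-trans (m≤m+n 2 2) 4≤G)))
        (≤-trans (m≤m+n (G + 2 * G) G) (≤-reflexive (eq G)))) 4G≤n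
      where
      eq : ∀ G → G + 2 * G + G ≡ G * 4
      eq = solve-∀

    G<n : G < n
    G<n = ≤-trans (m≤m+n (suc G) _) 2sucG≤n

    W : ℕ
    W = n ∸ suc G

    W+ : W + suc G ≡ n
    W+ = m∸n+n≡m G<n

    n≤3W : n ≤ 3 * W
    n≤3W = begin
      n              ≡⟨ W+ ⟨
      W + suc G      ≤⟨ +-monoʳ-≤ W sucG≤W ⟩
      W + W          ≤⟨ +-monoʳ-≤ W (m≤m+n W _) ⟩
      3 * W          ∎
      where
      open ≤-Reasoning
      sucG≤W : suc G ≤ W
      sucG≤W = m+n≤o⇒m≤o∸n (suc G) (≤-trans (≤-reflexive (cong (suc G +_) (sym (+-identityʳ (suc G))))) 2sucG≤n)

    -- The phases end when the number of empty cells falls below e.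
    B e : ℕ
    B = 2 ^ (50 * R)
    e = D ⊔ B

    D≤e : D ≤ e
    D≤e = m≤m⊔n D B

    B≤e : B ≤ e
    B≤e = m≤n⊔m D B

    4B≤n : 4 * B ≤ n
    4B≤n = ≤-trans (≤-reflexive (sym (^-distribˡ-+-* 2 2 (50 * R))))
      (powers (2 + 50 * R) 52 (≤-trans (+-monoˡ-≤ (50 * R) (≤-trans (≤-reflexive (sym (*-identityʳ 2))) (*-monoʳ-≤ 2 R>0)))
        (≤-reflexive (sym (*-distribʳ-+ R 2 50)))) (m≤m+n 52 48))

    -- `H₀` is the number of cells still empty once the `suc G` heavy keys are stored.
    m H₀ : ℕ
    m = D + n
    H₀ = D + W

    m≡ : m ≡ H₀ + suc G
    m≡ = trans (cong (D +_) (sym W+)) (sym (+-assoc D W (suc G)))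

    m≤3H₀ : m ≤ 3 * H₀
    m≤3H₀ = ≤-trans (+-mono-≤ (m≤n*m D 3) n≤3W) (≤-reflexive (sym (*-distribˡ-+ 3 D W)))

    e-cases : ∀ {P : ℕ → Set} → P D → P B → P e
    e-cases {P} pD pB = [ (λ eq → subst P (sym eq) pD) , (λ eq → subst P (sym eq) pB) ]′ (⊔-sel D B)

    4e≤3H₀ : 4 * e ≤ 3 * H₀
    4e≤3H₀ = e-cases {λ e → 4 * e ≤ 3 * H₀}
      (begin
        4 * D                ≡⟨ +-comm D (3 * D) ⟩
        3 * D + D            ≤⟨ +-monoʳ-≤ (3 * D) (≤-trans (<⇒≤ D<n) n≤3W) ⟩
        3 * D + 3 * W        ≡⟨ *-distribˡ-+ 3 D W ⟨
        3 * H₀               ∎)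
      (≤-trans 4B≤n (≤-trans n≤3W (*-monoʳ-≤ 3 (m≤n+m W D))))
      where open ≤-Reasoning

    e≤m : e ≤ m
    e≤m = e-cases {_≤ m} (m≤m+n D n) (≤-trans (≤-trans (m≤n*m B 4) 4B≤n) (m≤n+m n D))

    4≤e : 4 ≤ e
    4≤e = ≤-trans (^-monoʳ-≤ 2 {2} {50 * R} (≤-trans (*-mono-≤ (m≤m+n 2 48) R>0) ≤-refl)) B≤e

    levels : ∃ λ J → 2 ^ J * (4 * e) ≤ 3 * H₀ × 3 * H₀ < 2 ^ suc J * (4 * e)
    levels = bracket 2 (4 * e) (3 * H₀) ≤-refl (≤-trans (≤-trans (s≤s z≤n) 4≤e) (m≤n*m e 4)) 4e≤3H₀

    J : ℕ
    J = proj₁ levels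

    J≤ : 4 * (2 ^ J * e) ≤ 3 * H₀
    J≤ = ≤-trans (≤-reflexive (eq (2 ^ J) e)) (proj₁ (proj₂ levels))
      where
      eq : ∀ a e → 4 * (a * e) ≡ a * (4 * e)
      eq = solve-∀

    m<2^e : m < 2 ^ (3 + J) * e
    m<2^e = ≤-<-trans m≤3H₀ (<-≤-trans (proj₂ (proj₂ levels)) (≤-reflexive (eq (2 ^ J) e)))
      where
      eq : ∀ a e → 2 * a * (4 * e) ≡ 2 * (2 * (2 * a)) * e
      eq = solve-∀

    -- So the number of phases is of order `ln (m / D)`. If the phases stop at `D`, half the
    -- exponent is enough. If they stop at `B`, then `B * B ≤ n` forces `B ≤ 2 ^ (3 + J)`, and
    -- `D ≥ 1`.
    ratio≤ : m ≤ 2 ^ (2 * (3 + J)) * D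
    ratio≤ = [ (λ e≡ → ≤-trans (<⇒≤ (subst (λ e → m < 2 ^ (3 + J) * e) e≡ m<2^e)) (*-monoˡ-≤ D (^-monoʳ-≤ 2 (m≤n*m (3 + J) 2))))
             , (λ e≡ → big (subst (λ e → m < 2 ^ (3 + J) * e) e≡ m<2^e)) ]′ (⊔-sel D B)
      where
      big : m < 2 ^ (3 + J) * B → m ≤ 2 ^ (2 * (3 + J)) * D
      big m< = begin
        m                          ≤⟨ <⇒≤ m<′ ⟩
        2 ^ (3 + J + 50 * R)       ≤⟨ ^-monoʳ-≤ 2 (+-monoʳ-≤ (3 + J) (≤-trans 50R≤ (≤-reflexive (sym (+-identityʳ (3 + J)))))) ⟩
        2 ^ (2 * (3 + J))          ≤⟨ m≤m*n _ D {{>-nonZero D>0}} ⟩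
        2 ^ (2 * (3 + J)) * D      ∎
        where
        open ≤-Reasoning
        m<′ : m < 2 ^ (3 + J + 50 * R)
        m<′ = <-≤-trans m< (≤-reflexive (sym (^-distribˡ-+-* 2 (3 + J) (50 * R))))
        50R≤ : 50 * R ≤ 3 + J
        50R≤ = +-cancelʳ-≤ (50 * R) (50 * R) (3 + J) (≤-trans (≤-reflexive (sym (*-distribʳ-+ R 50 50)))
          (<⇒≤ (^-cancel-< (≤-<-trans 2^≤n (≤-<-trans (m≤n+m n D) m<′)))))

    instance
      p≢0 : NonZero (16 ^ (10 * R))
      p≢0 = m^n≢0 16 (10 * R)
      D≢0 : NonZero D
      D≢0 = >-nonZero D>0

    s₀ : ℕ
    s₀ = G / 16 ^ (10 * R)

    16^≡ : 16 ^ (10 * R) ≡ 2 ^ (40 * R)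
    16^≡ = trans (^-*-assoc 2 4 (10 * R)) (cong (2 ^_) (sym (*-assoc 4 10 R)))

    size : s₀ * 16 ^ (10 * R) ≤ G
    size = m/n*n≤m G (16 ^ (10 * R))

    15≤s₀ : 15 ≤ s₀
    15≤s₀ = ≤-trans (m≤m+n 15 1) (≤-trans (≤-reflexive (sym (m*n/n≡m 16 (16 ^ (10 * R))))) (/-monoˡ-≤ (16 ^ (10 * R)) 16p≤G))
      where
      64p≤n : 16 * 16 ^ (10 * R) * 4 ≤ n
      64p≤n = ≤-trans (≤-reflexive (trans (cong (λ p → 16 * p * 4) 16^≡) (eq (2 ^ (40 * R)))))
        (≤-trans (≤-reflexive (sym (^-distribˡ-+-* 2 6 (40 * R))))
          (powers (6 + 40 * R) 46 (≤-trans (+-monoˡ-≤ (40 * R) (≤-trans (≤-reflexive (sym (*-identityʳ 6))) (*-monoʳ-≤ 6 R>0)))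
            (≤-reflexive (sym (*-distribʳ-+ R 6 40)))) (m≤m+n 46 54)))
        where
        eq : ∀ p → 16 * p * 4 ≡ 64 * p
        eq = solve-∀
      16p≤G : 16 * 16 ^ (10 * R) ≤ G
      16p≤G = ≤-trans (≤-reflexive (sym (m*n/n≡m (16 * 16 ^ (10 * R)) 4))) (/-monoˡ-≤ 4 64p≤n)

    -- As `s₀` is at least half of `G / 2 ^ (40 * R)`, it is enough that `2 * R * 2 ^ (40 * R)` is
    -- at most `B`. This is the condition `N ≤ s₀ * Q` on chains, since `Q = 3 * H` with `H ≥ e`.
    RG≤ : R * G ≤ s₀ * (3 * e)
    RG≤ = begin
      R * G                        ≤⟨ *-monoʳ-≤ R G≤ ⟩
      R * (2 * s₀ * p)             ≡⟨ eq R s₀ p ⟩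
      s₀ * (2 * R * p)             ≤⟨ *-monoʳ-≤ s₀ (≤-trans 2Rp≤B (≤-trans B≤e (m≤n*m e 3))) ⟩
      s₀ * (3 * e)                 ∎
      where
      open ≤-Reasoning
      p : ℕ
      p = 16 ^ (10 * R)
      eq : ∀ R s p → R * (2 * s * p) ≡ s * (2 * R * p)
      eq = solve-∀
      G≤ : G ≤ 2 * s₀ * p
      G≤ = begin
        G                     ≡⟨ m≡m%n+[m/n]*n G p ⟩
        G % p + s₀ * p        ≤⟨ +-monoˡ-≤ (s₀ * p) (≤-trans (<⇒≤ (m%n<n G p)) (m≤n*m p s₀ {{>-nonZero (≤-trans (s≤s z≤n) 15≤s₀)}})) ⟩
        s₀ * p + s₀ * p       ≡⟨ eq″ s₀ p ⟩
        2 * s₀ * p            ∎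
        where
        eq″ : ∀ s p → s * p + s * p ≡ 2 * s * p
        eq″ = solve-∀
      2Rp≤B : 2 * R * p ≤ B
      2Rp≤B = begin
        2 * R * p                    ≤⟨ *-monoˡ-≤ p (*-monoʳ-≤ 2 (<⇒≤ (n<b^n 2 R ≤-refl))) ⟩
        2 ^ (1 + R) * p              ≡⟨ cong (2 ^ (1 + R) *_) 16^≡ ⟩
        2 ^ (1 + R) * 2 ^ (40 * R)   ≡⟨ ^-distribˡ-+-* 2 (1 + R) (40 * R) ⟨
        2 ^ (1 + R + 40 * R)         ≤⟨ ^-monoʳ-≤ 2 exponent ⟩
        B                            ∎
        where
        exponent : 1 + R + 40 * R ≤ 50 * R
        exponent = ≤-trans (+-monoˡ-≤ (40 * R) (+-monoˡ-≤ R R>0))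
          (≤-trans (≤-trans (m≤m+n _ (8 * R)) (≤-reflexive (eq‴ R))) ≤-refl)
          where
          eq‴ : ∀ R → R + R + 40 * R + 8 * R ≡ 50 * R
          eq‴ = solve-∀

    -- The value of `q` comes from `27 * m < 54 * n ≤ 270 * G`: it exceeds 9 times the average
    -- weight `3 * m / G`. With `L * D ≥ q * n` the penalties add up to at most `D`, hence never to
    -- more than the number of empty cells.
    q L : ℕ
    q = 270
    L = suc (q * n / D)

    qn<LD : q * n ≤ L * D
    qn<LD = begin
      q * n                                ≡⟨ m≡m%n+[m/n]*n (q * n) D ⟩
      q * n % D + q * n / D * D            ≤⟨ +-monoˡ-≤ (q * n / D * D) (<⇒≤ (m%n<n (q * n) D)) ⟩
      L * D                                ∎
      where open ≤-Reasoning

    qn≤Le : q * n ≤ L * e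
    qn≤Le = ≤-trans qn<LD (*-monoʳ-≤ L D≤e)

    27m<qG : 27 * m < q * G
    27m<qG = <-≤-trans (*-monoʳ-< 27 (+-monoˡ-< n D<n)) (≤-trans (≤-reflexive (eq n)) (≤-trans (*-monoʳ-≤ 54 n≤5G) (≤-reflexive (sym (*-assoc 54 5 G)))))
      where
      eq : ∀ n → 27 * (n + n) ≡ 54 * n
      eq = solve-∀

    -- There are `suc G ≤ n` blocks of `suc (L + q)` keys, with `L` of order `n / D`. Altogether
    -- this is at most `542 * n * n / D`, and 542 is below `2 ^ 10`.
    room : ∀ r → 2 ^ 10 * n * m ≤ r * D → suc G * suc (L + q) ≤ r
    room r h = *-cancelʳ-≤ _ _ D (≤-trans (begin
      suc G * suc (L + q) * D             ≤⟨ *-monoˡ-≤ D (*-monoˡ-≤ (suc (L + q)) G<n) ⟩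
      n * suc (L + q) * D                 ≡⟨ eq n (q * n / D) q D ⟩
      n * (q * n / D * D + (2 + q) * D)   ≤⟨ *-monoʳ-≤ n (+-mono-≤ (m/n*n≤m (q * n) D) (*-monoʳ-≤ (2 + q) (<⇒≤ D<n))) ⟩
      n * (q * n + (2 + q) * n)           ≡⟨ cong (n *_) (sym (*-distribʳ-+ n q (2 + q))) ⟩
      n * ((q + (2 + q)) * n)             ≤⟨ *-monoʳ-≤ n (*-mono-≤ (≤ᵇ⇒≤ (q + (2 + q)) (2 ^ 10) _) (m≤n+m n D)) ⟩
      n * (2 ^ 10 * m)                    ≡⟨ trans (sym (*-assoc n (2 ^ 10) m)) (cong (_* m) (*-comm n (2 ^ 10))) ⟩
      2 ^ 10 * n * m                      ∎) h)
      where
      open ≤-Reasoning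
      eq : ∀ n a q D → n * suc (suc a + q) * D ≡ n * (a * D + (2 + q) * D)
      eq = solve-∀

-- The adversary in the actual array

module Play where

  open import Defs using (module OnlineLabeling)
  open Strategy using (Σ<; ≤-by; Drop; Game)
  open import Data.Fin as Fin using (Fin; zero; suc; toℕ; fromℕ<)
  import Data.Fin.Properties as Fin
  open import Data.Irrelevant using ([_])
  open import Data.List using (List; _∷_; length; _++_)
  import Data.List.Properties as List
  open import Data.List.Membership.Propositional using (_∈_)
  open import Data.List.Membership.Propositional.Properties
    using (∈-filter⁺; ∈-allFin; ∈-∃++; ∈-++⁻; ∈-++⁺ˡ; ∈-++⁺ʳ)
  open import Data.List.Relation.Unary.Any using (here; there)
  open import Data.Nat
  open import Data.Nat.Properties
  open import Data.Nat.Tactic.RingSolver using (solve-∀)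
  open import Data.Product using (∃; ∃₂; _×_; _,_; proj₁)
  open import Data.Refinement using (value; _,_)
  open import Data.Sum using (inj₁; inj₂)
  open import Data.Vec using ([]; _∷_; lookup)
  open import Data.Vec.Relation.Unary.All as All using (All; []; _∷_)
  import Data.Vec.Relation.Unary.AllPairs as AllPairs
  open import Relation.Binary.Definitions using (tri<; tri≈; tri>)
  open import Relation.Binary.PropositionalEquality
  open import Relation.Nullary using (Dec; yes; no; ¬_; contradiction)
  open import Relation.Nullary.Decidable using (recompute)
  open OnlineLabeling
  open Finiteness using (extend)

  Σ<-cong : ∀ {f g} x → (∀ j → j < x → f j ≡ g j) → Σ< f x ≡ Σ< g x
  Σ<-cong zero    _ = refl
  Σ<-cong (suc x) h = cong₂ _+_ (Σ<-cong x (λ j j<x → h j (m≤n⇒m≤1+n j<x))) (h x ≤-refl)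

  -- Induction on `x`: the image of the last index is removed from `zs`, and by injectivity the
  -- images of the others remain.
  Σ<-≤length : ∀ {B : Set} (ρ : ℕ → ℕ) (v : ℕ → B) x (zs : List B) → (∀ j → ρ j ≤ 1) →
    (∀ i j → i < x → j < x → v i ≡ v j → i ≡ j) → (∀ j → j < x → ρ j ≢ 0 → v j ∈ zs) → Σ< ρ x ≤ length zs
  Σ<-≤length ρ v zero    zs _  _   _  = z≤n
  Σ<-≤length ρ v (suc x) zs ≤1 inj v∈ with ρ x ≟ 0
  ... | yes ρ≡0 = ≤-trans (≤-reflexive (trans (cong (Σ< ρ x +_) ρ≡0) (+-identityʳ _)))
    (Σ<-≤length ρ v x zs ≤1 (λ i j i< j< → inj i j (m≤n⇒m≤1+n i<) (m≤n⇒m≤1+n j<)) (λ j j< → v∈ j (m≤n⇒m≤1+n j<)))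
  ... | no ρ≢0 with ∈-∃++ (v∈ x ≤-refl ρ≢0)
  ... | as , bs , refl = begin
    Σ< ρ x + ρ x                    ≤⟨ +-mono-≤ (Σ<-≤length ρ v x (as ++ bs) ≤1
                                         (λ i j i< j< → inj i j (m≤n⇒m≤1+n i<) (m≤n⇒m≤1+n j<)) others) (≤1 x) ⟩
    length (as ++ bs) + 1           ≡⟨ cong (_+ 1) (List.length-++ as) ⟩
    length as + length bs + 1       ≡⟨ +-assoc (length as) (length bs) 1 ⟩
    length as + (length bs + 1)     ≡⟨ cong (length as +_) (+-comm (length bs) 1) ⟩
    length as + suc (length bs)     ≡⟨ List.length-++ as ⟨
    length (as ++ v x ∷ bs)         ∎
    where
    open ≤-Reasoning
    others : ∀ j → j < x → ρ j ≢ 0 → v j ∈ as ++ bs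
    others j j<x ρj with ∈-++⁻ as (v∈ j (m≤n⇒m≤1+n j<x) ρj)
    ... | inj₁ ∈as         = ∈-++⁺ˡ ∈as
    ... | inj₂ (here eq)   = contradiction (inj j x (m≤n⇒m≤1+n j<x) ≤-refl eq) (<⇒≢ j<x)
    ... | inj₂ (there ∈bs) = ∈-++⁺ʳ as ∈bs

  bump : ℕ → (ℕ → ℕ) → ℕ → ℕ
  bump g u j with j ≟ g
  ... | yes _ = suc (u j)
  ... | no  _ = u j

  bump-at : ∀ g u → bump g u g ≡ suc (u g)
  bump-at g u with g ≟ g
  ... | yes _  = refl
  ... | no g≢g = contradiction refl g≢g

  bump-off : ∀ g u {j} → j ≢ g → bump g u j ≡ u j
  bump-off g u {j} j≢g with j ≟ g
  ... | yes j≡g = contradiction j≡g j≢g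
  ... | no  _   = refl

  bump-≥ : ∀ g u j → u j ≤ bump g u j
  bump-≥ g u j with j ≟ g
  ... | yes _ = n≤1+n (u j)
  ... | no  _ = ≤-refl

  Σ<-before : ∀ (F : ℕ → ℕ) g u {x} → x ≤ g → Σ< (λ j → F (bump g u j)) x ≡ Σ< (λ j → F (u j)) x
  Σ<-before F g u {x} x≤g = Σ<-cong x λ j j<x → cong F (bump-off g u (<⇒≢ (<-≤-trans j<x x≤g)))

  Σ<-after : ∀ (F : ℕ → ℕ) c g u → F (suc (u g)) ≤ c + F (u g) → ∀ {x} → g < x →
             Σ< (λ j → F (bump g u j)) x ≤ c + Σ< (λ j → F (u j)) x
  Σ<-after F c g u F≤ {suc x} (s≤s g≤x) = go (x ≟ g)
    where
    open ≤-Reasoning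
    eq : ∀ a b c → a + (b + c) ≡ b + (a + c)
    eq = solve-∀
    go : Dec (x ≡ g) → Σ< (λ j → F (bump g u j)) x + F (bump g u x) ≤ c + (Σ< (λ j → F (u j)) x + F (u x))
    go (yes refl) = begin
      Σ< (λ j → F (bump g u j)) g + F (bump g u g)  ≡⟨ cong₂ _+_ (Σ<-before F g u ≤-refl) (cong F (bump-at g u)) ⟩
      Σ< (λ j → F (u j)) g + F (suc (u g))          ≤⟨ +-monoʳ-≤ _ F≤ ⟩
      Σ< (λ j → F (u j)) g + (c + F (u g))          ≡⟨ eq (Σ< (λ j → F (u j)) g) c (F (u g)) ⟩
      c + (Σ< (λ j → F (u j)) g + F (u g))          ∎
    go (no x≢g) = ≤-trans (+-mono-≤ (Σ<-after F c g u F≤ {x} (≤∧≢⇒< g≤x (λ eq → x≢g (sym eq))))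
                            (≤-reflexive (cong F (bump-off g u x≢g))))
                    (≤-reflexive (+-assoc c _ _))

  Σ<-bump : ∀ g u {x} → g < x → Σ< (bump g u) x ≡ suc (Σ< u x)
  Σ<-bump g u {suc x} (s≤s g≤x) = go (x ≟ g)
    where
    go : Dec (x ≡ g) → Σ< (bump g u) x + bump g u x ≡ suc (Σ< u x + u x)
    go (yes refl) = trans (cong₂ _+_ (Σ<-before (λ y → y) g u ≤-refl) (bump-at g u)) (+-suc (Σ< u g) (u g))
    go (no x≢g)   = cong₂ _+_ (Σ<-bump g u {x} (≤∧≢⇒< g≤x (λ eq → x≢g (sym eq)))) (bump-off g u x≢g)

  -- The order proof inside a storage function is irrelevant; decidability of the order recovers a
  -- usable one.
  ordered : ∀ {r m t} {ys : KeySeq r t} (f : Storage m ys) → OrderPreserving (value ys) (value f)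
  ordered (cs , [ o ]) i j lt = recompute (lookup cs i Fin.<? lookup cs j) (o i j lt)

  module Adversary {n m r : ℕ} (A : Algorithm n m r) (G L q : ℕ) (L>0 : 0 < L) (G<n : G < n)
    (room : suc G * suc (L + q) ≤ r) where

    K : ℕ
    K = L + q

    -- Keys come in blocks of `suc K`: the heavy key `key j 0`, then the `K` light keys of group
    -- `j`, which are inserted in increasing order.
    key : ℕ → ℕ → ℕ
    key j i = j * suc K + i

    key<r : ∀ {j i} → j ≤ G → i ≤ K → key j i < r
    key<r {j} {i} j≤G i≤K = begin-strict
      j * suc K + i          <⟨ +-monoʳ-< (j * suc K) (s≤s i≤K) ⟩
      j * suc K + suc K      ≡⟨ +-comm (j * suc K) (suc K) ⟩
      suc j * suc K          ≤⟨ *-monoˡ-≤ (suc K) (s≤s j≤G) ⟩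
      suc G * suc K          ≤⟨ room ⟩
      r                      ∎
      where open ≤-Reasoning

    key-mono : ∀ {j i j′ i′} → i ≤ K → j < j′ → key j i < key j′ i′
    key-mono {j} {i} {j′} {i′} i≤K j<j′ = begin-strict
      j * suc K + i          <⟨ +-monoʳ-< (j * suc K) (s≤s i≤K) ⟩
      j * suc K + suc K      ≡⟨ +-comm (j * suc K) (suc K) ⟩
      suc j * suc K          ≤⟨ *-monoˡ-≤ (suc K) j<j′ ⟩
      j′ * suc K             ≤⟨ m≤m+n _ i′ ⟩
      j′ * suc K + i′        ∎
      where open ≤-Reasoning

    key-injective : ∀ {j i j′ i′} → i ≤ K → i′ ≤ K → key j i ≡ key j′ i′ → j ≡ j′ × i ≡ i′
    key-injective {j} {i} {j′} {i′} i≤K i′≤K eq with <-cmp j j′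
    ... | tri< j<j′ _ _ = contradiction eq (<⇒≢ (key-mono i≤K j<j′))
    ... | tri> _ _ j′<j = contradiction (sym eq) (<⇒≢ (key-mono i′≤K j′<j))
    ... | tri≈ _ refl _ = refl , +-cancelˡ-≡ (j * suc K) i i′ eq

    Listed : (ℕ → ℕ → Set) → Fin r → Set
    Listed In y = ∃₂ λ j i → In j i × i ≤ K × toℕ y ≡ key j i

    -- The keys present are key j i for j ≤ G and i ≤ u j.
    record State (t : ℕ) : Set where
      field
        t≤n    : t ≤ n
        ys     : KeySeq r t
        u      : ℕ → ℕ
        u≤K    : ∀ j → u j ≤ K
        count  : t ≡ suc G + Σ< u G
        idx    : ℕ → ℕ → Fin t
        at     : ∀ {j i} → j ≤ G → i ≤ u j → toℕ (lookup (value ys) (idx j i)) ≡ key j i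
        listed : All (Listed λ j i → i ≤ u j) (value ys)

      storage : Storage m ys
      storage = A t t≤n ys

      pos : ℕ → ℕ → ℕ
      pos j i = toℕ (lookup (value storage) (idx j i))

      pos-mono : ∀ {j i j′ i′} → j ≤ G → i ≤ u j → j′ ≤ G → i′ ≤ u j′ → key j i < key j′ i′ → pos j i < pos j′ i′
      pos-mono {j} {i} {j′} {i′} j≤G i≤u j′≤G i′≤u lt =
        ordered {ys = ys} storage (idx j i) (idx j′ i′) (subst₂ _<_ (sym (at j≤G i≤u)) (sym (at j′≤G i′≤u)) lt)

      p : ℕ → ℕ
      p j = pos j 0

      group : ∀ {j} → j ≤ G → ∀ i → i ≤ u j → p j + i ≤ pos j i
      group j≤G zero    _   = ≤-reflexive (+-identityʳ _)
      group {j} j≤G (suc i) i<u = begin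
        p j + suc i      ≡⟨ +-suc (p j) i ⟩
        suc (p j + i)    ≤⟨ s≤s (group j≤G i (<⇒≤ i<u)) ⟩
        suc (pos j i)    ≤⟨ pos-mono j≤G (<⇒≤ i<u) j≤G i<u (+-monoʳ-< (j * suc K) ≤-refl) ⟩
        pos j (suc i)    ∎
        where open ≤-Reasoning

      gap : ∀ {j} → j < G → p j + suc (u j) ≤ p (suc j)
      gap {j} j<G = begin
        p j + suc (u j)    ≡⟨ +-suc (p j) (u j) ⟩
        suc (p j + u j)    ≤⟨ s≤s (group (<⇒≤ j<G) (u j) ≤-refl) ⟩
        suc (pos j (u j))  ≤⟨ pos-mono (<⇒≤ j<G) ≤-refl j<G z≤n (key-mono {j} {u j} {suc j} {0} (u≤K j) ≤-refl) ⟩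
        p (suc j)          ∎
        where open ≤-Reasoning

      -- Twice the number of empty cells in group j, plus a penalty for groups that are about to run out of keys.
      weight : ℕ → ℕ
      weight j = 2 * (p (suc j) ∸ (p j + suc (u j))) + (u j ∸ L)

      U Pen : ℕ → ℕ
      U   = Σ< u
      Pen = Σ< (λ j → u j ∸ L)

      -- From heavy key 0 up to, but excluding, heavy key `x` there are `p x - p 0` cells. They hold
      -- `x` heavy and `U x` light keys, and the rest are empty.
      telescope : ∀ {x} → x ≤ G → Σ< weight x + 2 * (p 0 + (x + U x)) ≡ 2 * p x + Pen x
      telescope {zero}  _   = eq (p 0)
        where
        eq : ∀ p → 2 * (p + 0) ≡ 2 * p + 0
        eq = solve-∀
      telescope {suc x} x<G = begin
        Σ< weight x + (2 * h + v) + 2 * (p 0 + (suc x + (U x + u x)))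
          ≡⟨ eq₁ (Σ< weight x) h v (p 0) x (U x) (u x) ⟩
        Σ< weight x + 2 * (p 0 + (x + U x)) + (2 * (h + suc (u x)) + v)
          ≡⟨ cong (_+ (2 * (h + suc (u x)) + v)) (telescope (<⇒≤ x<G)) ⟩
        2 * p x + Pen x + (2 * (h + suc (u x)) + v)
          ≡⟨ eq₂ (p x) (Pen x) h (u x) v ⟩
        2 * (h + (p x + suc (u x))) + (Pen x + v)
          ≡⟨ cong (λ y → 2 * y + (Pen x + v)) (m∸n+n≡m (gap x<G)) ⟩
        2 * p (suc x) + (Pen x + v) ∎
        where
        open ≡-Reasoning
        h v : ℕ
        h = p (suc x) ∸ (p x + suc (u x))
        v = u x ∸ L
        eq₁ : ∀ w h v p x U u → w + (2 * h + v) + 2 * (p + (suc x + (U + u))) ≡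
              w + 2 * (p + (x + U)) + (2 * (h + suc u) + v)
        eq₁ = solve-∀
        eq₂ : ∀ p P h u v → 2 * p + P + (2 * (h + suc u) + v) ≡ 2 * (h + (p + suc u)) + (P + v)
        eq₂ = solve-∀

      total-bound : Σ< weight G + 2 * t ≤ 2 * m + Pen G
      total-bound = ≤-trans (m≤m+n _ (2 * p 0)) (≤-by (2 * p G)
        (+-mono-≤ (≤-reflexive (telescope ≤-refl)) (*-monoʳ-≤ 2 (Fin.toℕ<n (lookup (value storage) (idx G 0)))))
        (trans (cong (λ t → Σ< weight G + 2 * t + 2 * p 0 + 2 * p G) count) (eq (Σ< weight G) G (U G) (p 0) (p G)))
        (eq′ (p G) (Pen G) m))
        where
        eq : ∀ w G U p₀ p → w + 2 * (suc G + U) + 2 * p₀ + 2 * p ≡ w + 2 * (p₀ + (G + U)) + 2 * suc p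
        eq = solve-∀
        eq′ : ∀ p P m → 2 * p + P + 2 * m ≡ 2 * m + P + 2 * p
        eq′ = solve-∀

      -- A group pays a penalty only if it has more than `L` light keys, and then at most `q`: at
      -- most `q / L` per key.
      penalty-bound : L * Pen G ≤ q * n
      penalty-bound = ≤-trans (go G) (*-monoʳ-≤ q (≤-trans (m≤n+m (U G) (suc G)) (≤-trans (≤-reflexive (sym count)) t≤n)))
        where
        each : ∀ v → v ≤ K → L * (v ∸ L) ≤ q * v
        each v v≤K with ≤-total v L
        ... | inj₁ v≤L = ≤-trans (≤-reflexive (trans (cong (L *_) (m≤n⇒m∸n≡0 v≤L)) (*-zeroʳ L))) z≤n
        ... | inj₂ L≤v = begin
          L * (v ∸ L)   ≤⟨ *-mono-≤ L≤v (m≤n+o⇒m∸n≤o v L v≤K) ⟩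
          v * q         ≡⟨ *-comm v q ⟩
          q * v         ∎
          where open ≤-Reasoning
        go : ∀ x → L * Pen x ≤ q * U x
        go zero    = ≤-trans (≤-reflexive (*-zeroʳ L)) z≤n
        go (suc x) = begin
          L * (Pen x + (u x ∸ L))        ≡⟨ *-distribˡ-+ L (Pen x) _ ⟩
          L * Pen x + L * (u x ∸ L)      ≤⟨ +-mono-≤ (go x) (each (u x) (u≤K x)) ⟩
          q * U x + q * u x              ≡⟨ *-distribˡ-+ q (U x) (u x) ⟨
          q * (U x + u x)                ∎
          where open ≤-Reasoning

      -- The origin of `Q = 3 * H`: empty cells contribute `2 * H` and penalties at most `H`.
      bounded : ∀ H → m ≤ H + t → q * n ≤ L * H → Σ< weight G ≤ 3 * H
      bounded H m≤ qn≤ = ≤-by (2 * t) (≤-trans total-bound (+-mono-≤ (*-monoʳ-≤ 2 m≤) Pen≤)) refl (eq H t)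
        where
        Pen≤ : Pen G ≤ H
        Pen≤ = *-cancelˡ-≤ L {{>-nonZero L>0}} (≤-trans penalty-bound qn≤)
        eq : ∀ H t → 2 * (H + t) + H ≡ 3 * H + 2 * t
        eq = solve-∀

    open State

    paid : ∀ {t} → State t → ℕ
    paid s = cost A (t≤n s) (ys s)

    start : ∀ k → k ≤ G → ∃ λ (ys : KeySeq r (suc k)) → ∃ λ (v : ℕ → Fin (suc k)) →
            (∀ {j} → j ≤ k → toℕ (lookup (value ys) (v j)) ≡ key j 0) × All (Listed λ j i → j ≤ k × i ≡ 0) (value ys)
    start zero k≤G =
      extend ([] , [ AllPairs.[] ]) (fromℕ< (key<r {0} {0} z≤n z≤n) , [ [] ]) , (λ _ → zero) ,
      (λ { z≤n → Fin.toℕ-fromℕ< _ }) , (0 , 0 , (z≤n , refl) , z≤n , Fin.toℕ-fromℕ< _) ∷ []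
    start (suc k) k<G =
      let ys , v , at , listed = start k (<⇒≤ k<G)
          y = fromℕ< (key<r k<G z≤n)
          y≡ : toℕ y ≡ key (suc k) 0
          y≡ = Fin.toℕ-fromℕ< _
          fresh : All (y ≢_) (value ys)
          fresh = All.map (λ { (j , i , (j≤k , _) , i≤K , eq) y≡y′ →
            contradiction (proj₁ (key-injective z≤n i≤K (trans (sym y≡) (trans (cong toℕ y≡y′) eq)))) (λ eq′ → 1+n≰n (subst (_≤ k) (sym eq′) j≤k)) }) listed
          v′ = λ j → place v j (j ≟ suc k)
      in extend ys (y , [ fresh ]) , v′
       , (λ {j} j≤ → at′ ys v y at y≡ j j≤ (j ≟ suc k))
       , (suc k , 0 , (≤-refl , refl) , z≤n , y≡)
         ∷ All.map (λ { (j , i , (j≤k , i≡0) , rest) → j , i , (m≤n⇒m≤1+n j≤k , i≡0) , rest }) listed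
      where
      place : (ℕ → Fin (suc k)) → (j : ℕ) → Dec (j ≡ suc k) → Fin (suc (suc k))
      place v j (yes _) = zero
      place v j (no _)  = suc (v j)
      at′ : (ys : KeySeq r (suc k)) (v : ℕ → Fin (suc k)) (y : Fin r) →
            (∀ {j} → j ≤ k → toℕ (lookup (value ys) (v j)) ≡ key j 0) → toℕ y ≡ key (suc k) 0 →
            ∀ j → j ≤ suc k → (d : Dec (j ≡ suc k)) → toℕ (lookup (y ∷ value ys) (place v j d)) ≡ key j 0
      at′ ys v y at y≡ j j≤ (yes refl) = y≡
      at′ ys v y at y≡ j j≤ (no j≢)    = at (s≤s⁻¹ (≤∧≢⇒< j≤ j≢))

    initial : State (suc G)
    initial = let ys , v , at , listed = start G ≤-refl in record
      { t≤n = G<n ; ys = ys ; u = λ _ → 0 ; u≤K = λ _ → z≤n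
      ; count = sym (trans (cong (suc G +_) (zeros G)) (+-identityʳ (suc G)))
      ; idx = λ j _ → v j
      ; at = λ { {j} {zero} j≤G _ → at j≤G }
      ; listed = All.map (λ { (j , i , (_ , i≡0) , rest) → j , i , ≤-reflexive i≡0 , rest }) listed }
      where
      zeros : ∀ x → Σ< (λ _ → 0) x ≡ 0
      zeros zero    = refl
      zeros (suc x) = trans (+-identityʳ _) (zeros x)

    module Insert {t} (t<n : t < n) (s : State t) (g : ℕ) (g<G : g < G) (light : weight s g < q) where

      ug<K : u s g < K
      ug<K = ≤-<-trans (m≤n+m∸n (u s g) L) (+-monoʳ-< L (≤-<-trans (m≤n+m _ _) light))

      y : Fin r
      y = fromℕ< (key<r (<⇒≤ g<G) ug<K)

      y≡ : toℕ y ≡ key g (suc (u s g))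
      y≡ = Fin.toℕ-fromℕ< _

      fresh : All (y ≢_) (value (ys s))
      fresh = All.map (λ { (j , i , i≤u , i≤K , eq) y≡y′ → absurd i≤u
        (key-injective ug<K i≤K (trans (sym y≡) (trans (cong toℕ y≡y′) eq))) }) (listed s)
        where
        absurd : ∀ {j i} → i ≤ u s j → ¬ (g ≡ j × suc (u s g) ≡ i)
        absurd i≤u (refl , refl) = 1+n≰n i≤u

      u′ : ℕ → ℕ
      u′ = bump g (u s)

      ys′ : KeySeq r (suc t)
      ys′ = extend (ys s) (y , [ fresh ])

      place : ∀ j i → Dec (j ≡ g) → Dec (i ≡ suc (u s g)) → Fin (suc t)
      place j i (yes _) (yes _) = zero
      place j i _       _       = suc (idx s j i)

      -- Index 0 is split off so that the position of a heavy key is the `suc` of its old one by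
      -- definition, which is the form in which `Relocated` compares cells.
      idx′ : ℕ → ℕ → Fin (suc t)
      idx′ j zero    = suc (idx s j zero)
      idx′ j (suc i) = place j (suc i) (j ≟ g) (suc i ≟ suc (u s g))

      at-place : ∀ {j i} → j ≤ G → i ≤ u′ j → ∀ d e → toℕ (lookup (value ys′) (place j i d e)) ≡ key j i
      at-place j≤G i≤ (yes refl) (yes refl) = y≡
      at-place {i = i} j≤G i≤ (yes refl) (no i≢) = at s j≤G (s≤s⁻¹ (≤∧≢⇒< (subst (i ≤_) (bump-at g (u s)) i≤) i≢))
      at-place {i = i} j≤G i≤ (no j≢) _ = at s j≤G (subst (i ≤_) (bump-off g (u s) j≢) i≤)

      at′ : ∀ {j i} → j ≤ G → i ≤ u′ j → toℕ (lookup (value ys′) (idx′ j i)) ≡ key j i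
      at′ {j} {zero}  j≤G _  = at s j≤G z≤n
      at′ {j} {suc i} j≤G i≤ = at-place j≤G i≤ (j ≟ g) (suc i ≟ suc (u s g))

      s′ : State (suc t)
      s′ = record
        { t≤n = t<n ; ys = ys′ ; u = u′ ; u≤K = bump≤K
        ; count = trans (cong suc (count s)) (trans (sym (+-suc (suc G) _)) (cong (suc G +_) (sym (Σ<-bump g (u s) g<G))))
        ; idx = idx′ ; at = at′
        ; listed = (g , suc (u s g) , ≤-reflexive (sym (bump-at g (u s))) , ug<K , y≡)
                   ∷ All.map (λ { (j , i , i≤u , rest) → j , i , ≤-trans i≤u (bump-≥ g (u s) j) , rest }) (listed s) }
        where
        bump≤K : ∀ j → u′ j ≤ K
        bump≤K j with j ≟ g
        ... | yes refl = ug<K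
        ... | no  _    = u≤K s j

      moves : ∀ j → Dec (lookup (value (storage s′)) (suc (idx s j 0)) ≡ lookup (value (storage s)) (idx s j 0)) → ℕ
      moves j (yes _) = 0
      moves j (no _)  = 1

      ρ : ℕ → ℕ
      ρ j = moves j (_ Fin.≟ _)

      ρ≤1 : ∀ j → ρ j ≤ 1
      ρ≤1 j = go (_ Fin.≟ _)
        where
        go : ∀ d → moves j d ≤ 1
        go (yes _) = z≤n
        go (no _)  = ≤-refl

      ρ≡0⇒ : ∀ j → ρ j ≡ 0 → p s′ j ≡ p s j
      ρ≡0⇒ j = go (_ Fin.≟ _)
        where
        go : ∀ d → moves j d ≡ 0 → p s′ j ≡ p s j
        go (yes eq) _ = cong toℕ eq

      relocated : ∀ j → ρ j ≢ 0 → suc (idx s j 0) ∈ Rel {ys = ys′} (storage s) (storage s′)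
      relocated j = go (_ Fin.≟ _)
        where
        go : ∀ d → moves j d ≢ 0 → suc (idx s j 0) ∈ Rel {ys = ys′} (storage s) (storage s′)
        go (yes _) 0≢0 = contradiction refl 0≢0
        go (no neq) _  = ∈-filter⁺ (relocated? {ys = ys′} (storage s) (storage s′)) (∈-allFin _) (moved neq)

      paid≤ : paid s + Σ< ρ G ≤ paid s′
      paid≤ = +-monoʳ-≤ (paid s) (Σ<-≤length ρ (λ j → suc (idx s j 0)) G _ ρ≤1 inj (λ j _ → relocated j))
        where
        inj : ∀ i j → i < G → j < G → suc (idx s i 0) ≡ suc (idx s j 0) → i ≡ j
        inj i j i<G j<G eq = proj₁ (key-injective z≤n z≤n (trans (sym (at s (<⇒≤ i<G) z≤n))
          (trans (cong (λ k → toℕ (lookup (value (ys s)) k)) (Fin.suc-injective eq)) (at s (<⇒≤ j<G) z≤n))))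

      -- If the heavy keys at both ends stay, the new key fills an empty cell between them: this
      -- lowers the weight by 2, while the penalty grows by at most 1. For this reason empty cells
      -- count twice. Heavy key 0 may move, but its position cancels.
      drop : Drop G (Σ< (weight s)) (Σ< (weight s′)) ρ g
      drop l x l≤g g<x x≤G ρl ρx = balance (P′ x) (P l) (P x) (P′ l) (p s 0) (p s′ 0) x l (U s x) (U s l)
        (p s x) (p s l) (Pen s x) (Pen s′ x) (Pen s l)
        (trans (cong (λ U → P′ x + 2 * (p s′ 0 + (x + U))) (sym (Σ<-bump g (u s) g<x)))
          (trans (telescope s′ x≤G) (cong (λ y → 2 * y + Pen s′ x) (ρ≡0⇒ x ρx))))
        (telescope s l≤G) (telescope s x≤G)
        (trans (cong (λ U → P′ l + 2 * (p s′ 0 + (l + U))) (sym (Σ<-before (λ y → y) g (u s) l≤g)))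
          (trans (telescope s′ l≤G) (cong₂ (λ y z → 2 * y + z) (ρ≡0⇒ l ρl) (Σ<-before (_∸ L) g (u s) l≤g))))
        (Σ<-after (_∸ L) 1 g (u s) (∸-suc≤ (u s g)) g<x)
        where
        P P′ : ℕ → ℕ
        P  = Σ< (weight s)
        P′ = Σ< (weight s′)
        l≤G : l ≤ G
        l≤G = ≤-trans l≤g (≤-trans (<⇒≤ g<x) x≤G)
        ∸-suc≤ : ∀ a → suc a ∸ L ≤ suc (a ∸ L)
        ∸-suc≤ a = m≤n+o⇒m∸n≤o (suc a) L (≤-trans (s≤s (m≤n+m∸n a L)) (≤-reflexive (sym (+-suc L (a ∸ L)))))
        balance : ∀ P′x Pl Px P′l p₀ p′₀ x l Ux Ul px pl Vx V′x Vl →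
          P′x + 2 * (p′₀ + (x + suc Ux)) ≡ 2 * px + V′x → Pl + 2 * (p₀ + (l + Ul)) ≡ 2 * pl + Vl →
          Px + 2 * (p₀ + (x + Ux)) ≡ 2 * px + Vx → P′l + 2 * (p′₀ + (l + Ul)) ≡ 2 * pl + Vl →
          V′x ≤ 1 + Vx → P′x + Pl + 1 ≤ Px + P′l
        balance P′x Pl Px P′l p₀ p′₀ x l Ux Ul px pl Vx V′x Vl h₁ h₂ h₃ h₄ h₅ =
          ≤-by (suc (2 * (p₀ + p′₀ + (x + Ux) + (l + Ul))))
            (≤-trans (≤-reflexive (cong₂ _+_ h₁ h₂))
              (≤-trans (+-monoˡ-≤ (2 * pl + Vl) (+-monoʳ-≤ (2 * px) h₅))
                (≤-reflexive (trans (eq₀ px Vx (2 * pl + Vl)) (cong suc (sym (cong₂ _+_ h₃ h₄)))))))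
            (eq₁ P′x Pl p₀ p′₀ x l Ux Ul) (eq₂ Px P′l p₀ p′₀ x l Ux Ul)
          where
          eq₀ : ∀ p V w → 2 * p + (1 + V) + w ≡ suc (2 * p + V + w)
          eq₀ = solve-∀
          eq₁ : ∀ a b p p′ x l U V → a + b + 1 + suc (2 * (p + p′ + (x + U) + (l + V))) ≡
                a + 2 * (p′ + (x + suc U)) + (b + 2 * (p + (l + V)))
          eq₁ = solve-∀
          eq₂ : ∀ a b p p′ x l U V → suc (a + 2 * (p + (x + U)) + (b + 2 * (p′ + (l + V)))) ≡
                a + b + suc (2 * (p + p′ + (x + U) + (l + V)))
          eq₂ = solve-∀

    game : Game
    game = record
      { n = n ; G = G ; q = q ; State = State ; weight = weight ; paid = paid
      ; insert = λ t<n s g g<G light → let open Insert t<n s g g<G light in s′ , ρ , paid≤ , drop }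

-- Upper bounds for logarithms, and real arithmetic

module Logarithm where

  open import Defs
  open import Data.Integer as ℤ using (+_)
  import Data.Integer.Properties as ℤ
  open import Data.Nat as ℕ using (ℕ; zero; suc)
  import Data.Nat.Properties as ℕ
  open import Data.Product using (_,_)
  open import Data.Rational as ℚ using (ℚ; 0ℚ; 1ℚ; _+_; _*_; _-_; _/_; 1/_; _≤_; Positive; NonNegative; NonZero)
  import Data.Rational.Properties as ℚ
  open import Data.Rational.Solver using (module +-*-Solver)
  import Data.Rational.Unnormalised as ℚᵘ
  import Data.Rational.Unnormalised.Properties as ℚᵘ
  open import Data.Sum using ([_,_]′)
  open import Relation.Binary.PropositionalEquality
  open Series using (coeff; coeff-inverse; coeff≥0; coeff-anti; toℚᵘ-/; toℚ-mono; square≥0; x+1≢0; module Tail)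
  open Products using (0≤*; *-mono; 0≤-diff)
  open Convergence using (1-cayley²>0)

  toℚ-+ : ∀ a b → toℚ (a ℕ.+ b) ≡ toℚ a + toℚ b
  toℚ-+ a b = ℚ.toℚᵘ-injective (ℚᵘ.≃-trans (toℚᵘ-/ (+ (a ℕ.+ b)) 0) (ℚᵘ.≃-sym
    (ℚᵘ.≃-trans (ℚ.toℚᵘ-homo-+ (toℚ a) (toℚ b))
      (ℚᵘ.≃-trans (ℚᵘ.+-cong (toℚᵘ-/ (+ a) 0) (toℚᵘ-/ (+ b) 0))
        (ℚᵘ.*≡* (cong (ℤ._* + 1) (cong₂ ℤ._+_ (ℤ.*-identityʳ (+ a)) (ℤ.*-identityʳ (+ b)))))))))

  toℚ-* : ∀ a b → toℚ (a ℕ.* b) ≡ toℚ a * toℚ b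
  toℚ-* a b = ℚ.toℚᵘ-injective (ℚᵘ.≃-trans (toℚᵘ-/ (+ (a ℕ.* b)) 0) (ℚᵘ.≃-sym
    (ℚᵘ.≃-trans (ℚ.toℚᵘ-homo-* (toℚ a) (toℚ b))
      (ℚᵘ.≃-trans (ℚᵘ.*-cong (toℚᵘ-/ (+ a) 0) (toℚᵘ-/ (+ b) 0))
        (ℚᵘ.*≡* (cong (ℤ._* + 1) (sym (ℤ.pos-* a b))))))))

  toℚ-cancel-≤ : ∀ {a b} → toℚ a ≤ toℚ b → a ℕ.≤ b
  toℚ-cancel-≤ {a} {b} h with ℚᵘ.≤-respˡ-≃ (toℚᵘ-/ (+ a) 0) (ℚᵘ.≤-respʳ-≃ (toℚᵘ-/ (+ b) 0) (ℚ.toℚᵘ-mono-≤ h))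
  ... | ℚᵘ.*≤* le = ℤ.drop‿+≤+ (subst₂ ℤ._≤_ (ℤ.*-identityʳ (+ a)) (ℤ.*-identityʳ (+ b)) le)

  toℚ≥0 : ∀ a → 0ℚ ≤ toℚ a
  toℚ≥0 a = toℚ-mono {0} {a} ℕ.z≤n

  harmonic : ℕ → ℚ
  harmonic zero    = 0ℚ
  harmonic (suc k) = harmonic k + coeff k

  harmonic-block : ∀ a i → harmonic (i ℕ.+ a) ≤ harmonic a + toℚ i * coeff a
  harmonic-block a zero    = ℚ.≤-reflexive (sym (trans (cong (λ x → harmonic a + x) (ℚ.*-zeroˡ (coeff a))) (ℚ.+-identityʳ _)))
  harmonic-block a (suc i) = begin
    harmonic (i ℕ.+ a) + coeff (i ℕ.+ a)
      ≤⟨ ℚ.+-mono-≤ {harmonic (i ℕ.+ a)} {harmonic a + toℚ i * coeff a} {coeff (i ℕ.+ a)} {coeff a}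
           (harmonic-block a i) (coeff-anti (ℕ.m≤n+m a i)) ⟩
    harmonic a + toℚ i * coeff a + coeff a
      ≡⟨ cong (λ y → harmonic a + toℚ i * coeff a + y) (ℚ.*-identityˡ (coeff a)) ⟨
    harmonic a + toℚ i * coeff a + 1ℚ * coeff a
      ≡⟨ solve 4 (λ h i c o → h :+ i :* c :+ o :* c := h :+ (o :+ i) :* c) refl (harmonic a) (toℚ i) (coeff a) 1ℚ ⟩
    harmonic a + (1ℚ + toℚ i) * coeff a
      ≡⟨ cong (λ x → harmonic a + x * coeff a) (toℚ-+ 1 i) ⟨
    harmonic a + toℚ (suc i) * coeff a ∎
    where
    open ℚ.≤-Reasoning
    open +-*-Solver

  -- The block from 2ʲ to 2ʲ⁺¹ consists of 2ʲ terms that are at most 1/2ʲ.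
  harmonic-2^ : ∀ j → harmonic (2 ℕ.^ j) ≤ toℚ (suc j)
  harmonic-2^ zero    = ℚ.≤-refl
  harmonic-2^ (suc j) = begin
    harmonic (2 ℕ.^ suc j)
      ≡⟨ cong (λ x → harmonic (k ℕ.+ x)) (ℕ.+-identityʳ k) ⟩
    harmonic (k ℕ.+ k)
      ≤⟨ harmonic-block k k ⟩
    harmonic k + toℚ k * coeff k
      ≤⟨ ℚ.+-mono-≤ {harmonic k} {toℚ (suc j)} {toℚ k * coeff k} {toℚ 1} (harmonic-2^ j) block ⟩
    toℚ (suc j) + toℚ 1
      ≡⟨ toℚ-+ (suc j) 1 ⟨
    toℚ (suc j ℕ.+ 1)
      ≡⟨ cong toℚ (ℕ.+-comm (suc j) 1) ⟩
    toℚ (suc (suc j)) ∎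
    where
    open ℚ.≤-Reasoning
    k : ℕ
    k = 2 ℕ.^ j
    block : toℚ k * coeff k ≤ toℚ 1
    block = begin
      toℚ k * coeff k                  ≤⟨ ℚ.*-monoʳ-≤-nonNeg (coeff k) {{ℚ.nonNegative (coeff≥0 k)}}
                                            (toℚ-mono (ℕ.≤-trans (ℕ.m≤n*m k 2) (ℕ.n≤1+n _))) ⟩
      toℚ (suc (2 ℕ.* k)) * coeff k    ≡⟨ ℚ.*-comm _ (coeff k) ⟩
      coeff k * toℚ (suc (2 ℕ.* k))    ≡⟨ coeff-inverse k ⟩
      1ℚ                               ∎

  -- The series of ln x is cut at κ = 2ʲ ≥ x: the first κ coefficients sum to at most j + 1, and the tail is geometric
  -- of sum at most 1.
  module LnBound (x : ℚ) .{{x⁺ : Positive x}} (1≤x : 1ℚ ≤ x) (j : ℕ) (x≤ : x ≤ toℚ (2 ℕ.^ j)) where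

    open ℚ.≤-Reasoning

    κ : ℕ
    κ = 2 ℕ.^ j

    instance
      x+1⁺ : Positive (x + 1ℚ)
      x+1⁺ = ℚ.pos+pos⇒pos x 1ℚ
      nz : NonZero (x + 1ℚ)
      nz = x+1≢0 x

    v z u : ℚ
    v = 1/ (x + 1ℚ)
    z = cayley x
    u = z * z

    instance
      v⁺ : Positive v
      v⁺ = ℚ.1/pos⇒pos (x + 1ℚ)
      v⁰ : NonNegative v
      v⁰ = ℚ.pos⇒nonNeg v

    inverse : (x + 1ℚ) * v ≡ 1ℚ
    inverse = ℚ.*-inverseʳ (x + 1ℚ)

    z≥0 : 0ℚ ≤ z
    z≥0 = 0≤* (0≤-diff 1≤x) (ℚ.nonNegative⁻¹ v)

    z≤1 : z ≤ 1ℚ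
    z≤1 = begin
      (x - 1ℚ) * v  ≤⟨ ℚ.*-monoʳ-≤-nonNeg v (ℚ.+-monoʳ-≤ x (ℚ.≤-trans (ℚ.neg-antimono-≤ (ℚ.<⇒≤ (ℚ.positive⁻¹ 1ℚ))) (ℚ.<⇒≤ (ℚ.positive⁻¹ 1ℚ)))) ⟩
      (x + 1ℚ) * v  ≡⟨ inverse ⟩
      1ℚ            ∎

    coeffκ≤v : coeff κ ≤ v
    coeffκ≤v = begin
      coeff κ                                ≡⟨ ℚ.*-identityʳ (coeff κ) ⟨
      coeff κ * 1ℚ                           ≡⟨ cong (coeff κ *_) inverse ⟨
      coeff κ * ((x + 1ℚ) * v)               ≤⟨ ℚ.*-monoˡ-≤-nonNeg (coeff κ) {{ℚ.nonNegative (coeff≥0 κ)}}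
                                                  (ℚ.*-monoʳ-≤-nonNeg v x+1≤) ⟩
      coeff κ * (toℚ (suc (2 ℕ.* κ)) * v)    ≡⟨ ℚ.*-assoc (coeff κ) _ v ⟨
      coeff κ * toℚ (suc (2 ℕ.* κ)) * v      ≡⟨ cong (_* v) (coeff-inverse κ) ⟩
      1ℚ * v                                 ≡⟨ ℚ.*-identityˡ v ⟩
      v ∎
      where
      x+1≤ : x + 1ℚ ≤ toℚ (suc (2 ℕ.* κ))
      x+1≤ = begin
        x + 1ℚ                ≤⟨ ℚ.+-monoˡ-≤ 1ℚ x≤ ⟩
        toℚ κ + toℚ 1         ≡⟨ toℚ-+ κ 1 ⟨
        toℚ (κ ℕ.+ 1)         ≡⟨ cong toℚ (ℕ.+-comm κ 1) ⟩
        toℚ (suc κ)           ≤⟨ toℚ-mono (ℕ.s≤s (ℕ.m≤n*m κ 2)) ⟩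
        toℚ (suc (2 ℕ.* κ))   ∎

    -- As `z = (x - 1) * v` and `(x + 1) * v = 1`, the right side is `4 * x * v * v`, whereas
    -- `v = (x + 1) * v * v` is at most `2 * x * v * v`.
    v≤1-u : v ≤ 1ℚ - u
    v≤1-u = begin
      v                            ≡⟨ ℚ.*-identityʳ v ⟨
      v * 1ℚ                       ≡⟨ cong (v *_) inverse ⟨
      v * ((x + 1ℚ) * v)           ≤⟨ ℚ.*-monoˡ-≤-nonNeg v (ℚ.*-monoʳ-≤-nonNeg v (ℚ.+-monoʳ-≤ x 1≤x)) ⟩
      v * ((x + x) * v)            ≡⟨ ℚ.+-identityˡ _ ⟨
      0ℚ + v * ((x + x) * v)       ≤⟨ ℚ.+-monoˡ-≤ (v * ((x + x) * v)) (0≤* (ℚ.nonNegative⁻¹ v) (0≤* x+x≥0 (ℚ.nonNegative⁻¹ v))) ⟩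
      v * ((x + x) * v) + v * ((x + x) * v)
        ≡⟨ cong (λ y → v * (y * v) + v * (y * v)) (cong₂ _+_ (sym (ℚ.*-identityˡ x)) (sym (ℚ.*-identityˡ x))) ⟩
      v * ((1ℚ * x + 1ℚ * x) * v) + v * ((1ℚ * x + 1ℚ * x) * v)
        ≡⟨ solve 3 (λ x v o → v :* ((o :* x :+ o :* x) :* v) :+ v :* ((o :* x :+ o :* x) :* v) :=
             (x :+ o) :* v :* ((x :+ o) :* v) :- (x :- o) :* v :* ((x :- o) :* v)) refl x v 1ℚ ⟩
      (x + 1ℚ) * v * ((x + 1ℚ) * v) - u
        ≡⟨ cong (_- u) (trans (cong₂ _*_ inverse inverse) (ℚ.*-identityˡ 1ℚ)) ⟩
      1ℚ - u ∎
      where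
      open +-*-Solver
      x≥0 : 0ℚ ≤ x
      x≥0 = ℚ.≤-trans (ℚ.<⇒≤ (ℚ.positive⁻¹ 1ℚ)) 1≤x
      x+x≥0 : 0ℚ ≤ x + x
      x+x≥0 = ℚ.≤-trans x≥0 (ℚ.≤-trans (ℚ.≤-reflexive (sym (ℚ.+-identityʳ x))) (ℚ.+-monoʳ-≤ x x≥0))

    open Tail u (square≥0 z) (1-cayley²>0 x) using (S; V; w; w≥0; pow≥0; pow≤1; S-mono; V-anti)
    module T = Tail u (square≥0 z) (1-cayley²>0 x)

    sum≤harmonic : ∀ k → S k ≤ harmonic k
    sum≤harmonic zero    = ℚ.≤-refl
    sum≤harmonic (suc k) = ℚ.+-mono-≤ {S k} {harmonic k} {coeff k * u ^ k} {coeff k} (sum≤harmonic k) (ℚ.≤-trans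
      (ℚ.*-monoˡ-≤-nonNeg (coeff k) {{ℚ.nonNegative (coeff≥0 k)}} (pow≤1 k)) (ℚ.≤-reflexive (ℚ.*-identityʳ (coeff k))))

    tail≤1 : w * (coeff κ * u ^ κ) ≤ 1ℚ
    tail≤1 = begin
      w * (coeff κ * u ^ κ)  ≤⟨ ℚ.*-monoˡ-≤-nonNeg w {{ℚ.nonNegative w≥0}}
                                  (ℚ.*-monoˡ-≤-nonNeg (coeff κ) {{ℚ.nonNegative (coeff≥0 κ)}} (pow≤1 κ)) ⟩
      w * (coeff κ * 1ℚ)     ≡⟨ cong (w *_) (ℚ.*-identityʳ (coeff κ)) ⟩
      w * coeff κ            ≤⟨ ℚ.*-monoˡ-≤-nonNeg w {{ℚ.nonNegative w≥0}} (ℚ.≤-trans coeffκ≤v v≤1-u) ⟩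
      w * (1ℚ - u)           ≡⟨ ℚ.*-inverseˡ (1ℚ - u) {{T.1-u≢0}} ⟩
      1ℚ                     ∎

    -- `S` increases, `V` decreases and `S ≤ V`, so the single value `V κ` bounds all partial sums.
    S≤ : ∀ i → S i ≤ toℚ (2 ℕ.+ j)
    S≤ i = begin
      S i                        ≤⟨ S≤V i ⟩
      S κ + w * (coeff κ * u ^ κ) ≤⟨ ℚ.+-mono-≤ {S κ} {toℚ (suc j)} {w * (coeff κ * u ^ κ)} {1ℚ} (ℚ.≤-trans {S κ} {harmonic κ} {toℚ (suc j)} (sum≤harmonic κ) (harmonic-2^ j)) tail≤1 ⟩
      toℚ (suc j) + toℚ 1        ≡⟨ toℚ-+ (suc j) 1 ⟨
      toℚ (suc j ℕ.+ 1)          ≡⟨ cong toℚ (ℕ.+-comm (suc j) 1) ⟩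
      toℚ (2 ℕ.+ j)              ∎
      where
      term≥0 : ∀ i → 0ℚ ≤ w * (coeff i * u ^ i)
      term≥0 i = 0≤* w≥0 (0≤* (coeff≥0 i) (pow≥0 i))
      S≤S+ : ∀ i y → 0ℚ ≤ y → S i ≤ S i + y
      S≤S+ i y y≥0 = ℚ.≤-trans {S i} {S i + 0ℚ} {S i + y} (ℚ.≤-reflexive (sym (ℚ.+-identityʳ (S i)))) (ℚ.+-monoʳ-≤ (S i) y≥0)
      S≤V : ∀ i → S i ≤ V κ
      S≤V i = [ (λ i≤κ → ℚ.≤-trans {S i} {S κ} {V κ} (S-mono i κ (ℕ.≤⇒≤′ i≤κ)) (S≤S+ κ (w * (coeff κ * u ^ κ)) (term≥0 κ)))
              , (λ κ≤i → ℚ.≤-trans {S i} {V i} {V κ} (S≤S+ i (w * (coeff i * u ^ i)) (term≥0 i)) (V-anti κ i (ℕ.≤⇒≤′ κ≤i)))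
              ]′ (ℕ.≤-total i κ)

    S≥0 : ∀ i → 0ℚ ≤ S i
    S≥0 i = S-mono 0 i (ℕ.≤⇒≤′ ℕ.z≤n)

    ln≥0 : ∀ i → 0ℚ ≤ approx (ln x) i
    ln≥0 i = 0≤* {z + z} {S i} (ℚ.+-mono-≤ {0ℚ} {z} {0ℚ} {z} z≥0 z≥0) (S≥0 i)

    ln≤ : ∀ i → approx (ln x) i ≤ toℚ (2 ℕ.* (2 ℕ.+ j))
    ln≤ i = begin
      (z + z) * S i            ≤⟨ *-mono {z + z} {1ℚ + 1ℚ} {S i} {toℚ (2 ℕ.+ j)} 0≤2 (S≥0 i)
                                    (ℚ.+-mono-≤ {z} {1ℚ} {z} {1ℚ} z≤1 z≤1) (S≤ i) ⟩
      toℚ 2 * toℚ (2 ℕ.+ j)    ≡⟨ toℚ-* 2 (2 ℕ.+ j) ⟨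
      toℚ (2 ℕ.* (2 ℕ.+ j))    ∎
      where
      0≤2 : 0ℚ ≤ 1ℚ + 1ℚ
      0≤2 = toℚ≥0 2

  /-cancel : ∀ a m .{{_ : ℕ.NonZero m}} → + a / m * toℚ m ≡ toℚ a
  /-cancel a (suc m) = ℚ.toℚᵘ-injective (ℚᵘ.≃-trans (ℚ.toℚᵘ-homo-* (+ a / suc m) (toℚ (suc m)))
    (ℚᵘ.≃-trans (ℚᵘ.*-cong (toℚᵘ-/ (+ a) m) (toℚᵘ-/ (+ suc m) 0))
      (ℚᵘ.≃-trans (ℚᵘ.*≡* (trans (ℤ.*-identityʳ _) (cong (+ a ℤ.*_) (sym (ℤ.*-identityʳ (+ suc m))))))
        (ℚᵘ.≃-sym (toℚᵘ-/ (+ a) 0)))))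

  -- The bounds hold for every approximant, so the comparison of limits follows term by term, from
  -- index 0 on.
  product≤ : ∀ C n A B c .{{_ : ℕ.NonZero C}} (x y : ℝ) →
    (∀ i → 0ℚ ≤ approx x i) → (∀ i → approx x i ≤ toℚ A) →
    (∀ i → 0ℚ ≤ approx y i) → (∀ i → approx y i ≤ toℚ B) →
    n ℕ.* (A ℕ.* A) ℕ.* B ℕ.≤ c ℕ.* C →
    fromℚ (toℚ c) ≥ℝ fromℚ (+ 1 / C) *ℝ fromℚ (toℚ n) *ℝ (x *ℝ x) *ℝ y
  product≤ C n A B c x y x≥0 x≤ y≥0 y≤ h ε ε>0 = 0 , λ i _ → ℚ.≤-trans (main i) below
    where
    open ℚ.≤-Reasoning
    p : ℚ
    p = + 1 / C
    instance
      C⁺ : Positive (toℚ C)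
      C⁺ = toℚ⁺ C
    p≥0 : 0ℚ ≤ p
    p≥0 = ℚ.*-cancelʳ-≤-pos {0ℚ} {p} (toℚ C) (begin
      0ℚ * toℚ C   ≡⟨ ℚ.*-zeroˡ (toℚ C) ⟩
      0ℚ           ≤⟨ toℚ≥0 1 ⟩
      toℚ 1        ≡⟨ /-cancel 1 C ⟨
      p * toℚ C    ∎)
    main : ∀ i → p * toℚ n * (approx x i * approx x i) * approx y i ≤ toℚ c
    main i = begin
      p * toℚ n * (a * a) * b
        ≤⟨ *-mono {p * toℚ n * (a * a)} {p * toℚ n * (toℚ A * toℚ A)} {b} {toℚ B} pnAA≥0 (y≥0 i)
             (ℚ.*-monoˡ-≤-nonNeg (p * toℚ n) {{ℚ.nonNegative pn≥0}}
               (*-mono {a} {toℚ A} {a} {toℚ A} (toℚ≥0 A) (x≥0 i) (x≤ i) (x≤ i)))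
             (y≤ i) ⟩
      p * toℚ n * (toℚ A * toℚ A) * toℚ B
        ≡⟨ solve 4 (λ p n A B → p :* n :* (A :* A) :* B := p :* (n :* (A :* A) :* B)) refl p (toℚ n) (toℚ A) (toℚ B) ⟩
      p * (toℚ n * (toℚ A * toℚ A) * toℚ B)
        ≡⟨ cong (p *_) (trans (toℚ-* (n ℕ.* (A ℕ.* A)) B)
             (cong (_* toℚ B) (trans (toℚ-* n (A ℕ.* A)) (cong (toℚ n *_) (toℚ-* A A))))) ⟨
      p * toℚ (n ℕ.* (A ℕ.* A) ℕ.* B)
        ≤⟨ ℚ.*-monoˡ-≤-nonNeg p {{ℚ.nonNegative p≥0}} (toℚ-mono h) ⟩
      p * toℚ (c ℕ.* C)
        ≡⟨ cong (p *_) (toℚ-* c C) ⟩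
      p * (toℚ c * toℚ C)
        ≡⟨ solve 3 (λ p c C → p :* (c :* C) := c :* (p :* C)) refl p (toℚ c) (toℚ C) ⟩
      toℚ c * (p * toℚ C)
        ≡⟨ trans (cong (toℚ c *_) (/-cancel 1 C)) (ℚ.*-identityʳ (toℚ c)) ⟩
      toℚ c ∎
      where
      open +-*-Solver
      a b : ℚ
      a = approx x i
      b = approx y i
      pn≥0 : 0ℚ ≤ p * toℚ n
      pn≥0 = 0≤* p≥0 (toℚ≥0 n)
      pnAA≥0 : 0ℚ ≤ p * toℚ n * (toℚ A * toℚ A)
      pnAA≥0 = 0≤* {p * toℚ n} {toℚ A * toℚ A} pn≥0 (0≤* (toℚ≥0 A) (toℚ≥0 A))
    below : toℚ c ≤ toℚ c + ε
    below = ℚ.≤-trans (ℚ.≤-reflexive (sym (ℚ.+-identityʳ (toℚ c)))) (ℚ.+-monoʳ-≤ (toℚ c) (ℚ.<⇒≤ ε>0))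

  1/[1-n/m]*D≡m : ∀ n D .{{m≢0 : ℕ.NonZero (D ℕ.+ n)}} .{{nz : NonZero (1ℚ - + n / (D ℕ.+ n))}} →
                  1/ (1ℚ - + n / (D ℕ.+ n)) * toℚ D ≡ toℚ (D ℕ.+ n)
  1/[1-n/m]*D≡m n D = begin-equality
    1/ d * toℚ D         ≡⟨ cong (1/ d *_) d*m≡D ⟨
    1/ d * (d * toℚ m)   ≡⟨ ℚ.*-assoc (1/ d) d (toℚ m) ⟨
    1/ d * d * toℚ m     ≡⟨ cong (_* toℚ m) (ℚ.*-inverseˡ d) ⟩
    1ℚ * toℚ m           ≡⟨ ℚ.*-identityˡ (toℚ m) ⟩
    toℚ m                ∎
    where
    open ℚ.≤-Reasoning
    m : ℕ
    m = D ℕ.+ n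
    d : ℚ
    d = 1ℚ - + n / m
    d*m≡D : d * toℚ m ≡ toℚ D
    d*m≡D = begin-equality
      d * toℚ m                          ≡⟨ solve 3 (λ o p q → (o :- p) :* q := o :* q :- p :* q) refl 1ℚ (+ n / m) (toℚ m) ⟩
      1ℚ * toℚ m - + n / m * toℚ m       ≡⟨ cong₂ _-_ (trans (ℚ.*-identityˡ (toℚ m)) (toℚ-+ D n)) (/-cancel n m) ⟩
      toℚ D + toℚ n - toℚ n              ≡⟨ solve 2 (λ a b → a :+ b :- b := a) refl (toℚ D) (toℚ n) ⟩
      toℚ D                              ∎
      where open +-*-Solver

  module Ratio (n D : ℕ) (x : ℚ) (x*D≡m : x * toℚ D ≡ toℚ (D ℕ.+ n)) (D>0 : 0 ℕ.< D) (D≤n : D ℕ.≤ n) where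

    open ℚ.≤-Reasoning

    m : ℕ
    m = D ℕ.+ n

    instance
      D⁺ : Positive (toℚ D)
      D⁺ = toℚ⁺ D {{ℕ.>-nonZero D>0}}

    x≤ : ∀ k → m ℕ.≤ k ℕ.* D → x ≤ toℚ k
    x≤ k h = ℚ.*-cancelʳ-≤-pos {x} {toℚ k} (toℚ D) (begin
      x * toℚ D         ≡⟨ x*D≡m ⟩
      toℚ m             ≤⟨ toℚ-mono h ⟩
      toℚ (k ℕ.* D)     ≡⟨ toℚ-* k D ⟩
      toℚ k * toℚ D     ∎)

    2≤x : toℚ 2 ≤ x
    2≤x = ℚ.*-cancelʳ-≤-pos {toℚ 2} {x} (toℚ D) (begin
      toℚ 2 * toℚ D     ≡⟨ toℚ-* 2 D ⟨
      toℚ (2 ℕ.* D)     ≤⟨ toℚ-mono (ℕ.+-monoʳ-≤ D (ℕ.≤-trans (ℕ.≤-reflexive (ℕ.+-identityʳ D)) D≤n)) ⟩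
      toℚ m             ≡⟨ x*D≡m ⟨
      x * toℚ D         ∎)

    1≤x : 1ℚ ≤ x
    1≤x = ℚ.≤-trans (toℚ-mono {1} {2} (ℕ.s≤s ℕ.z≤n)) 2≤x

    power : ∀ k → toℚ (2 ℕ.^ k) ≤ x ^ k
    power zero    = ℚ.≤-refl
    power (suc k) = ℚ.≤-trans (ℚ.≤-reflexive (toℚ-* 2 (2 ℕ.^ k)))
      (*-mono {toℚ 2} {x} {toℚ (2 ℕ.^ k)} {x ^ k} (ℚ.≤-trans (toℚ≥0 1) 1≤x) (toℚ≥0 (2 ℕ.^ k)) 2≤x (power k))

    -- One factor `x = m / D` of the power is kept exactly; the other `k` factors are each estimated
    -- by 2.
    range : ∀ k r → toℚ r ℚ.≥ x ^ suc k * toℚ n → 2 ℕ.^ k ℕ.* n ℕ.* m ℕ.≤ r ℕ.* D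
    range k r h = toℚ-cancel-≤ (begin
      toℚ (2 ℕ.^ k ℕ.* n ℕ.* m)       ≡⟨ trans (toℚ-* (2 ℕ.^ k ℕ.* n) m) (cong (_* toℚ m) (toℚ-* (2 ℕ.^ k) n)) ⟩
      toℚ (2 ℕ.^ k) * toℚ n * toℚ m   ≡⟨ ℚ.*-assoc (toℚ (2 ℕ.^ k)) (toℚ n) (toℚ m) ⟩
      toℚ (2 ℕ.^ k) * (toℚ n * toℚ m) ≤⟨ ℚ.*-monoʳ-≤-nonNeg (toℚ n * toℚ m) {{ℚ.nonNegative (0≤* (toℚ≥0 n) (toℚ≥0 m))}} (power k) ⟩
      x ^ k * (toℚ n * toℚ m)         ≡⟨ cong (λ y → x ^ k * (toℚ n * y)) x*D≡m ⟨
      x ^ k * (toℚ n * (x * toℚ D))   ≡⟨ solve 4 (λ p n x D → p :* (n :* (x :* D)) := x :* p :* n :* D) refl (x ^ k) (toℚ n) x (toℚ D) ⟩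
      x * x ^ k * toℚ n * toℚ D       ≤⟨ ℚ.*-monoʳ-≤-nonNeg (toℚ D) {{ℚ.nonNegative (toℚ≥0 D)}} h ⟩
      toℚ r * toℚ D                   ≡⟨ toℚ-* r D ⟨
      toℚ (r ℕ.* D)                   ∎)
      where open +-*-Solver

-- From the strategy to the bound for `χ`

open import Defs
open import Data.Integer using (+_)
open import Data.Nat using (ℕ; >-nonZero; _≤_; _<_; _>_; _*_)
open import Data.Nat.Properties using (<⇒≤; m<n⇒0<n; <-≤-trans)
open import Data.Product using (Σ-syntax; _×_)
open import Data.Rational as ℚ using (1ℚ; _/_; _-_; 1/_)
import Data.Rational.Properties as ℚ
open import Data.Nat as ℕ using (suc; NonZero; z≤n; s≤s; _+_; _∸_)
open import Data.Nat.Properties as ℕ using (≤-trans; ≤-reflexive; m∸n+n≡m; m≤m+n; +-cancelʳ-<; *-monoʳ-≤; *-mono-≤; +-identityʳ; m^n>0; +-monoˡ-≤; m≤m*n)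
open import Data.Nat.Tactic.RingSolver using (solve-∀)
open import Data.Product using (∃; _,_)
open import Data.Rational using (Positive)
open import Relation.Binary.PropositionalEquality using (_≡_; refl; sym; trans; cong; subst)
open OnlineLabeling using (Algorithm; totalCost; optimalAlgorithm; worstCase; module Maximum; module Minimum)
open Strategy using (κ; κ≡; module Loop)
open Constants using (base; 2≤base; module Parameters)
open Play using (module Adversary)
open Logarithm using (module LnBound; module Ratio; product≤; 1/[1-n/m]*D≡m)

-- The minimum is attained, so it suffices to run the adversary against this one algorithm.
χ-attained : ∀ {n m r} .(n≤m : n ≤ m) .(m<r : m < r) →
             ∃ λ (A : Algorithm n m r) → ∀ ys → totalCost A ys ≤ χ n m r n≤m m<r
χ-attained {n} {m} {r} n≤m m<r = A , Maximum.bound (worstCase _ A)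
  where
  A : Algorithm n m r
  A = Minimum.arg (optimalAlgorithm n m r n≤m m<r)

abstract
  -- The factors come from `n ≤ 5 * G`, `ln n ≤ 404 * R` twice, `ln x ≤ 16 * suc J`, and the
  -- relocations `R * R * G / κ` per phase.
  C₃ : ℕ
  C₃ = 5 * (404 * 404) * 16 * κ

  C₃≡ : C₃ ≡ 5 * (404 * 404) * 16 * κ
  C₃≡ = refl

C₃>0 : 0 < C₃
C₃>0 = subst (0 <_) (sym (trans C₃≡ (cong (λ k → 5 * (404 * 404) * 16 * k) κ≡))) (s≤s z≤n)

module LowerBound (n D r : ℕ) (n≥ : base ℕ.^ 20 ≤ n) (D>0 : 0 < D) (D<n : D < n)
  (range : 2 ℕ.^ 10 * n * (D + n) ≤ r * D) where

  open Parameters n D n≥ D>0 D<n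

  cost≥ : (A : Algorithm n m r) → ∃ λ ys → suc J * (R * R * G) ≤ κ * totalCost A ys
  cost≥ A =
    let s , h = Loop.loop game m D L R s₀ e refl D≤e e≤m 4≤e qn≤Le R>0 384≤R² 15≤s₀ RG≤ size 27m<qG
                  (λ H s → State.bounded s H) J H₀ initial m≡ J≤
    in State.ys s , ≤-trans (m≤m+n _ (κ * paid initial)) h
    where
    open Adversary A G L q (s≤s z≤n) G<n (room r range)

  χ≥ : .(n≤m : n ≤ m) .(m<r : m < r) → suc J * (R * R * G) ≤ κ * χ n m r n≤m m<r
  χ≥ n≤m m<r =
    let A , ≤χ = χ-attained n≤m m<r
        ys , h = cost≥ A
    in ≤-trans h (*-monoʳ-≤ κ (≤χ ys))

  lnₙ lnₓ : ℕ
  lnₙ = 404 * R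
  lnₓ = 16 * suc J

  product : ∀ c → suc J * (R * R * G) ≤ κ * c → n * (lnₙ * lnₙ) * lnₓ ≤ c * C₃
  product c h = subst (λ C → n * (lnₙ * lnₙ) * lnₓ ≤ c * C) (sym C₃≡) (go 404 16 κ h)
    where
    open ℕ.≤-Reasoning
    go : ∀ a b k → suc J * (R * R * G) ≤ k * c → n * (a * R * (a * R)) * (b * suc J) ≤ c * (5 * (a * a) * b * k)
    go a b k h = begin
      n * (a * R * (a * R)) * (b * suc J)                ≤⟨ *-mono-≤ (*-mono-≤ n≤5G (ℕ.≤-refl {a * R * (a * R)})) (ℕ.≤-refl {b * suc J}) ⟩
      5 * G * (a * R * (a * R)) * (b * suc J)            ≡⟨ eq G a R b (suc J) ⟩
      5 * (a * a) * b * (suc J * (R * R * G))            ≤⟨ *-monoʳ-≤ (5 * (a * a) * b) h ⟩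
      5 * (a * a) * b * (k * c)                          ≡⟨ eq′ (5 * (a * a) * b) k c ⟩
      c * (5 * (a * a) * b * k)                          ∎
      where
      eq : ∀ G a R b J → 5 * G * (a * R * (a * R)) * (b * J) ≡ 5 * (a * a) * b * (J * (R * R * G))
      eq = solve-∀
      eq′ : ∀ x k c → x * (k * c) ≡ c * (x * k)
      eq′ = solve-∀

  lnₙ≥ : 2 * (2 + 100 * suc R) ≤ lnₙ
  lnₙ≥ = ≤-trans (≤-reflexive (eq R)) (≤-trans (+-monoˡ-≤ (200 * R) (m≤m*n 204 R {{>-nonZero R>0}})) (≤-reflexive (eq′ R)))
    where
    eq : ∀ R → 2 * (2 + 100 * suc R) ≡ 204 + 200 * R
    eq = solve-∀
    eq′ : ∀ R → 204 * R + 200 * R ≡ 404 * R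
    eq′ = solve-∀

  lnₓ≥ : 2 * (2 + 2 * (3 + J)) ≤ lnₓ
  lnₓ≥ = ≤-trans (m≤m+n _ (12 * J)) (≤-reflexive (eq J))
    where
    eq : ∀ J → 2 * (2 + 2 * (3 + J)) + 12 * J ≡ 16 * suc J
    eq = solve-∀


bound : ∀ n D r x .{{C₃≢0 : NonZero C₃}} .{{n⁺ : Positive (toℚ n)}} .{{x⁺ : Positive x}} →
  base ℕ.^ 20 ≤ n → (n<m : n < D + n) → D + n < 2 * n → (m<r : D + n < r) →
  x ℚ.* toℚ D ≡ toℚ (D + n) → toℚ r ℚ.≥ x ^ 11 ℚ.* toℚ n →
  fromℚ (toℚ (χ n (D + n) r (<⇒≤ n<m) m<r)) ≥ℝ
    fromℚ (+ 1 / C₃) *ℝ fromℚ (toℚ n) *ℝ (ln (toℚ n) *ℝ ln (toℚ n)) *ℝ ln x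
bound n D r x n≥ n<m m<2n m<r x*D≡m h =
  product≤ C₃ n lnₙ lnₓ c (ln (toℚ n)) (ln x)
    LnN.ln≥0 (λ i → ℚ.≤-trans (LnN.ln≤ i) (Series.toℚ-mono lnₙ≥))
    LnX.ln≥0 (λ i → ℚ.≤-trans (LnX.ln≤ i) (Series.toℚ-mono lnₓ≥))
    (product c (χ≥ (<⇒≤ n<m) m<r))
  where
  c : ℕ
  c = χ n (D + n) r (<⇒≤ n<m) m<r
  D>0 : 0 < D
  D>0 = +-cancelʳ-< n 0 D n<m
  D<n : D < n
  D<n = +-cancelʳ-< n D n (<-≤-trans m<2n (≤-reflexive (cong (λ k → n + k) (+-identityʳ n))))
  open Ratio n D x x*D≡m D>0 (<⇒≤ D<n) using (x≤; 1≤x; range)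
  open LowerBound n D r n≥ D>0 D<n (range 10 r h)
  open Parameters n D n≥ D>0 D<n using (n>0; n≤2^; ratio≤; R; J)
  module LnN = LnBound (toℚ n) (Series.toℚ-mono n>0) (100 * suc R) (Series.toℚ-mono n≤2^)
  module LnX = LnBound x 1≤x (2 * (3 + J)) (x≤ (2 ℕ.^ (2 * (3 + J))) ratio≤)

density-bound : ∀ n D m r → m ≡ D + n →
  .{{C₃≢0 : NonZero C₃}} .{{n⁺ : Positive (toℚ n)}} .{{m≢0 : NonZero m}}
  .{{d≢0 : ℚ.NonZero (1ℚ - + n / m)}} .{{1/d⁺ : Positive (1/ (1ℚ - + n / m))}} →
  base ℕ.^ 20 ≤ n → (n<m : n < m) → m < 2 * n → (m<r : m < r) →
  toℚ r ℚ.≥ (1/ (1ℚ - + n / m)) ^ 11 ℚ.* toℚ n →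
  fromℚ (toℚ (χ n m r (<⇒≤ n<m) m<r)) ≥ℝ
    fromℚ (+ 1 / C₃) *ℝ fromℚ (toℚ n) *ℝ (ln (toℚ n) *ℝ ln (toℚ n)) *ℝ ln (1/ (1ℚ - + n / m))
density-bound n D _ r refl n≥ n<m m<2n m<r h =
  bound n D r (1/ (1ℚ - + n / (D + n))) n≥ n<m m<2n m<r (1/[1-n/m]*D≡m n D) h

base^20>0 : 0 < base ℕ.^ 20
base^20>0 = m^n>0 base {{>-nonZero (<⇒≤ 2≤base)}} 20

theorem2 :
    Σ[ C₀ ∈ ℕ ] Σ[ C₂ ∈ ℕ ] Σ[ C₃ ∈ ℕ ] Σ[ C₀>0 ∈ C₀ > 0 ] C₂ > 0 × Σ[ C₃>0 ∈ C₃ > 0 ]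
      ∀ (n m r : ℕ) → (C₀≤n : C₀ ≤ n) → (n<m : n < m) → m < 2 * n → (m<r : m < r) →
      let instance
            n≢0   = >-nonZero (<-≤-trans C₀>0 C₀≤n)
            m≢0   = >-nonZero (m<n⇒0<n n<m)
            C₃≢0  = >-nonZero C₃>0
            n⁺    = toℚ⁺ n
            d⁺    = 1-δ⁺ n<m
            d≢0   = ℚ.pos⇒nonZero (1ℚ - + n / m)
            1/d⁺  = ℚ.1/pos⇒pos (1ℚ - + n / m)
          δ = + n / m
      in
      toℚ r ℚ.≥ (1/ (1ℚ - δ)) ^ C₂ ℚ.* toℚ n →
      fromℚ (toℚ (χ n m r (<⇒≤ n<m) m<r)) ≥ℝ
        fromℚ (+ 1 / C₃) *ℝ fromℚ (toℚ n) *ℝ (ln (toℚ n) *ℝ ln (toℚ n)) *ℝ ln (1/ (1ℚ - δ))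
-- `base ^ 20` ensures `R ≥ 20`, hence `R * R ≥ 384`. Of the 11 factors `1 / (1 - δ) ≥ 2`, ten give
-- the `2 ^ 10` in `room` and one gives `m / D`.
theorem2 = base ℕ.^ 20 , 11 , C₃ , base^20>0 , s≤s z≤n , C₃>0 , λ n m r C₀≤n n<m m<2n m<r h →
  let instance
        n≢0  = >-nonZero (<-≤-trans base^20>0 C₀≤n)
        m≢0  = >-nonZero (m<n⇒0<n n<m)
        C₃≢0 = >-nonZero C₃>0
        n⁺   = toℚ⁺ n
        d⁺   = 1-δ⁺ n<m
        d≢0  = ℚ.pos⇒nonZero (1ℚ - + n / m)
        1/d⁺ = ℚ.1/pos⇒pos (1ℚ - + n / m)
  in density-bound n (m ∸ n) m r (sym (m∸n+n≡m (<⇒≤ n<m))) C₀≤n n<m m<2n m<r h
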